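{- For every integer $n\geq 1$, the $(3,1)$-polygraph $\Sigma^{\mathrm{styl,coh}}(n)$ (defined in the context) is a finite coherent presentation of the stylic monoid $\mathrm{Styl}_n$. After identifying each generator $r_x$ ($x\in[n]$) with the letter $x$, its underlying $2$-polygraph is the letter presentation $\Sigma^{\mathrm{styl}}(n)$, whose generating $1$-cells are the letters of $[n]$ and whose generating $2$-cells are $\eta_x\colon xx\Rightarrow x$ ($x\in[n]$), $\kappa_{x,y,z}\colon zxy\Rightarrow xzy$ ($x\leq y<z$) and $\lambda_{x,y,z}\colon yzx\Rightarrow yxz$ ($x<y\leq z$). Its generating $3$-cells form an effectively computable finite homotopy basis of the track $2$-category $\Sigma^{\mathrm{styl}}(n)_2^\top$.
   Context: **Rows and $N$-tableaux.** Fix $n\geq1$, $[n]=\{1<2<\cdots<n\}$. For a word $w$ over $[n]$, $\ell(w)$ is its length and $\mathrm{supp}(w)$ its set of letters. A row is a nonempty strictly increasing word over $[n]$, identified with its support; $\mathcal R_n$ is the set of rows, and $\overline{\mathcal R}_n$ the set of rows of length $\geq2$. For rows $u,v$, $u\triangleleft v$ means $\mathrm{supp}(u)\subseteq\mathrm{supp}(v)$ and $\min(v)<\min(u)$. An $N$-tableau $T$ is a finite sequence of rows $u_k,\dots,u_1$ (top to bottom) with $u_{i+1}\triangleleft u_i$ for all $i$; $\mathcal R(T):=r_{u_k}\cdots r_{u_1}$ is its row-generator reading. Right $N$-insertion of a letter $x$: insert $x$ in the bottom row $u_1$, i.e. replace $u_1$ by the row with support $\mathrm{supp}(u_1)\cup\{x\}$;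 if $u_1$ has a letter $>x$, the smallest such letter $y$ is bumped (it also stays in the row) and is inserted in the same way into the next row above, and so on; a letter bumped from the top row creates a new top row consisting of that letter. For a word $w$, $N(w)$ is obtained by inserting its letters from left to right starting from the empty tableau (inserting $x$ in the empty tableau gives the one-row tableau $x$). For rows $u,v$, $N(uv)$ has at most two rows. **Polygraphs.** A $2$-polygraph $\Sigma=(\Sigma_1,\Sigma_2)$ is a set $\Sigma_1$ together with a set $\Sigma_2$ of $2$-cells $\beta\colon u\Rightarrow v$ between words of $\Sigma_1^*$; it presents the quotient $\overline\Sigma$ of $\Sigma_1^*$ by the congruence generated by $\Sigma_2$. $\Sigma_2^*$ (resp. $\Sigma_2^\top$) is the free $2$-category (resp. free $(2,1)$-category, called track $2$-category) on $\Sigma$; $0$-composition is written by juxtaposition, $1$-composition by $\star_1$. A $(3,1)$-polygraph $(\Sigma,\Sigma_3)$ is a $2$-polygraph with a set $\Sigma_3$ of generating $3$-cells $A\colon f\Rrightarrow g$ between parallel $2$-cells $f,g$ of $\Sigma_2^\top$. $\Sigma_3$ is a homotopy basis of $\Sigma_2^\top$ if every pair of parallel $2$-cells $(f,g)$ of $\Sigma_2^\top$ is filled by a $3$-cell $f\Rrightarrow g$ of the free $(3,1)$-category generated by $(\Sigma,\Sigma_3)$. $(\Sigma,\Sigma_3)$ is a coherent presentation of a monoid $M$ if $\Sigma$ presents $M$ and $\Sigma_3$ is a homotopy basis of $\Sigma_2^\top$; it is finite if all generating sets are finite. The stylic monoid $\mathrm{Styl}_n$ is the monoid presented by $\Sigma^{\mathrm{styl}}(n)$.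 **Row presentation.** $\Sigma^{\mathrm{row}}(n)$ has generating $1$-cells $r_u$, $u\in\mathcal R_n$, and generating $2$-cells $\alpha_{u,v}\colon r_ur_v\Rightarrow\mathcal R(N(uv))$ for all rows $u,v$ with $u\not\triangleleft v$. It is known to be convergent and to present $\mathrm{Styl}_n$, with irreducible words the $\mathcal R(T)$, $T$ an $N$-tableau. For a word $w$ in the $r_u$, $\Lambda_w\colon w\Rightarrow\widehat w$ is the leftmost normalization path to its normal form $\widehat w$ (always rewrite the leftmost reducible adjacent pair). $\mathfrak C_n=\{(u,v,t)\in\mathcal R_n^3\mid u\not\triangleleft v,\ v\not\triangleleft t\}$. For a row $u$ with $\ell(u)\ge2$, $\partial u$ is $u$ with its first letter removed; $\mathfrak S_n=\{(u,v,t)\in\mathfrak C_n\mid \ell(u)\geq2,\ \partial u\not\triangleleft v\}$; $\mathfrak T^{(1)}_n=\mathfrak C_n\setminus\mathfrak S_n$. For $\tau=(u,v,t)\in\mathfrak C_n$ put $L_\tau=(\alpha_{u,v}1_{r_t})\star_1\Lambda_{\mathcal R(N(uv))r_t}$ and $R_\tau=(1_{r_u}\alpha_{v,t})\star_1\Lambda_{r_u\mathcal R(N(vt))}$, two paths from $r_ur_vr_t$ to its normal form. **Selected row cells.** A pair $(\tau,\beta)$, with $\tau\in\mathfrak T_n^{(1)}$ and $\beta=\alpha_{p,q}$, is eligible if $\beta$ occurs in $L_\tau$ or $R_\tau$ as a rewriting step with source exactly $r_pr_q$ (empty context), and this is the only occurrence of $\beta$ in $L_\tau$ and $R_\tau$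 together (occurrences in any context counted). For an eligible pair, let $U$ be the one of $L_\tau,R_\tau$ containing $\beta$, $V$ the other, write $U=f\star_1\beta\star_1g$ and put $S_{\tau,\beta}=f^{ -1}\star_1V\star_1g^{ -1}$. A dependency of $(\tau,\beta)$ is a generating row $2$-cell occurring, itself or its inverse, in the expression $S_{\tau,\beta}$. Order the cells $\alpha_{u,v}$ lexicographically by $(\ell(u)+\ell(v),\ell(u),u,v)$ (rows compared lexicographically, a proper prefix being smaller), triples lexicographically by their three rows, and eligible pairs lexicographically by $(\beta,\tau)$. Scan the eligible pairs in increasing order, keeping $(\tau,\beta)$ iff neither $\tau$ nor $\beta$ occurs in an already kept pair. Let $\mathcal B_n^{\mathrm{match}}$ be the set of $\beta$ in kept pairs, $\tau_\beta$ the triple kept with $\beta$, $S_\beta=S_{\tau_\beta,\beta}$. Let $G$ be the directed graph on $\mathcal B_n^{\mathrm{match}}$ with an edge $\beta'\to\beta$ iff $\beta'$ is a dependency of $(\tau_\beta,\beta)$. Scan $\mathcal B_n^{\mathrm{match}}$ in increasing order, keeping $\beta$ iff the subgraph of $G$ induced by the already kept vertices and $\beta$ is acyclic; the kept set is $\mathcal B_n^{\mathrm{acyc}}$. **Reduced row presentation.** Let $\Sigma^{\mathrm{row,red}}(n)$ have generating $1$-cells $r_u$ ($u\in\mathcal R_n$) and generating $2$-cells $\Sigma^{\mathrm{row}}_2(n)\setminus\mathcal B_n^{\mathrm{acyc}}$. Let $\mathsf{Red}_n\colon\Sigma^{\mathrm{row}}(n)_2^\top\to\Sigma^{\mathrm{row,red}}(n)_2^\top$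 be the $2$-functor fixing $1$-cells and surviving row cells, with $\mathsf{Red}_n(\beta)=\mathsf{Red}_n(S_\beta)$ for $\beta\in\mathcal B_n^{\mathrm{acyc}}$ (well defined by acyclicity). The generating $3$-cells of $\Sigma^{\mathrm{row,red}}(n)$ are $\mathcal X_\tau\colon\mathsf{Red}_n(L_\tau)\Rrightarrow\mathsf{Red}_n(R_\tau)$ for $\tau\in\mathfrak T_n^{(1)}\setminus\{\tau_\beta\mid\beta\in\mathcal B_n^{\mathrm{acyc}}\}$. **Pre-row presentation.** $\Sigma^{\mathrm{prerow}}(n)$ has generating $1$-cells $r_u$, $u\in\mathcal R_n$, and generating $2$-cells $\eta^r_x\colon r_xr_x\Rightarrow r_x$; $\kappa^r_{x,y,z}\colon r_zr_xr_y\Rightarrow r_xr_zr_y$ ($x\le y<z$); $\lambda^r_{x,y,z}\colon r_yr_zr_x\Rightarrow r_yr_xr_z$ ($x<y\le z$); and $\gamma_u\colon r_{x_1}\cdots r_{x_k}\Rightarrow r_u$ for $u=x_1\cdots x_k\in\overline{\mathcal R}_n$. For words $U,V$ in the letter generators $r_x$ representing the same element of $\mathrm{Styl}_n$, $\Pi_{U,V}\colon U\Rightarrow V$ is the shortest path made of applications of $\eta^r,\kappa^r,\lambda^r$ and their inverses, and the lexicographically least among the shortest ones, elementary steps being ordered first by position from left to right, then by $\eta^r\prec\kappa^r\prec\lambda^r\prec(\eta^r)^{ -1}\prec(\kappa^r)^{ -1}\prec(\lambda^r)^{ -1}$, then lexicographically by parameters. For $w=r_{u_1}\cdots r_{u_k}$,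 $\mathrm{flat}(w)$ is obtained by replacing each $r_{u_i}$, $u_i=x_1\cdots x_p$, by $r_{x_1}\cdots r_{x_p}$, and $E_w\colon w\Rightarrow\mathrm{flat}(w)$ is the $0$-composite of the cells $\gamma_{u_i}^{ -1}$ (identity if $\ell(u_i)=1$). For rows $u\not\triangleleft v$, with $s=r_ur_v$ and $t=\mathcal R(N(uv))$, put $P_{u,v}=E_s\star_1\Pi_{\mathrm{flat}(s),\mathrm{flat}(t)}\star_1E_t^{ -1}$. **Transport.** For a generating $2$-cell $\delta\colon s\Rightarrow t$ of $\Sigma^{\mathrm{prerow}}(n)$ put $Q_\delta=\mathsf{Red}_n(\Lambda_s\star_1\Lambda_t^{ -1})$. Let $\mathcal E_n$ be the $2$-functor, to $\Sigma^{\mathrm{prerow}}(n)_2^\top$, fixing $1$-cells and pre-row $2$-cells and sending every surviving row cell $\alpha_{u,v}$ to $P_{u,v}$. $\Sigma^{\mathrm{prerow,coh}}(n)$ is the $(3,1)$-polygraph over $\Sigma^{\mathrm{prerow}}(n)$ with generating $3$-cells $A^{\mathrm{prerow}}\colon\mathcal E_n(f)\Rrightarrow\mathcal E_n(g)$ for each generating $3$-cell $A\colon f\Rrightarrow g$ of $\Sigma^{\mathrm{row,red}}(n)$, and $B^{\mathrm{prerow}}_\delta\colon\mathcal E_n(Q_\delta)\Rrightarrow\delta$ for each generating $2$-cell $\delta$ of $\Sigma^{\mathrm{prerow}}(n)$. **The letter presentation.** $\Sigma^{\mathrm{styl,coh}}(n)$ is obtained from $\Sigma^{\mathrm{prerow,coh}}(n)$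 by removing all $r_u$ and $\gamma_u$ with $u\in\overline{\mathcal R}_n$, and keeping all generating $3$-cells with boundaries transformed by the $2$-functor sending $r_u$ to $r_{x_1}\cdots r_{x_k}$ and $\gamma_u$ to the identity for $u=x_1\cdots x_k\in\overline{\mathcal R}_n$, and fixing all other generators. "Effectively computable" means that there is an algorithm which, given $n$, lists the generating $3$-cells with their boundaries. -}

module Defs where

open import Algebra.Bundles using (Monoid)
open import Algebra.Morphism.Structures using (module MonoidMorphisms)
open import Data.Bool.Properties using () renaming (_≟_ to _≟ᵇ_)
open import Data.Empty using (⊥-elim; ⊥-elim-irr)
open import Data.Fin.Base using (Fin; zero; suc)
import Data.Fin.Base as Fin
import Data.Fin.Properties as Fin
open import Data.Fin.Induction using (spo-wellFounded)
open import Data.Fin.Subset using (Subset; Nonempty; inside; outside; _∪_; _⊆_)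
  renaming (_∈_ to _∈ₛ_; ⊥ to ∅)
import Data.Fin.Subset.Properties as Sub
open import Data.List.Base
  using (List; []; _∷_; _++_; _∷ʳ_; map; concatMap; foldl; reverse; length; head;
         filter; mapMaybe; fromMaybe; upTo; allFin; cartesianProduct; cartesianProductWith;
         lookup)
import Data.List.Properties as List
open import Data.List.Membership.Propositional using (_∈_)
open import Data.List.Membership.Propositional.Properties
  using (∈-map⁺; ∈-++⁺ˡ; ∈-++⁺ʳ; ∈-allFin; ∈-upTo⁺)
import Data.List.Relation.Binary.Lex.NonStrict as Lex
open import Data.List.Relation.Unary.Any as Any using (Any; here; there; any?)
import Data.List.Relation.Unary.Any.Properties as Any
open import Data.List.Relation.Unary.Linked using (Linked; []; [-]; _∷_)
open import Data.List.Relation.Unary.Unique.Propositional using (Unique)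
import Data.List.Sort as Sort
open import Data.Maybe.Base as Maybe using (Maybe; just; nothing; maybe)
open import Data.Nat.Base as ℕ using (ℕ; zero; suc; _+_; _≤_; z≤n; s≤s)
import Data.Nat.Properties as ℕ
open import Data.Product.Base using (Σ; ∃; ∃₂; _×_; _,_; proj₂; Σ-syntax; ∃-syntax)
open import Data.Product.Relation.Binary.Lex.NonStrict using (×-decTotalOrder)
open import Data.Sum.Base using (_⊎_; inj₁; inj₂; [_,_]′)
open import Data.Vec.Base using ([]; _∷_; _[_]≔_; here; there)
import Data.Vec.Properties as Vec
open import Function.Base using (_∘_; id; flip)
open import Function.Bundles using (_↔_)
open import Function.Definitions using (Bijective)
open import Induction.WellFounded using (WellFounded; Acc; acc)
open import Level using (0ℓ)
open import Relation.Binary.Bundles using (DecTotalOrder)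
open import Relation.Binary.Construct.Closure.Equivalence as Eq using (EqClosure)
open import Relation.Binary.Construct.Closure.ReflexiveTransitive as Star
  using (Star; ε; _◅_; _◅◅_)
open import Relation.Binary.Construct.Closure.Symmetric using (SymClosure; fwd; bwd)
open import Relation.Binary.Construct.Closure.Transitive as Plus using (TransClosure; _∷_)
import Relation.Binary.Construct.On as On
open import Relation.Binary.PropositionalEquality
  using (_≡_; _≢_; refl; sym; trans; cong; cong₂; subst; subst₂; isEquivalence)
open import Relation.Nullary.Decidable
  using (Dec; yes; no; ¬?; _×-dec_; _⊎-dec_; map′; recompute)
open import Relation.Nullary.Negation using (¬_; contradiction)

private variable
  n : ℕ
  X Y : Set

uip : {x y : X} (p q : x ≡ y) → p ≡ q
uip refl refl = refl

record Polygraph₂ (X : Set) : Set₁ where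
  field
    Gen₂    : Set
    src tgt : Gen₂ → List X

open Polygraph₂ public

record Step (P : Polygraph₂ X) (u v : List X) : Set where
  constructor step
  field
    left   : List X
    gen    : Gen₂ P
    right  : List X
    src-eq : u ≡ left ++ src P gen ++ right
    tgt-eq : v ≡ left ++ tgt P gen ++ right

-- Zigzags represent the 2-cells of the free track 2-category; they are considered
-- up to _≈_ below.
Path : Polygraph₂ X → List X → List X → Set
Path P = Star (Step P)

Track : Polygraph₂ X → List X → List X → Set
Track P = EqClosure (Step P)

module _ {P : Polygraph₂ X} where

  private variable
    u v u′ v′ : List X

  stepOf : (β : Gen₂ P) → Step P (src P β) (tgt P β)
  stepOf β = step [] β [] (sym (List.++-identityʳ _)) (sym (List.++-identityʳ _))

  ⟪_⟫ : (β : Gen₂ P) → Track P (src P β) (tgt P β)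
  ⟪ β ⟫ = fwd (stepOf β) ◅ ε

  ⌜_⌝ : Path P u v → Track P u v
  ⌜_⌝ = Star.map fwd

  _⁻¹ : Track P u v → Track P v u
  _⁻¹ = Eq.symmetric (Step P)

  castP : u ≡ u′ → v ≡ v′ → Path P u v → Path P u′ v′
  castP = subst₂ (Path P)

  cast : u ≡ u′ → v ≡ v′ → Track P u v → Track P u′ v′
  cast = subst₂ (Track P)

  _◁ₛ_ : ∀ w → Step P u v → Step P (w ++ u) (w ++ v)
  w ◁ₛ step l β r p q = step (w ++ l) β r (lemma p) (lemma q)
    where
    lemma : ∀ {x s} → x ≡ l ++ s → w ++ x ≡ (w ++ l) ++ s
    lemma {s = s} e = trans (cong (w ++_) e) (sym (List.++-assoc w l s))

  _▷ₛ_ : Step P u v → ∀ w → Step P (u ++ w) (v ++ w)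
  step l β r p q ▷ₛ w = step l β (r ++ w) (lemma p) (lemma q)
    where
    lemma : ∀ {x s} → x ≡ l ++ s ++ r → x ++ w ≡ l ++ s ++ r ++ w
    lemma {s = s} e = trans (cong (_++ w) e)
      (trans (List.++-assoc l (s ++ r) w) (cong (l ++_) (List.++-assoc s r w)))

  _◁ₚ_ : ∀ w → Path P u v → Path P (w ++ u) (w ++ v)
  w ◁ₚ p = Star.gmap (w ++_) (w ◁ₛ_) p

  _▷ₚ_ : Path P u v → ∀ w → Path P (u ++ w) (v ++ w)
  p ▷ₚ w = Star.gmap (_++ w) (_▷ₛ w) p

  _◁_ : ∀ w → Track P u v → Track P (w ++ u) (w ++ v)
  w ◁ f = Eq.gmap (w ++_) (w ◁ₛ_) f

  _▷_ : Track P u v → ∀ w → Track P (u ++ w) (v ++ w)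
  f ▷ w = Eq.gmap (_++ w) (_▷ₛ w) f

  -- Equality of 2-cells in the free track 2-category.  Associativity and units
  -- hold on representatives, and f ⋆₀ g is (f ▷ _) ◅◅ (_ ◁ g).
  infix 4 _≈_
  data _≈_ : {u v : List X} → Track P u v → Track P u v → Set where
    ≈-refl      : {f : Track P u v} → f ≈ f
    ≈-sym       : {f g : Track P u v} → f ≈ g → g ≈ f
    ≈-trans     : {f g h : Track P u v} → f ≈ g → g ≈ h → f ≈ h
    ⋆-cong      : {f f′ : Track P u v} {g g′ : Track P v v′} →
                  f ≈ f′ → g ≈ g′ → f ◅◅ g ≈ f′ ◅◅ g′
    ◁-cong      : ∀ w {f g : Track P u v} → f ≈ g → w ◁ f ≈ w ◁ g
    ▷-cong      : {f g : Track P u v} → f ≈ g → ∀ w → f ▷ w ≈ g ▷ w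
    inverseʳ    : (f : Track P u v) → f ◅◅ f ⁻¹ ≈ ε
    inverseˡ    : (f : Track P u v) → f ⁻¹ ◅◅ f ≈ ε
    interchange : (f : Track P u v) (g : Track P u′ v′) →
                  (f ▷ u′) ◅◅ (v ◁ g) ≈ (u ◁ g) ◅◅ (f ▷ v′)

  gensStep : SymClosure (Step P) u v → Gen₂ P
  gensStep (fwd s) = Step.gen s
  gensStep (bwd s) = Step.gen s

  gens : Track P u v → List (Gen₂ P)
  gens ε       = []
  gens (s ◅ f) = gensStep s ∷ gens f

-- The 2-functor fixing 1-cells determined by images of the generating 2-cells
-- occurring in its argument.
module _ {P Q : Polygraph₂ X} where

  mapStep : ∀ {u v} (s : Step P u v) →
          Track Q (src P (Step.gen s)) (tgt P (Step.gen s)) → Track Q u v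
  mapStep (step l β r p q) f = cast (sym p) (sym q) (l ◁ (f ▷ r))

  mapTrack : ∀ {u v} (f : Track P u v) →
             (∀ {β} → β ∈ gens f → Track Q (src P β) (tgt P β)) → Track Q u v
  mapTrack ε           φ = ε
  mapTrack (fwd s ◅ f) φ = mapStep s (φ (here refl)) ◅◅ mapTrack f (φ ∘ there)
  mapTrack (bwd s ◅ f) φ = mapStep s (φ (here refl)) ⁻¹ ◅◅ mapTrack f (φ ∘ there)

concatMap-++ : (f : X → List Y) (u v : List X) →
               concatMap f (u ++ v) ≡ concatMap f u ++ concatMap f v
concatMap-++ f []      v = refl
concatMap-++ f (x ∷ u) v =
  trans (cong (f x ++_) (concatMap-++ f u v)) (sym (List.++-assoc (f x) _ _))

concatMap-++₃ : (f : X → List Y) (u v w : List X) →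
                concatMap f (u ++ v ++ w) ≡ concatMap f u ++ concatMap f v ++ concatMap f w
concatMap-++₃ f u v w =
  trans (concatMap-++ f u (v ++ w)) (cong (concatMap f u ++_) (concatMap-++ f v w))

-- The 2-functor determined by images of the generating 1-cells and 2-cells.
module _ {P : Polygraph₂ X} {Q : Polygraph₂ Y} (f₁ : X → List Y)
         (f₂ : ∀ β → Track Q (concatMap f₁ (src P β)) (concatMap f₁ (tgt P β))) where

  extendStep : ∀ {u v} → Step P u v → Track Q (concatMap f₁ u) (concatMap f₁ v)
  extendStep (step l β r p q) =
    cast (eq p) (eq q) (concatMap f₁ l ◁ (f₂ β ▷ concatMap f₁ r))
    where
    eq : ∀ {u s} → u ≡ l ++ s ++ r →
         concatMap f₁ l ++ concatMap f₁ s ++ concatMap f₁ r ≡ concatMap f₁ u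
    eq {s = s} e = sym (trans (cong (concatMap f₁) e) (concatMap-++₃ f₁ l s r))

  extend : ∀ {u v} → Track P u v → Track Q (concatMap f₁ u) (concatMap f₁ v)
  extend ε           = ε
  extend (fwd s ◅ f) = extendStep s ◅◅ extend f
  extend (bwd s ◅ f) = extendStep s ⁻¹ ◅◅ extend f

record Cells₃ (P : Polygraph₂ X) : Set₁ where
  field
    Gen₃    : Set
    dom cod : Gen₃ → List X
    lhs rhs : (A : Gen₃) → Track P (dom A) (cod A)

open Cells₃ public

module _ {P : Polygraph₂ X} (Γ : Cells₃ P) where

  -- Terms for the 3-cells of the free (3,1)-category.  Only their existence
  -- matters for fillings, so no equality of 3-cells is imposed.
  data Track₃ : {u v : List X} → Track P u v → Track P u v → Set where
    gen₃  : (A : Gen₃ Γ) → Track₃ (lhs Γ A) (rhs Γ A)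
    id₃   : ∀ {u v} {f g : Track P u v} → f ≈ g → Track₃ f g
    _⋆₂_  : ∀ {u v} {f g h : Track P u v} → Track₃ f g → Track₃ g h → Track₃ f h
    inv₃  : ∀ {u v} {f g : Track P u v} → Track₃ f g → Track₃ g f
    _⋆₁_  : ∀ {u v w} {f f′ : Track P u v} {g g′ : Track P v w} →
            Track₃ f f′ → Track₃ g g′ → Track₃ (f ◅◅ g) (f′ ◅◅ g′)
    _◁₃_  : ∀ w {u v} {f g : Track P u v} → Track₃ f g → Track₃ (w ◁ f) (w ◁ g)
    _▷₃_  : ∀ {u v} {f g : Track P u v} → Track₃ f g → ∀ w → Track₃ (f ▷ w) (g ▷ w)

  IsHomotopyBasis : Set
  IsHomotopyBasis = ∀ {u v} (f g : Track P u v) → Track₃ f g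

module _ (P : Polygraph₂ X) where

  infix 4 _~_
  data _~_ : List X → List X → Set where
    ~-gen   : ∀ β → src P β ~ tgt P β
    ~-refl  : ∀ {u} → u ~ u
    ~-sym   : ∀ {u v} → u ~ v → v ~ u
    ~-trans : ∀ {u v w} → u ~ v → v ~ w → u ~ w
    ~-++    : ∀ {u v u′ v′} → u ~ v → u′ ~ v′ → u ++ u′ ~ v ++ v′

  ~-reflexive : ∀ {u v} → u ≡ v → u ~ v
  ~-reflexive refl = ~-refl

  ⟦_⟧ : Monoid 0ℓ 0ℓ
  ⟦_⟧ = record
    { Carrier  = List X
    ; _≈_      = _~_
    ; _∙_      = _++_
    ; ε        = []
    ; isMonoid = record
      { isSemigroup = record
        { isMagma = record
          { isEquivalence = record { refl = ~-refl ; sym = ~-sym ; trans = ~-trans }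
          ; ∙-cong        = ~-++
          }
        ; assoc = λ u v w → ~-reflexive (List.++-assoc u v w)
        }
      ; identity = (λ _ → ~-refl) , (λ u → ~-reflexive (List.++-identityʳ u))
      }
    }

  ~⇒Track : ∀ {u v} → u ~ v → Track P u v
  ~⇒Track (~-gen β)            = ⟪ β ⟫
  ~⇒Track ~-refl               = ε
  ~⇒Track (~-sym e)            = ~⇒Track e ⁻¹
  ~⇒Track (~-trans e e′)       = ~⇒Track e ◅◅ ~⇒Track e′
  ~⇒Track (~-++ {v = v} e e′)  = (~⇒Track e ▷ _) ◅◅ (v ◁ ~⇒Track e′)

_Presents_ : Polygraph₂ X → Monoid 0ℓ 0ℓ → Set
P Presents M =
  Σ[ φ ∈ (Carrier ⟦ P ⟧ → Carrier M) ] IsMonoidIsomorphism φ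
  where
  open Monoid using (Carrier; rawMonoid)
  open MonoidMorphisms (rawMonoid ⟦ P ⟧) (rawMonoid M)

record IsCoherentPresentation {P : Polygraph₂ X} (Γ : Cells₃ P) (M : Monoid 0ℓ 0ℓ) : Set where
  field
    presents      : P Presents M
    homotopyBasis : IsHomotopyBasis Γ

IsFinite : Set → Set
IsFinite A = ∃[ k ] (A ↔ Fin k)

record IsFinitePolygraph {P : Polygraph₂ X} (Γ : Cells₃ P) : Set where
  field
    finite₁ : IsFinite X
    finite₂ : IsFinite (Gen₂ P)
    finite₃ : IsFinite (Gen₃ Γ)

record IsIsomorphism (P : Polygraph₂ X) (Q : Polygraph₂ Y)
                     (f₁ : X → Y) (f₂ : Gen₂ P → Gen₂ Q) : Set where
  field
    bijective₁ : Bijective _≡_ _≡_ f₁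
    bijective₂ : Bijective _≡_ _≡_ f₂
    src-comm   : ∀ β → src Q (f₂ β) ≡ map f₁ (src P β)
    tgt-comm   : ∀ β → tgt Q (f₂ β) ≡ map f₁ (tgt P β)

Boundary : Polygraph₂ X → Set
Boundary P = ∃₂ λ u v → Track P u v × Track P u v

boundary : {P : Polygraph₂ X} (Γ : Cells₃ P) → Gen₃ Γ → Boundary P
boundary Γ A = dom Γ A , cod Γ A , lhs Γ A , rhs Γ A

data StylCell (n : ℕ) : Set where
  η : (x : Fin n) → StylCell n
  κ : (x y z : Fin n) → .(x Fin.≤ y) → .(y Fin.< z) → StylCell n
  ƛ : (x y z : Fin n) → .(x Fin.< y) → .(y Fin.≤ z) → StylCell n

Σstyl : (n : ℕ) → Polygraph₂ (Fin n)
Σstyl n .Gen₂ = StylCell n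
Σstyl n .src (η x)         = x ∷ x ∷ []
Σstyl n .src (κ x y z _ _) = z ∷ x ∷ y ∷ []
Σstyl n .src (ƛ x y z _ _) = y ∷ z ∷ x ∷ []
Σstyl n .tgt (η x)         = x ∷ []
Σstyl n .tgt (κ x y z _ _) = x ∷ z ∷ y ∷ []
Σstyl n .tgt (ƛ x y z _ _) = y ∷ x ∷ z ∷ []

Styl : ℕ → Monoid 0ℓ 0ℓ
Styl n = ⟦ Σstyl n ⟧

infix 4 _≋_
_≋_ : List (Fin n) → List (Fin n) → Set
_≋_ {n} = _~_ (Σstyl n)

-- Rows are identified with their supports.
record Row (n : ℕ) : Set where
  constructor row
  field
    supp      : Subset n
    .nonempty : Nonempty supp

open Row public hiding (nonempty)

nonemptyᵣ : (u : Row n) → Nonempty (supp u)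
nonemptyᵣ (row p ne) = recompute (Sub.nonempty? p) ne

row-≡ : {u v : Row n} → supp u ≡ supp v → u ≡ v
row-≡ {u = row _ _} {row _ _} refl = refl

word : Subset n → List (Fin n)
word []            = []
word (inside  ∷ p) = zero ∷ map Fin.suc (word p)
word (outside ∷ p) = map Fin.suc (word p)

ℓ : Row n → ℕ
ℓ u = length (word (supp u))

pop : {p : Subset n} → Nonempty (outside ∷ p) → Nonempty p
pop (suc x , there x∈p) = x , x∈p

push : {b : _} {p : Subset n} → Nonempty p → Nonempty (b ∷ p)
push (x , x∈p) = suc x , there x∈p

¬nonempty-[] : ¬ Nonempty []
¬nonempty-[] (() , _)

least : (p : Subset n) → .(Nonempty p) → Fin n
least []            ne = ⊥-elim-irr (¬nonempty-[] ne)
least (inside  ∷ p) _  = zero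
least (outside ∷ p) ne = suc (least p (pop ne))

min : Row n → Fin n
min (row p ne) = least p ne

infix 4 _⊲_
_⊲_ : Row n → Row n → Set
u ⊲ v = supp u ⊆ supp v × min v Fin.< min u

_⊲?_ : (u v : Row n) → Dec (u ⊲ v)
u ⊲? v = (supp u Sub.⊆? supp v) ×-dec (min v Fin.<? min u)

_≟ᵣ_ : (u v : Row n) → Dec (u ≡ v)
u ≟ᵣ v = map′ row-≡ (cong supp) (Vec.≡-dec _≟ᵇ_ (supp u) (supp v))

infixl 6 _⊕_ _+ᵣ_
_⊕_ : Subset n → Fin n → Subset n
p ⊕ x = p [ x ]≔ inside

∈-⊕ : (p : Subset n) (x : Fin n) → x ∈ₛ p ⊕ x
∈-⊕ (_ ∷ p) zero    = here
∈-⊕ (_ ∷ p) (suc x) = there (∈-⊕ p x)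

_+ᵣ_ : Row n → Fin n → Row n
u +ᵣ x = row (supp u ⊕ x) (x , ∈-⊕ _ x)

r : Fin n → Row n
r x = row (∅ ⊕ x) (x , ∈-⊕ _ x)

nonempty-tail : (p : Subset n) .(ne : Nonempty p) → .(2 ≤ length (word p)) →
                Nonempty (p [ least p ne ]≔ outside)
nonempty-tail []            ne = ⊥-elim-irr (¬nonempty-[] ne)
nonempty-tail (inside  ∷ p) ne h = push (go p (ℕ.≤-pred (recompute (2 ℕ.≤? _) h)))
  where
  go : (p : Subset n) → 1 ≤ length (map Fin.suc (word p)) → Nonempty p
  go []            ()
  go (inside  ∷ p) _ = zero , here
  go (outside ∷ p) h = push (go p (ℕ.≤-trans h (ℕ.≤-reflexive (List.length-map Fin.suc (map Fin.suc (word p))))))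
nonempty-tail (outside ∷ p) ne h =
  push (nonempty-tail p (pop ne) (ℕ.≤-trans h (ℕ.≤-reflexive (List.length-map Fin.suc (word p)))))

∂ : (u : Row n) → .(2 ≤ ℓ u) → Row n
∂ (row p ne) h = row (p [ least p ne ]≔ outside) (nonempty-tail p ne h)

-- The smallest element of p, and the smallest element of p above x.
first : Subset n → Maybe (Fin n)
first []            = nothing
first (inside  ∷ p) = just zero
first (outside ∷ p) = Maybe.map suc (first p)

above : Fin n → Subset n → Maybe (Fin n)
above zero    (_ ∷ p) = Maybe.map suc (first p)
above (suc x) (_ ∷ p) = Maybe.map suc (above x p)

-- Tableaux are listed from the bottom row to the top row.
Tableau : ℕ → Set
Tableau n = List (Row n)

insert : Tableau n → Fin n → Tableau n
insert []      x = r x ∷ []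
insert (u ∷ T) x = (u +ᵣ x) ∷ maybe (insert T) T (above x (supp u))

infixl 5 _◂_
_◂_ : Tableau n → List (Fin n) → Tableau n
T ◂ w = foldl insert T w

N : List (Fin n) → Tableau n
N w = [] ◂ w

𝓡 : Tableau n → List (Row n)
𝓡 = reverse

IsTableau : Tableau n → Set
IsTableau = Linked (flip _⊲_)

letters : Row n → List (Fin n)
letters u = word (supp u)

-- The letters of flat(w), before the identification of x with r_x.
flat : List (Row n) → List (Fin n)
flat = concatMap letters

_·_ : Row n → Row n → Tableau n
u · v = N (letters u ++ letters v)

≋-shift : {u v : List (Fin n)} → u ≋ v → map Fin.suc u ≋ map Fin.suc v
≋-shift (~-gen (η x))         = ~-gen (η (suc x))
≋-shift (~-gen (κ x y z p q)) = ~-gen (κ (suc x) (suc y) (suc z) (s≤s p) (s≤s q))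
≋-shift (~-gen (ƛ x y z p q)) = ~-gen (ƛ (suc x) (suc y) (suc z) (s≤s p) (s≤s q))
≋-shift ~-refl                = ~-refl
≋-shift (~-sym e)             = ~-sym (≋-shift e)
≋-shift (~-trans e e′)        = ~-trans (≋-shift e) (≋-shift e′)
≋-shift (~-++ {u} {v} {u′} {v′} e e′) =
  subst₂ _≋_ (sym (List.map-++ Fin.suc u u′)) (sym (List.map-++ Fin.suc v v′))
    (~-++ (≋-shift e) (≋-shift e′))

≋-in : ∀ a b {u v : List (Fin n)} → u ≋ v → a ++ u ++ b ≋ a ++ v ++ b
≋-in a b e = ~-++ (~-refl {u = a}) (~-++ e (~-refl {u = b}))

≋-∷ : ∀ x {u v : List (Fin n)} → u ≋ v → x ∷ u ≋ x ∷ v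
≋-∷ x = ~-++ (~-refl {u = x ∷ []})

word-increasing : (p : Subset n) → Linked Fin._<_ (word p)
word-increasing []            = []
word-increasing (outside ∷ p) = go (word-increasing p)
  where
  go : {w : List (Fin n)} → Linked Fin._<_ w → Linked Fin._<_ (map Fin.suc w)
  go []       = []
  go [-]      = [-]
  go (p ∷ ps) = s≤s p ∷ go ps
word-increasing (inside  ∷ p) with word p | word-increasing (outside ∷ p)
... | []    | _  = [-]
... | _ ∷ _ | ps = s≤s z≤n ∷ ps

first-head : (p : Subset n) → first p ≡ head (word p)
first-head []            = refl
first-head (inside  ∷ p) = refl
first-head (outside ∷ p) rewrite first-head p with word p
... | []    = refl
... | _ ∷ _ = refl

zero-left : ∀ {y : Fin (suc n)} {ys} → Fin.zero {n} Fin.< y → Linked Fin._<_ (y ∷ ys) →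
            y ∷ ys ++ zero ∷ [] ≋ y ∷ zero ∷ ys
zero-left 0<y [-] = ~-refl
zero-left {y = y} {z ∷ zs} 0<y (y<z ∷ zs↗) = ~-trans
  (≋-∷ y (zero-left (ℕ.<-trans 0<y y<z) zs↗))
  (~-++ (~-gen (ƛ zero y z 0<y (ℕ.<⇒≤ y<z))) (~-refl {u = zs}))

insert-zero : ∀ {y : Fin (suc n)} {ys} → Fin.zero {n} Fin.< y → Linked Fin._<_ (y ∷ ys) →
              y ∷ ys ++ zero ∷ [] ≋ y ∷ zero ∷ y ∷ ys
insert-zero {y = y} {ys} 0<y ys↗ = ~-trans (zero-left 0<y ys↗) (~-trans
  (~-++ (~-sym (~-gen (η y))) (~-refl {u = zero ∷ ys}))
  (~-++ (~-gen (ƛ zero y y 0<y ℕ.≤-refl)) (~-refl {u = ys})))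

insert-zero′ : ∀ {y : Fin (suc n)} {ys} → Fin.zero {n} Fin.< y → Linked Fin._<_ (y ∷ ys) →
               zero ∷ y ∷ ys ++ zero ∷ [] ≋ y ∷ zero ∷ y ∷ ys
insert-zero′ {y = y} {ys} 0<y ys↗ = ~-trans (≋-∷ zero (insert-zero 0<y ys↗)) (~-trans
  (~-++ (~-sym (~-gen (κ zero zero y z≤n 0<y))) (~-refl {u = y ∷ ys}))
  (≋-∷ y (~-++ (~-gen (η zero)) (~-refl {u = y ∷ ys}))))

positive : ∀ (p : Subset n) {y ys} → map Fin.suc (word p) ≡ y ∷ ys → zero {n} Fin.< y
positive p e with word p
positive p refl | _ ∷ _ = s≤s z≤n

above-> : ∀ x (p : Subset n) {a} → above x p ≡ just a → x Fin.< a
above-> zero    (_ ∷ p) e with first p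
above-> zero    (_ ∷ p) refl | just _ = s≤s z≤n
above-> (suc x) (_ ∷ p) e with above x p in eq
above-> (suc x) (_ ∷ p) refl | just _ = s≤s (above-> x p eq)

fromMaybe-suc : (m : Maybe (Fin n)) → fromMaybe (Maybe.map suc m) ≡ map Fin.suc (fromMaybe m)
fromMaybe-suc nothing  = refl
fromMaybe-suc (just _) = refl

word-⊕ : ∀ (p : Subset n) x → ∃₂ λ c w → word (p ⊕ x) ≡ c ∷ w × c Fin.≤ x
word-⊕ (inside  ∷ p) zero    = _ , _ , refl , z≤n
word-⊕ (outside ∷ p) zero    = _ , _ , refl , z≤n
word-⊕ (inside  ∷ p) (suc x) = _ , _ , refl , z≤n
word-⊕ (outside ∷ p) (suc x) with c , w , e , c≤x ← word-⊕ p x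
  rewrite e = _ , _ , refl , s≤s c≤x

shifted : ∀ (p : Subset n) x →
          word p ++ x ∷ [] ≋ fromMaybe (above x p) ++ word (p ⊕ x) →
          map Fin.suc (word p) ++ suc x ∷ []
          ≋ fromMaybe (Maybe.map suc (above x p)) ++ map Fin.suc (word (p ⊕ x))
shifted p x e = subst₂ _≋_ (List.map-++ Fin.suc (word p) (x ∷ []))
  (trans (List.map-++ Fin.suc (fromMaybe (above x p)) _)
         (cong (_++ map Fin.suc (word (p ⊕ x))) (sym (fromMaybe-suc (above x p)))))
  (≋-shift e)

insert-word : ∀ (p : Subset n) x →
              word p ++ x ∷ [] ≋ fromMaybe (above x p) ++ word (p ⊕ x)
insert-word (inside ∷ p) zero
  rewrite first-head p
  with word p | word-increasing (outside ∷ p) | positive p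
... | []    | _  | _   = ~-gen (η zero)
... | _ ∷ _ | p↗ | pos = insert-zero′ (pos refl) p↗
insert-word (outside ∷ p) zero
  rewrite first-head p
  with word p | word-increasing (outside ∷ p) | positive p
... | []    | _  | _   = ~-refl
... | _ ∷ _ | p↗ | pos = insert-zero (pos refl) p↗
insert-word (outside ∷ p) (suc x) = shifted p x (insert-word p x)
insert-word (inside  ∷ p) (suc x) =
  ~-trans (≋-∷ zero (shifted p x (insert-word p x))) past
  where
  past : zero ∷ fromMaybe (Maybe.map suc (above x p)) ++ map Fin.suc (word (p ⊕ x))
         ≋ fromMaybe (Maybe.map suc (above x p)) ++ zero ∷ map Fin.suc (word (p ⊕ x))
  past with above x p in eq
  ... | nothing = ~-refl
  ... | just y with c , w , e , c≤x ← word-⊕ p x rewrite e =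
    ~-++ (~-sym (~-gen (κ zero (suc c) (suc y) z≤n (s≤s (ℕ.≤-<-trans c≤x (above-> x p eq))))))
         (~-refl {u = map Fin.suc w})

word-r : (x : Fin n) → letters (r x) ≡ x ∷ []
word-r {suc n} zero    = cong (λ w → zero ∷ map Fin.suc w) (empty n)
  where
  empty : ∀ n → word (∅ {n}) ≡ []
  empty zero    = refl
  empty (suc n) = cong (map Fin.suc) (empty n)
word-r         (suc x) = cong (map Fin.suc) (word-r x)

flat-++ : (u v : List (Row n)) → flat (u ++ v) ≡ flat u ++ flat v
flat-++ = concatMap-++ letters

flat-𝓡-∷ : (u : Row n) (T : Tableau n) → flat (𝓡 (u ∷ T)) ≡ flat (𝓡 T) ++ letters u
flat-𝓡-∷ u T = trans (cong flat (List.unfold-reverse u T))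
  (trans (flat-++ (𝓡 T) (u ∷ [])) (cong (flat (𝓡 T) ++_) (List.++-identityʳ (letters u))))

≋-insert : (T : Tableau n) (x : Fin n) → flat (𝓡 T) ++ x ∷ [] ≋ flat (𝓡 (insert T x))
≋-insert []      x = ~-reflexive _ (sym (trans (List.++-identityʳ _) (word-r x)))
≋-insert (u ∷ T) x = ~-trans
  (~-reflexive _ (trans (cong (_++ x ∷ []) (flat-𝓡-∷ u T)) (List.++-assoc (flat (𝓡 T)) _ _)))
  (~-trans (~-++ (~-refl {u = flat (𝓡 T)}) (insert-word (supp u) x))
  (~-trans (bump (above x (supp u))) (~-reflexive _ (sym (flat-𝓡-∷ (u +ᵣ x) (maybe (insert T) T (above x (supp u))))))))
  where
  bump : (m : Maybe (Fin _)) → flat (𝓡 T) ++ fromMaybe m ++ letters (u +ᵣ x)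
                              ≋ flat (𝓡 (maybe (insert T) T m)) ++ letters (u +ᵣ x)
  bump nothing  = ~-refl
  bump (just y) = ~-trans (~-reflexive _ (sym (List.++-assoc (flat (𝓡 T)) (y ∷ []) _)))
                          (~-++ (≋-insert T y) (~-refl {u = letters (u +ᵣ x)}))

≋-◂ : (T : Tableau n) (w : List (Fin n)) → flat (𝓡 T) ++ w ≋ flat (𝓡 (T ◂ w))
≋-◂ T []      = ~-reflexive _ (List.++-identityʳ _)
≋-◂ T (x ∷ w) = ~-trans (~-reflexive _ (sym (List.++-assoc (flat (𝓡 T)) (x ∷ []) w)))
  (~-trans (~-++ (≋-insert T x) (~-refl {u = w})) (≋-◂ (insert T x) w))

≋-N : (w : List (Fin n)) → w ≋ flat (𝓡 (N w))
≋-N = ≋-◂ []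

addAll : Row n → List (Fin n) → Row n
addAll = foldl _+ᵣ_

bumps : Subset n → List (Fin n) → List (Fin n)
bumps p []      = []
bumps p (x ∷ w) = fromMaybe (above x p) ++ bumps (p ⊕ x) w

◂-++ : (T : Tableau n) (u v : List (Fin n)) → T ◂ (u ++ v) ≡ (T ◂ u) ◂ v
◂-++ T []      v = refl
◂-++ T (x ∷ u) v = ◂-++ (insert T x) u v

◂-∷ : (u : Row n) (T : Tableau n) (w : List (Fin n)) →
      (u ∷ T) ◂ w ≡ addAll u w ∷ (T ◂ bumps (supp u) w)
◂-∷ u T []      = refl
◂-∷ u T (x ∷ w) = trans (◂-∷ (u +ᵣ x) _ w) (cong (addAll (u +ᵣ x) w ∷_) (bump (above x (supp u))))
  where
  bump : (m : Maybe (Fin _)) → maybe (insert T) T m ◂ bumps (supp u ⊕ x) w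
                              ≡ T ◂ (fromMaybe m ++ bumps (supp u ⊕ x) w)
  bump nothing  = refl
  bump (just y) = refl

∅-above : (x : Fin n) → above x ∅ ≡ nothing
∅-first : first (∅ {n}) ≡ nothing
∅-first {zero}  = refl
∅-first {suc n} = cong (Maybe.map suc) (∅-first {n})
∅-above {suc n} zero    = cong (Maybe.map suc) (∅-first {n})
∅-above         (suc x) = cong (Maybe.map suc) (∅-above x)

-- A new top row behaves as if the letter were inserted in an empty row.
◂-[] : (x : Fin n) (w : List (Fin n)) →
       [] ◂ (x ∷ w) ≡ addAll (r x) w ∷ ([] ◂ bumps ∅ (x ∷ w))
◂-[] x w rewrite ∅-above x = ◂-∷ (r x) [] w

bumps-suc : ∀ b (p : Subset n) w → bumps (b ∷ p) (map Fin.suc w) ≡ map Fin.suc (bumps p w)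
bumps-suc b p []      = refl
bumps-suc b p (x ∷ w) = trans
  (cong₂ _++_ (fromMaybe-suc (above x p)) (bumps-suc b (p ⊕ x) w))
  (sym (List.map-++ Fin.suc (fromMaybe (above x p)) _))

above-⊕-self : (p : Subset n) (x : Fin n) → above x (p ⊕ x) ≡ above x p
above-⊕-self (_ ∷ p) zero    = refl
above-⊕-self (_ ∷ p) (suc x) = cong (Maybe.map suc) (above-⊕-self p x)

first-⊕ : ∀ z (p : Subset n) →
          (∃ λ f → first p ≡ just f × f Fin.≤ z × first (p ⊕ z) ≡ just f)
          ⊎ (first p ≡ above z p × first (p ⊕ z) ≡ just z)
first-⊕ zero    (inside  ∷ p) = inj₁ (zero , refl , z≤n , refl)
first-⊕ zero    (outside ∷ p) = inj₂ (refl , refl)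
first-⊕ (suc z) (inside  ∷ p) = inj₁ (zero , refl , z≤n , refl)
first-⊕ (suc z) (outside ∷ p) with first-⊕ z p
... | inj₁ (f , e , f≤z , e′) =
  inj₁ (suc f , cong (Maybe.map suc) e , s≤s f≤z , cong (Maybe.map suc) e′)
... | inj₂ (e , e′) = inj₂ (cong (Maybe.map suc) e , cong (Maybe.map suc) e′)

first-⊕-hit : ∀ z (p : Subset n) → ∃ λ f → first (p ⊕ z) ≡ just f × f Fin.≤ z
first-⊕-hit z p with first-⊕ z p
... | inj₁ (f , _ , f≤z , e) = f , e , f≤z
... | inj₂ (_ , e)           = z , e , ℕ.≤-refl

first-min : ∀ y (p : Subset n) {f h} → first p ≡ just f → above y p ≡ just h → f Fin.≤ h
first-min y       (inside  ∷ p) refl _ = z≤n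
first-min zero    (outside ∷ p) e e′ with refl ← trans (sym e) e′ = ℕ.≤-refl
first-min (suc y) (outside ∷ p) e e′ with first p in eq | above y p in eq′
first-min (suc y) (outside ∷ p) refl refl | just _ | just _ = s≤s (first-min y p eq eq′)

above-hit : ∀ y z (p : Subset n) → y Fin.< z →
            ∃ λ h → above y (p ⊕ z) ≡ just h × h Fin.≤ z
above-hit zero    (suc z) (_ ∷ p) _ with first-⊕-hit z p
... | f , e , f≤z = suc f , cong (Maybe.map suc) e , s≤s f≤z
above-hit (suc y) (suc z) (_ ∷ p) (s≤s y<z) with above-hit y z p y<z
... | h , e , h≤z = suc h , cong (Maybe.map suc) e , s≤s h≤z

above-⊕-≤ : ∀ y z (p : Subset n) → y Fin.≤ z → above z (p ⊕ y) ≡ above z p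
above-⊕-≤ zero    zero    (_ ∷ p) _         = refl
above-⊕-≤ zero    (suc z) (_ ∷ p) _         = refl
above-⊕-≤ (suc y) (suc z) (_ ∷ p) (s≤s y≤z) = cong (Maybe.map suc) (above-⊕-≤ y z p y≤z)

first-⊕² : ∀ y z (p : Subset n) → y Fin.≤ z → first (p ⊕ y ⊕ z) ≡ first (p ⊕ y)
first-⊕² zero    zero    (_ ∷ p) _                   = refl
first-⊕² zero    (suc z) (_ ∷ p) _                   = refl
first-⊕² (suc y) (suc z) (inside  ∷ p) _             = refl
first-⊕² (suc y) (suc z) (outside ∷ p) (s≤s y≤z) = cong (Maybe.map suc) (first-⊕² y z p y≤z)

above-mono : ∀ y z (p : Subset n) {c} → y Fin.≤ z → above z p ≡ just c →
             ∃ λ b → above y p ≡ just b × b Fin.≤ c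
above-mono zero    zero    (_ ∷ p) _ e = _ , e , ℕ.≤-refl
above-mono zero    (suc z) (_ ∷ p) _ e with above z p in eq
above-mono zero    (suc z) (_ ∷ p) _ refl | just c with first-above z p eq
  where
  first-above : ∀ z (p : Subset n) {c} → above z p ≡ just c →
                ∃ λ b → first p ≡ just b × b Fin.≤ c
  first-above z       (inside  ∷ p) _ = zero , refl , z≤n
  first-above zero    (outside ∷ p) e = _ , e , ℕ.≤-refl
  first-above (suc z) (outside ∷ p) e with above z p in eq
  first-above (suc z) (outside ∷ p) refl | just c with first-above z p eq
  ... | b , e , b≤c = suc b , cong (Maybe.map suc) e , s≤s b≤c
... | b , e , b≤c = suc b , cong (Maybe.map suc) e , s≤s b≤c
above-mono (suc y) (suc z) (_ ∷ p) (s≤s y≤z) e with above z p in eq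
above-mono (suc y) (suc z) (_ ∷ p) (s≤s y≤z) refl | just c with above-mono y z p y≤z eq
... | b , e , b≤c = suc b , cong (Maybe.map suc) e , s≤s b≤c

-- The possible pairs of words bumped by the two sides of a κ or a ƛ.
data Bumped : List (Fin n) → List (Fin n) → Set where
  same : ∀ {u v : List (Fin n)} → u ≡ v → Bumped u v
  gen  : (β : StylCell n) → Bumped (src (Σstyl n) β) (tgt (Σstyl n) β)
  dup  : ∀ m (z : Fin n) → Bumped (fromMaybe m ++ z ∷ z ∷ []) (fromMaybe m ++ fromMaybe m ++ z ∷ [])

Bumped-suc : ∀ {u v : List (Fin n)} → Bumped u v → Bumped (map Fin.suc u) (map Fin.suc v)
Bumped-suc (same e)              = same (cong (map Fin.suc) e)
Bumped-suc (gen (η x))           = gen (η (suc x))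
Bumped-suc (gen (κ x y z p q))   = gen (κ (suc x) (suc y) (suc z) (s≤s p) (s≤s q))
Bumped-suc (gen (ƛ x y z p q))   = gen (ƛ (suc x) (suc y) (suc z) (s≤s p) (s≤s q))
Bumped-suc (dup nothing z)       = dup nothing (suc z)
Bumped-suc (dup (just a) z)      = dup (just (suc a)) (suc z)

join₃ : (a b c : Maybe (Fin n)) → List (Fin n)
join₃ a b c = fromMaybe a ++ fromMaybe b ++ fromMaybe c ++ []

join₃-suc : (a b c : Maybe (Fin n)) →
            join₃ (Maybe.map suc a) (Maybe.map suc b) (Maybe.map suc c) ≡ map Fin.suc (join₃ a b c)
join₃-suc nothing  nothing  nothing  = refl
join₃-suc nothing  nothing  (just _) = refl
join₃-suc nothing  (just _) nothing  = refl
join₃-suc nothing  (just _) (just _) = refl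
join₃-suc (just _) nothing  nothing  = refl
join₃-suc (just _) nothing  (just _) = refl
join₃-suc (just _) (just _) nothing  = refl
join₃-suc (just _) (just _) (just _) = refl

Bumped-suc₃ : ∀ (a b c a′ b′ c′ : Maybe (Fin n)) → Bumped (join₃ a b c) (join₃ a′ b′ c′) →
  Bumped (join₃ (Maybe.map suc a) (Maybe.map suc b) (Maybe.map suc c))
         (join₃ (Maybe.map suc a′) (Maybe.map suc b′) (Maybe.map suc c′))
Bumped-suc₃ a b c a′ b′ c′ β =
  subst₂ Bumped (sym (join₃-suc a b c)) (sym (join₃-suc a′ b′ c′)) (Bumped-suc β)

Bumped-map : ∀ b (p : Subset n) u v → Bumped (bumps p u) (bumps p v) →
             Bumped (bumps (b ∷ p) (map Fin.suc u)) (bumps (b ∷ p) (map Fin.suc v))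
Bumped-map b p u v β =
  subst₂ Bumped (sym (bumps-suc b p u)) (sym (bumps-suc b p v)) (Bumped-suc β)

κ-core : ∀ z (p : Subset n) H {h} → H ≡ just h → h Fin.≤ z →
         (∀ {f} → first (p ⊕ z) ≡ just f → f Fin.≤ h) →
         Bumped (join₃ (above z p) (first (p ⊕ z)) H) (join₃ (first p) (above z p) H)
κ-core z p _ {h} refl h≤z f≤h with first-⊕ z p
κ-core z p _ {h} refl h≤z f≤h | inj₁ (f , e , f≤z , e′) rewrite e | e′ with above z p in eq
... | nothing = same refl
... | just a  = gen (κ f h a (f≤h refl) (ℕ.≤-<-trans h≤z (above-> z p eq)))
κ-core z p _ {h} refl h≤z f≤h | inj₂ (e , e′)
  rewrite e | e′ with refl ← Fin.≤-antisym h≤z (f≤h refl) = dup (above z p) z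

bumps-κ : ∀ (p : Subset n) x y z → x Fin.≤ y → y Fin.< z →
          Bumped (bumps p (z ∷ x ∷ y ∷ [])) (bumps p (x ∷ z ∷ y ∷ []))
bumps-κ (b ∷ p) zero zero (suc z) _ _ with first-⊕-hit z p
... | f , e , f≤z = Bumped-suc₃ (above z p) (first (p ⊕ z)) (first (p ⊕ z)) (first p) (above z p) (first (p ⊕ z))
    (κ-core z p _ e f≤z λ { e′ → ≤-just (trans (sym e′) e) })
  where
  ≤-just : ∀ {f h : Fin n} → just f ≡ just h → f Fin.≤ h
  ≤-just refl = ℕ.≤-refl
bumps-κ (b ∷ p) zero (suc y) (suc z) _ (s≤s y<z) with above-hit y z p y<z
... | h , e , h≤z = Bumped-suc₃ (above z p) (first (p ⊕ z)) (above y (p ⊕ z)) (first p) (above z p) (above y (p ⊕ z))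
    (κ-core z p _ e h≤z λ e′ → first-min y (p ⊕ z) e′ e)
bumps-κ (b ∷ p) (suc x) (suc y) (suc z) (s≤s x≤y) (s≤s y<z) =
  Bumped-map b p (z ∷ x ∷ y ∷ []) (x ∷ z ∷ y ∷ []) (bumps-κ p x y z x≤y y<z)

bumps-ƛ : ∀ (p : Subset n) x y z → x Fin.< y → y Fin.≤ z →
          Bumped (bumps p (y ∷ z ∷ x ∷ [])) (bumps p (y ∷ x ∷ z ∷ []))
bumps-ƛ (b ∷ p) zero (suc y) (suc z) _ (s≤s y≤z) = Bumped-suc₃
  (above y p) (above z (p ⊕ y)) (first (p ⊕ y ⊕ z)) (above y p) (first (p ⊕ y)) (above z (p ⊕ y)) core
  where
  core : Bumped (join₃ (above y p) (above z (p ⊕ y)) (first (p ⊕ y ⊕ z)))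
                (join₃ (above y p) (first (p ⊕ y)) (above z (p ⊕ y)))
  core rewrite above-⊕-≤ y z p y≤z | first-⊕² y z p y≤z
    with above z p in eq | first-⊕-hit y p
  ... | nothing | d , e , d≤y rewrite e = same (cong (fromMaybe (above y p) ++_) refl)
  ... | just c  | d , e , d≤y with above-mono y z p y≤z eq
  ... | b , e′ , b≤c rewrite e | e′ =
    gen (ƛ d b c (ℕ.≤-<-trans d≤y (above-> y p e′)) b≤c)
bumps-ƛ (b ∷ p) (suc x) (suc y) (suc z) (s≤s x<y) (s≤s y≤z) =
  Bumped-map b p (y ∷ z ∷ x ∷ []) (y ∷ x ∷ z ∷ []) (bumps-ƛ p x y z x<y y≤z)

∅-first-⊕ : (z : Fin n) → first (∅ ⊕ z) ≡ just z
∅-first-⊕ zero    = refl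
∅-first-⊕ (suc z) = cong (Maybe.map suc) (∅-first-⊕ z)

∅-above-⊕ : (y z : Fin n) → y Fin.< z → above y (∅ ⊕ z) ≡ just z
∅-above-⊕ zero    (suc z) _         = cong (Maybe.map suc) (∅-first-⊕ z)
∅-above-⊕ (suc y) (suc z) (s≤s y<z) = cong (Maybe.map suc) (∅-above-⊕ y z y<z)

map-∅ : ∀ u {v : List (Fin n)} → bumps ∅ u ≡ v → bumps ∅ (map Fin.suc u) ≡ map Fin.suc v
map-∅ u e = trans (bumps-suc outside ∅ u) (cong (map Fin.suc) e)

bumps-∅-κ : ∀ (x y z : Fin n) → x Fin.≤ y → y Fin.< z →
            bumps ∅ (z ∷ x ∷ y ∷ []) ≡ z ∷ z ∷ [] × bumps ∅ (x ∷ z ∷ y ∷ []) ≡ z ∷ []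
bumps-∅-κ {suc n} zero zero (suc z) _ _
  rewrite ∅-above z | ∅-first-⊕ z | ∅-first {n} = refl , refl
bumps-∅-κ {suc n} zero (suc y) (suc z) _ (s≤s y<z)
  rewrite ∅-above z | ∅-first-⊕ z | ∅-first {n} | ∅-above-⊕ y z y<z = refl , refl
bumps-∅-κ (suc x) (suc y) (suc z) (s≤s x≤y) (s≤s y<z) with bumps-∅-κ x y z x≤y y<z
... | e , e′ = map-∅ (z ∷ x ∷ y ∷ []) e , map-∅ (x ∷ z ∷ y ∷ []) e′

bumps-∅-ƛ : ∀ (x y z : Fin n) → x Fin.< y → y Fin.≤ z →
            bumps ∅ (y ∷ z ∷ x ∷ []) ≡ y ∷ [] × bumps ∅ (y ∷ x ∷ z ∷ []) ≡ y ∷ []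
bumps-∅-ƛ zero (suc y) (suc z) _ (s≤s y≤z)
  rewrite above-⊕-≤ y z ∅ y≤z | first-⊕² y z ∅ y≤z | ∅-above y | ∅-above z | ∅-first-⊕ y
  = refl , refl
bumps-∅-ƛ (suc x) (suc y) (suc z) (s≤s x<y) (s≤s y≤z) with bumps-∅-ƛ x y z x<y y≤z
... | e , e′ = map-∅ (y ∷ z ∷ x ∷ []) e , map-∅ (y ∷ x ∷ z ∷ []) e′

⊕-comm : (p : Subset n) {x y : Fin n} → x ≢ y → p ⊕ x ⊕ y ≡ p ⊕ y ⊕ x
⊕-comm p {x} {y} = Vec.[]≔-commutes p x y

<⇒≢ : {x y : Fin n} → x Fin.< y → x ≢ y
<⇒≢ x<x refl = ℕ.<-irrefl refl x<x

⊕-gen : (p : Subset n) (β : StylCell n) →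
        foldl _⊕_ p (src (Σstyl n) β) ≡ foldl _⊕_ p (tgt (Σstyl n) β)
⊕-gen p (η x)         = Vec.[]≔-idempotent p x
⊕-gen p (κ x y z q s) = cong (_⊕ y) (sym (⊕-comm p
  (<⇒≢ (recompute (x Fin.<? z) (ℕ.≤-<-trans q s)))))
⊕-gen p (ƛ x y z q s) = sym (⊕-comm (p ⊕ y)
  (<⇒≢ (recompute (x Fin.<? z) (ℕ.<-≤-trans q s))))

◂-η : (T : Tableau n) (x : Fin n) → T ◂ (x ∷ x ∷ []) ≡ T ◂ (x ∷ [])
◂-η []      x rewrite above-⊕-self ∅ x | ∅-above x =
  cong (_∷ []) (row-≡ (Vec.[]≔-idempotent ∅ x))
◂-η (u ∷ T) x = trans (◂-∷ u T (x ∷ x ∷ [])) (trans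
  (cong₂ _∷_ (row-≡ (⊕-gen (supp u) (η x))) bump) (sym (◂-∷ u T (x ∷ []))))
  where
  bump : T ◂ bumps (supp u) (x ∷ x ∷ []) ≡ T ◂ bumps (supp u) (x ∷ [])
  bump rewrite above-⊕-self (supp u) x with above x (supp u)
  ... | nothing = refl
  ... | just y  = ◂-η T y

◂-Bumped : (T : Tableau n) → (∀ β → T ◂ src (Σstyl n) β ≡ T ◂ tgt (Σstyl n) β) →
           ∀ {u v} → Bumped u v → T ◂ u ≡ T ◂ v
◂-Bumped T hyp (same e)          = cong (T ◂_) e
◂-Bumped T hyp (gen β)           = hyp β
◂-Bumped T hyp (dup nothing z)   = ◂-η T z
◂-Bumped T hyp (dup (just a) z)  = trans (◂-η (insert T a) z)
  (sym (cong (_◂ (z ∷ [])) (◂-η T a)))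

◂-gen : (T : Tableau n) (β : StylCell n) → T ◂ src (Σstyl n) β ≡ T ◂ tgt (Σstyl n) β
◂-gen T (η x) = ◂-η T x
◂-gen [] β@(κ x y z p q) = trans (◂-[] z (x ∷ y ∷ [])) (trans
  (cong₂ _∷_ (row-≡ {v = addAll (r x) (z ∷ y ∷ [])} (⊕-gen ∅ β)) bump) (sym (◂-[] x (z ∷ y ∷ []))))
  where
  bump : [] ◂ bumps ∅ (z ∷ x ∷ y ∷ []) ≡ [] ◂ bumps ∅ (x ∷ z ∷ y ∷ [])
  bump with bumps-∅-κ x y z (recompute (x Fin.≤? y) p) (recompute (y Fin.<? z) q)
  ... | e , e′ = trans (cong ([] ◂_) e) (trans (◂-η [] z) (cong ([] ◂_) (sym e′)))
◂-gen [] β@(ƛ x y z p q) = trans (◂-[] y (z ∷ x ∷ [])) (trans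
  (cong₂ _∷_ (row-≡ (⊕-gen ∅ β)) bump) (sym (◂-[] y (x ∷ z ∷ []))))
  where
  bump : [] ◂ bumps ∅ (y ∷ z ∷ x ∷ []) ≡ [] ◂ bumps ∅ (y ∷ x ∷ z ∷ [])
  bump with bumps-∅-ƛ x y z (recompute (x Fin.<? y) p) (recompute (y Fin.≤? z) q)
  ... | e , e′ = cong ([] ◂_) (trans e (sym e′))
◂-gen (u ∷ T) β@(κ x y z p q) = trans (◂-∷ u T (src (Σstyl _) β)) (trans
  (cong₂ _∷_ (row-≡ (⊕-gen (supp u) β)) (◂-Bumped T (◂-gen T)
    (bumps-κ (supp u) x y z (recompute (x Fin.≤? y) p) (recompute (y Fin.<? z) q))))
  (sym (◂-∷ u T (tgt (Σstyl _) β))))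
◂-gen (u ∷ T) β@(ƛ x y z p q) = trans (◂-∷ u T (src (Σstyl _) β)) (trans
  (cong₂ _∷_ (row-≡ (⊕-gen (supp u) β)) (◂-Bumped T (◂-gen T)
    (bumps-ƛ (supp u) x y z (recompute (x Fin.<? y) p) (recompute (y Fin.≤? z) q))))
  (sym (◂-∷ u T (tgt (Σstyl _) β))))

◂-resp : (T : Tableau n) {u v : List (Fin n)} → u ≋ v → T ◂ u ≡ T ◂ v
◂-resp T (~-gen β)      = ◂-gen T β
◂-resp T ~-refl         = refl
◂-resp T (~-sym e)      = sym (◂-resp T e)
◂-resp T (~-trans e e′) = trans (◂-resp T e) (◂-resp T e′)
◂-resp T (~-++ {u} {v} {u′} {v′} e e′) =
  trans (◂-++ T u u′) (trans (cong (_◂ u′) (◂-resp T e))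
    (trans (◂-resp (T ◂ v) e′) (sym (◂-++ T v v′))))

N-resp : {u v : List (Fin n)} → u ≋ v → N u ≡ N v
N-resp = ◂-resp []

-- leftover p q is the support of the letters bumped when the row q is inserted
-- in the row p.
leftover leftover⁺ : Subset n → Subset n → Subset n
leftover []      []            = []
leftover (_ ∷ p) (outside ∷ q) = outside ∷ leftover p q
leftover (_ ∷ p) (inside  ∷ q) = outside ∷ leftover⁺ p q
leftover⁺ []            []            = []
leftover⁺ (outside ∷ p) (_ ∷ q)       = outside ∷ leftover⁺ p q
leftover⁺ (inside  ∷ p) (outside ∷ q) = inside ∷ leftover p q
leftover⁺ (inside  ∷ p) (inside  ∷ q) = inside ∷ leftover⁺ p q

bumps-leftover  : (p q : Subset n) → bumps p (word q) ≋ word (leftover p q)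
bumps-leftover⁺ : (p q : Subset n) →
                  fromMaybe (first p) ++ bumps p (word q) ≋ word (leftover⁺ p q)

bumps-zero : ∀ b (p : Subset n) w → bumps (b ∷ p) (zero ∷ map Fin.suc w)
                                    ≡ map Fin.suc (fromMaybe (first p) ++ bumps p w)
bumps-zero b p w = trans
  (cong₂ _++_ (fromMaybe-suc (first p)) (bumps-suc inside p w))
  (sym (List.map-++ Fin.suc (fromMaybe (first p)) (bumps p w)))

bumps-leftover []      []            = ~-refl
bumps-leftover (b ∷ p) (outside ∷ q) =
  ~-trans (~-reflexive _ (bumps-suc b p (word q))) (≋-shift (bumps-leftover p q))
bumps-leftover (b ∷ p) (inside  ∷ q) =
  ~-trans (~-reflexive _ (bumps-zero b p (word q))) (≋-shift (bumps-leftover⁺ p q))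

bumps-leftover⁺ []            []            = ~-refl
bumps-leftover⁺ (outside ∷ p) (outside ∷ q) = ~-trans
  (~-reflexive _ (trans
    (cong₂ _++_ (fromMaybe-suc (first p)) (bumps-suc outside p (word q)))
    (sym (List.map-++ Fin.suc (fromMaybe (first p)) _))))
  (≋-shift (bumps-leftover⁺ p q))
bumps-leftover⁺ (outside ∷ p) (inside  ∷ q) = ~-trans
  (~-reflexive _ (cong₂ _++_ (fromMaybe-suc (first p)) (bumps-zero outside p (word q))))
  (~-trans (twice (first p) (bumps p (word q))) (≋-shift (bumps-leftover⁺ p q)))
  where
  twice : ∀ m w → map Fin.suc (fromMaybe m) ++ map Fin.suc (fromMaybe m ++ w)
                  ≋ map Fin.suc (fromMaybe m ++ w)
  twice nothing  w = ~-refl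
  twice (just y) w = ~-++ (~-gen (η (suc y))) ~-refl
bumps-leftover⁺ (inside ∷ p) (outside ∷ q) = ≋-∷ zero
  (~-trans (~-reflexive _ (bumps-suc inside p (word q))) (≋-shift (bumps-leftover p q)))
bumps-leftover⁺ (inside ∷ p) (inside ∷ q) = ≋-∷ zero
  (~-trans (~-reflexive _ (bumps-zero inside p (word q))) (≋-shift (bumps-leftover⁺ p q)))

_∪ᵣ_ : Row n → Row n → Row n
u ∪ᵣ v = row (supp u ∪ supp v) (union (supp u) (nonemptyᵣ u))
  where
  union : (p : Subset n) {q : Subset n} → Nonempty p → Nonempty (p ∪ q)
  union p {q} (x , x∈p) = x , Sub.p⊆p∪q q x∈p

adds-suc : ∀ b (p : Subset n) w →
           foldl _⊕_ (b ∷ p) (map Fin.suc w) ≡ b ∷ foldl _⊕_ p w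
adds-suc b p []      = refl
adds-suc b p (x ∷ w) = adds-suc b (p ⊕ x) w

adds-word : (p q : Subset n) → foldl _⊕_ p (word q) ≡ p ∪ q
adds-word []            []            = refl
adds-word (inside  ∷ p) (outside ∷ q) = trans (adds-suc _ p (word q)) (cong (_ ∷_) (adds-word p q))
adds-word (outside ∷ p) (outside ∷ q) = trans (adds-suc _ p (word q)) (cong (_ ∷_) (adds-word p q))
adds-word (inside  ∷ p) (inside  ∷ q) = trans (adds-suc _ p (word q)) (cong (_ ∷_) (adds-word p q))
adds-word (outside ∷ p) (inside  ∷ q) = trans (adds-suc _ p (word q)) (cong (_ ∷_) (adds-word p q))

supp-addAll : (u : Row n) (w : List (Fin n)) → supp (addAll u w) ≡ foldl _⊕_ (supp u) w
supp-addAll u []      = refl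
supp-addAll u (x ∷ w) = supp-addAll (u +ᵣ x) w

◂-row : (u : Row n) (T : Tableau n) (v : Row n) →
        (u ∷ T) ◂ letters v ≡ (u ∪ᵣ v) ∷ (T ◂ word (leftover (supp u) (supp v)))
◂-row u T v = trans (◂-∷ u T (letters v)) (cong₂ _∷_
  (row-≡ (trans (supp-addAll u (letters v)) (adds-word (supp u) (supp v))))
  (◂-resp T (bumps-leftover (supp u) (supp v))))

bumps-∅ : (p : Subset n) → bumps ∅ (word p) ≡ []
bumps-∅ []            = refl
bumps-∅ (outside ∷ p) = map-∅ (word p) (bumps-∅ p)
bumps-∅ {suc n} (inside ∷ p) = trans (bumps-zero outside ∅ (word p))
  (cong (map Fin.suc) (trans (cong (λ m → fromMaybe m ++ bumps ∅ (word p)) (∅-first {n})) (bumps-∅ p)))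

N-row : (p : Subset n) → (N (word p) ≡ []) ⊎ (∃ λ (u : Row n) → N (word p) ≡ u ∷ [] × supp u ≡ p)
N-row p with word p in eq
... | []    = inj₁ refl
... | x ∷ w = inj₂ (addAll (r x) w , trans (◂-[] x w) (cong (λ b → addAll (r x) w ∷ ([] ◂ b)) none) ,
    trans (supp-addAll (r x) w) (trans (cong (foldl _⊕_ ∅) (sym eq))
      (trans (adds-word ∅ p) (Sub.∪-identityˡ p))))
  where
  none : bumps ∅ (x ∷ w) ≡ []
  none = trans (cong (bumps ∅) (sym eq)) (bumps-∅ p)

word-nonempty : (p : Subset n) → .(Nonempty p) → word p ≢ []
word-nonempty []            ne e = ⊥-elim-irr (¬nonempty-[] ne)
word-nonempty (outside ∷ p) ne e with word p in eq
word-nonempty (outside ∷ p) ne e | [] = word-nonempty p (pop ne) eq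

N-letters : (u : Row n) → N (letters u) ≡ u ∷ []
N-letters u with N-row (supp u)
... | inj₂ (v , e , e′) = trans e (cong (_∷ []) (row-≡ e′))
... | inj₁ e with letters u in eq
...   | []    = contradiction eq (word-nonempty (supp u) (nonemptyᵣ u))
...   | x ∷ w = contradiction (trans (sym (◂-[] x w)) e) λ ()

·-shape : (u v : Row n) → u · v ≡ (u ∪ᵣ v) ∷ [] ⊎ ∃ λ w → u · v ≡ (u ∪ᵣ v) ∷ w ∷ []
·-shape u v with N-row (leftover (supp u) (supp v)) | ·-leftover
  where
  ·-leftover : u · v ≡ (u ∪ᵣ v) ∷ N (word (leftover (supp u) (supp v)))
  ·-leftover = trans (◂-++ [] (letters u) (letters v))
    (trans (cong (_◂ letters v) (N-letters u)) (◂-row u [] v))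
... | inj₁ e           | eq = inj₁ (trans eq (cong ((u ∪ᵣ v) ∷_) e))
... | inj₂ (w , e , _) | eq = inj₂ (w , trans eq (cong ((u ∪ᵣ v) ∷_) e))

least-∈ : (p : Subset n) (ne : Nonempty p) → least p ne ∈ₛ p
least-∈ []            (() , _)
least-∈ (inside  ∷ p) ne = here
least-∈ (outside ∷ p) ne = there (least-∈ p (pop ne))

least-≤ : (p : Subset n) .(ne : Nonempty p) {x : Fin n} → x ∈ₛ p → least p ne Fin.≤ x
least-≤ (inside  ∷ p) ne x∈p         = z≤n
least-≤ (outside ∷ p) ne (there x∈p) = s≤s (least-≤ p (pop ne) x∈p)

min-∈ : (u : Row n) → min u ∈ₛ supp u
min-∈ u = least-∈ (supp u) (nonemptyᵣ u)

min-≤ : (u : Row n) {x : Fin n} → x ∈ₛ supp u → min u Fin.≤ x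
min-≤ u = least-≤ (supp u) (nonemptyᵣ u)

∈-⊕⁻ : (p : Subset n) {x y : Fin n} → y ∈ₛ p ⊕ x → y ≡ x ⊎ y ∈ₛ p
∈-⊕⁻ (_ ∷ p) {zero}  here         = inj₁ refl
∈-⊕⁻ (_ ∷ p) {zero}  (there y∈p)  = inj₂ (there y∈p)
∈-⊕⁻ (_ ∷ p) {suc x} here         = inj₂ here
∈-⊕⁻ (_ ∷ p) {suc x} (there y∈p⊕) with ∈-⊕⁻ p y∈p⊕
... | inj₁ refl = inj₁ refl
... | inj₂ y∈p  = inj₂ (there y∈p)

⊆-⊕ : (p : Subset n) (x : Fin n) → p ⊆ p ⊕ x
⊆-⊕ (_ ∷ p) zero    here        = here
⊆-⊕ (_ ∷ p) zero    (there y∈p) = there y∈p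
⊆-⊕ (_ ∷ p) (suc x) here        = here
⊆-⊕ (_ ∷ p) (suc x) (there y∈p) = there (⊆-⊕ p x y∈p)

∅-⊕⁻ : {x y : Fin n} → y ∈ₛ ∅ ⊕ x → y ≡ x
∅-⊕⁻ y∈ with ∈-⊕⁻ ∅ y∈
... | inj₁ e  = e
... | inj₂ y∈ = contradiction y∈ Sub.∉⊥

first-∈ : (p : Subset n) {y : Fin n} → first p ≡ just y → y ∈ₛ p
first-∈ (inside  ∷ p) refl = here
first-∈ (outside ∷ p) e with first p in eq
first-∈ (outside ∷ p) refl | just y = there (first-∈ p eq)

above-∈ : (x : Fin n) (p : Subset n) {y : Fin n} → above x p ≡ just y → y ∈ₛ p
above-∈ zero    (_ ∷ p) e with first p in eq
above-∈ zero    (_ ∷ p) refl | just y = there (first-∈ p eq)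
above-∈ (suc x) (_ ∷ p) e with above x p in eq
above-∈ (suc x) (_ ∷ p) refl | just y = there (above-∈ x p eq)

⊲-⊇ : {t u v : Row n} → supp u ⊆ supp v → t ⊲ u → t ⊲ v
⊲-⊇ {u = u} {v} u⊆v (t⊆u , u<t) =
  (λ x∈t → u⊆v (t⊆u x∈t)) , ℕ.≤-<-trans (min-≤ v (u⊆v (min-∈ u))) u<t

⊲-bump : {t u : Row n} {x y : Fin n} → t ⊲ u → y ∈ₛ supp u → x Fin.< y → t +ᵣ y ⊲ u +ᵣ x
⊲-bump {t = t} {u} {x} {y} t⊲u@(t⊆u , u<t) y∈u x<y = sub , less
  where
  sub : supp (t +ᵣ y) ⊆ supp (u +ᵣ x)
  sub z∈ with ∈-⊕⁻ (supp t) z∈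
  ... | inj₁ refl = ⊆-⊕ (supp u) x y∈u
  ... | inj₂ z∈t  = ⊆-⊕ (supp u) x (t⊆u z∈t)
  less : min (u +ᵣ x) Fin.< min (t +ᵣ y)
  less with ∈-⊕⁻ (supp t) (min-∈ (t +ᵣ y))
  ... | inj₁ e  = ℕ.<-≤-trans (ℕ.≤-<-trans (min-≤ (u +ᵣ x) (∈-⊕ (supp u) x)) x<y)
                              (ℕ.≤-reflexive (cong Fin.toℕ (sym e)))
  ... | inj₂ m∈ = ℕ.<-≤-trans
    (ℕ.≤-<-trans (min-≤ (u +ᵣ x) (⊆-⊕ (supp u) x (min-∈ u))) u<t) (min-≤ t m∈)

⊲-r : {u : Row n} {x y : Fin n} → y ∈ₛ supp u → x Fin.< y → r y ⊲ u +ᵣ x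
⊲-r {u = u} {x} {y} y∈u x<y = sub , less
  where
  sub : supp (r y) ⊆ supp (u +ᵣ x)
  sub z∈ with refl ← ∅-⊕⁻ z∈ = ⊆-⊕ (supp u) x y∈u
  less : min (u +ᵣ x) Fin.< min (r y)
  less = ℕ.<-≤-trans (ℕ.≤-<-trans (min-≤ (u +ᵣ x) (∈-⊕ (supp u) x)) x<y)
                     (ℕ.≤-reflexive (cong Fin.toℕ (sym (∅-⊕⁻ (min-∈ (r y))))))

insert-tableau : {T : Tableau n} (x : Fin n) → IsTableau T → IsTableau (insert T x)
insert-tableau {T = []}         x _   = [-]
insert-tableau {T = u ∷ []}     x _ with above x (supp u) in eq
... | nothing = [-]
... | just y  = ⊲-r {u = u} (above-∈ x (supp u) eq) (above-> x (supp u) eq) ∷ [-]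
insert-tableau {T = u ∷ t ∷ T} x (t⊲u ∷ tab) with above x (supp u) in eq
... | nothing = ⊲-⊇ {t = t} {u} {u +ᵣ x} (⊆-⊕ (supp u) x) t⊲u ∷ tab
... | just y  = ⊲-bump {t = t} {u} t⊲u (above-∈ x (supp u) eq) (above-> x (supp u) eq)
                ∷ insert-tableau y tab

N-tableau : (w : List (Fin n)) → IsTableau (N w)
N-tableau = go []
  where
  go : {T : Tableau n} → IsTableau T → ∀ w → IsTableau (T ◂ w)
  go tab []      = tab
  go tab (x ∷ w) = go (insert-tableau x tab) w

leftover-⊲  : (p q : Subset n) .(np : Nonempty p) .(nq : Nonempty q) →
              p ⊆ q → least q nq Fin.< least p np → leftover p q ≡ p
leftover⁺-⊆ : (p q : Subset n) → p ⊆ q → leftover⁺ p q ≡ p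

leftover-⊲ []            []            _  _  _   _   = refl
leftover-⊲ (inside  ∷ p) (outside ∷ q) _  _  p⊆q _   with () ← p⊆q here
leftover-⊲ (outside ∷ p) (outside ∷ q) np nq p⊆q (s≤s q<p) =
  cong (outside ∷_) (leftover-⊲ p q (pop np) (pop nq) (Sub.drop-∷-⊆ p⊆q) q<p)
leftover-⊲ (outside ∷ p) (inside  ∷ q) _  _  p⊆q _   =
  cong (outside ∷_) (leftover⁺-⊆ p q (Sub.drop-∷-⊆ p⊆q))

leftover⁺-⊆ []            []            _   = refl
leftover⁺-⊆ (outside ∷ p) (_ ∷ q)       p⊆q =
  cong (outside ∷_) (leftover⁺-⊆ p q (Sub.drop-∷-⊆ p⊆q))
leftover⁺-⊆ (inside  ∷ p) (inside  ∷ q) p⊆q =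
  cong (inside ∷_) (leftover⁺-⊆ p q (Sub.drop-∷-⊆ p⊆q))
leftover⁺-⊆ (inside  ∷ p) (outside ∷ q) p⊆q with () ← p⊆q here

∪-⊆ : (p q : Subset n) → p ⊆ q → p ∪ q ≡ q
∪-⊆ p q p⊆q = Sub.⊆-antisym (λ x∈ → [ p⊆q , id ]′ (Sub.x∈p∪q⁻ p q x∈)) (Sub.q⊆p∪q p q)

◂-tableau : {u : Row n} {T : Tableau n} → IsTableau (u ∷ T) → T ◂ letters u ≡ u ∷ T
◂-tableau {u = u} [-] = N-letters u
◂-tableau {u = u} {t ∷ T} ((t⊆u , u<t) ∷ tab) = trans (◂-row t T u) (cong₂ _∷_
  (row-≡ (∪-⊆ (supp t) (supp u) t⊆u))
  (trans (cong (λ p → T ◂ word p)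
           (leftover-⊲ (supp t) (supp u) (nonemptyᵣ t) (nonemptyᵣ u) t⊆u u<t))
         (◂-tableau tab)))

N-𝓡 : {T : Tableau n} → IsTableau T → N (flat (𝓡 T)) ≡ T
N-𝓡 {T = []}    _   = refl
N-𝓡 {T = u ∷ T} tab = trans (cong N (flat-𝓡-∷ u T))
  (trans (◂-++ [] (flat (𝓡 T)) (letters u))
  (trans (cong (_◂ letters u) (N-𝓡 (tail tab))) (◂-tableau tab)))
  where
  tail : ∀ {u T} → IsTableau (u ∷ T) → IsTableau T
  tail [-]       = []
  tail (_ ∷ tab) = tab

record RowCell (n : ℕ) : Set where
  constructor α
  field
    upper lower : Row n
    .reducible  : ¬ upper ⊲ lower

Σrow : (n : ℕ) → Polygraph₂ (Row n)
Σrow n .Gen₂            = RowCell n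
Σrow n .src (α u v _)   = u ∷ v ∷ []
Σrow n .tgt (α u v _)   = 𝓡 (u · v)

Irreducible : List (Row n) → Set
Irreducible = Linked _⊲_

-- The pair u v is the leftmost reducible one, since a u is irreducible.
data Normalization {n : ℕ} : List (Row n) → Set where
  done    : ∀ {w} → Irreducible w → Normalization w
  rewrite-at : ∀ a u v b → Irreducible (a ∷ʳ u) → ¬ u ⊲ v →
            Normalization (a ++ 𝓡 (u · v) ++ b) → Normalization (a ++ u ∷ v ∷ b)

Irreducible-∷ʳ : ∀ a (u v : Row n) b →
                 Irreducible (a ∷ʳ u) → u ⊲ v → Irreducible (v ∷ b) → Irreducible (a ++ u ∷ v ∷ b)
Irreducible-∷ʳ []           u v b _          u⊲v irr = u⊲v ∷ irr
Irreducible-∷ʳ (t ∷ [])     u v b (t⊲u ∷ _)  u⊲v irr = t⊲u ∷ u⊲v ∷ irr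
Irreducible-∷ʳ (s ∷ t ∷ a)  u v b (s⊲t ∷ i)  u⊲v irr = s⊲t ∷ Irreducible-∷ʳ (t ∷ a) u v b i u⊲v irr

Irreducible-∪ : ∀ a (u v : Row n) b → Irreducible (a ++ u ∷ b) → Irreducible (v ∷ b) →
                Irreducible (a ++ (u ∪ᵣ v) ∷ b)
Irreducible-∪ []          u v []      _           _         = [-]
Irreducible-∪ []          u v (d ∷ b) ((u⊆d , d<u) ∷ irr) ((v⊆d , d<v) ∷ _) = (sub , less) ∷ irr
  where
  sub : supp (u ∪ᵣ v) ⊆ supp d
  sub x∈ = [ u⊆d , v⊆d ]′ (Sub.x∈p∪q⁻ (supp u) (supp v) x∈)
  less : min d Fin.< min (u ∪ᵣ v)
  less with Sub.x∈p∪q⁻ (supp u) (supp v) (min-∈ (u ∪ᵣ v))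
  ... | inj₁ m∈u = ℕ.<-≤-trans d<u (min-≤ u m∈u)
  ... | inj₂ m∈v = ℕ.<-≤-trans d<v (min-≤ v m∈v)
Irreducible-∪ (t ∷ [])    u v b (t⊲u ∷ i) irr =
  ⊲-⊇ {t = t} {u} {u ∪ᵣ v} (Sub.p⊆p∪q (supp v)) t⊲u ∷ Irreducible-∪ [] u v b i irr
Irreducible-∪ (s ∷ t ∷ a) u v b (s⊲t ∷ i) irr = s⊲t ∷ Irreducible-∪ (t ∷ a) u v b i irr

Irreducible-prefix : ∀ (a b : List (Row n)) → Irreducible (a ++ b) → Irreducible a
Irreducible-prefix []          b _         = []
Irreducible-prefix (u ∷ [])    b _         = [-]
Irreducible-prefix (u ∷ v ∷ a) b (p ∷ irr) = p ∷ Irreducible-prefix (v ∷ a) b irr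

-- Normalization of a v d s, where a is the reverse of T: the row v moves to the
-- left through a, and leaves a d reduced.
sweep : (T : Tableau n) (v : Row n) (d s : List (Row n)) →
        Irreducible (reverse T ++ d) → Irreducible (v ∷ d) →
        (∀ w → Irreducible w → Normalization (w ++ s)) →
        Normalization (reverse T ++ v ∷ d ++ s)
sweep []      v d s _   irr k = k (v ∷ d) irr
sweep (u ∷ T) v d s irT irr k = subst Normalization (sym (split (v ∷ d ++ s))) step′
  where
  a = reverse T
  split : ∀ b → reverse (u ∷ T) ++ b ≡ a ++ u ∷ b
  split b = trans (cong (_++ b) (List.unfold-reverse u T)) (List.++-assoc a (u ∷ []) b)
  aud : Irreducible (a ++ u ∷ d)
  aud = subst Irreducible (split d) irT
  au : Irreducible (a ∷ʳ u)
  au = Irreducible-prefix (a ∷ʳ u) d (subst Irreducible (sym (List.++-assoc a (u ∷ []) d)) aud)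
  merged : Irreducible (a ++ (u ∪ᵣ v) ∷ d)
  merged = Irreducible-∪ a u v d aud irr
  next : Normalization (a ++ 𝓡 (u · v) ++ d ++ s)
  next with ·-shape u v
  ... | inj₁ e rewrite e = subst Normalization (List.++-assoc a (_ ∷ d) s)
                             (k (a ++ (u ∪ᵣ v) ∷ d) merged)
  ... | inj₂ (w , e) with tab ← subst IsTableau e (N-tableau (letters u ++ letters v))
    rewrite e with w⊲ ∷ _ ← tab =
    sweep T w ((u ∪ᵣ v) ∷ d) s merged (w⊲ ∷ tail-irr a merged) k
    where
    tail-irr : ∀ a {x} → Irreducible (a ++ x ∷ d) → Irreducible (x ∷ d)
    tail-irr []          i       = i
    tail-irr (_ ∷ [])    (_ ∷ i) = i
    tail-irr (_ ∷ y ∷ a) (_ ∷ i) = tail-irr (y ∷ a) i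
  step′ : Normalization (a ++ u ∷ v ∷ d ++ s)
  step′ with u ⊲? v
  ... | yes u⊲v = subst Normalization (List.++-assoc a (u ∷ v ∷ d) s)
                    (k (a ++ u ∷ v ∷ d) (Irreducible-∷ʳ a u v d au u⊲v irr))
  ... | no  u⋪v = rewrite-at a u v (d ++ s) au u⋪v next

normalization : (w : List (Row n)) → Normalization w
normalization = go [] []
  where
  go : ∀ w → Irreducible w → ∀ s → Normalization (w ++ s)
  go w irr []      = done (subst Irreducible (sym (List.++-identityʳ w)) irr)
  go w irr (v ∷ s) = subst (λ a → Normalization (a ++ v ∷ s)) (List.reverse-involutive w)
    (sweep (reverse w) v [] s
      (subst Irreducible (sym (trans (List.++-identityʳ _) (List.reverse-involutive w))) irr)
      [-] (λ w′ irr′ → go w′ irr′ s))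

normalForm : {w : List (Row n)} → Normalization w → List (Row n)
normalForm {w = w} (done _)             = w
normalForm         (rewrite-at _ _ _ _ _ _ d) = normalForm d

leftmostPath : {w : List (Row n)} (d : Normalization w) → Path (Σrow n) w (normalForm d)
leftmostPath (done _)                   = ε
leftmostPath (rewrite-at a u v b _ u⋪v d) = step a (α u v u⋪v) b refl refl ◅ leftmostPath d

-- The normal form of w, see normalForm-^.
infix 8 _^
_^ : List (Row n) → List (Row n)
w ^ = 𝓡 (N (flat w))

Path-flat : {u v : List (Row n)} → Path (Σrow n) u v → flat u ≋ flat v
Path-flat ε = ~-refl
Path-flat (step a (α u v _) b refl refl ◅ p) = ~-trans
  (~-reflexive _ (concatMap-++₃ letters a (u ∷ v ∷ []) b))
  (~-trans (~-++ (~-refl {u = flat a}) (~-++ {u′ = flat b}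
    (~-trans (~-reflexive _ (cong (letters u ++_) (List.++-identityʳ (letters v))))
             (≋-N (letters u ++ letters v)))
    ~-refl))
  (~-trans (~-reflexive _ (sym (concatMap-++₃ letters a (𝓡 (u · v)) b))) (Path-flat p)))

reverse-tableau : {w : List (Row n)} → Irreducible w → IsTableau (reverse w)
reverse-tableau {w = []}    _   = []
reverse-tableau {w = u ∷ w} irr = go w [-] irr
  where
  go : ∀ {t T} w → IsTableau (t ∷ T) → Irreducible (t ∷ w) →
       IsTableau (foldl (flip _∷_) (t ∷ T) w)
  go []      tab _           = tab
  go (v ∷ w) tab (t⊲v ∷ irr) = go w (t⊲v ∷ tab) irr

Irreducible-^ : {w : List (Row n)} → Irreducible w → w ^ ≡ w
Irreducible-^ {w = w} irr = trans (cong (λ v → 𝓡 (N (flat v))) (sym (List.reverse-involutive w)))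
  (trans (cong 𝓡 (N-𝓡 (reverse-tableau irr))) (List.reverse-involutive w))

^-resp : (u v : List (Row n)) → flat u ≋ flat v → u ^ ≡ v ^
^-resp u v e = cong 𝓡 (N-resp e)

normalForm-irr : {w : List (Row n)} (d : Normalization w) → Irreducible (normalForm d)
normalForm-irr (done irr)                 = irr
normalForm-irr (rewrite-at _ _ _ _ _ _ d) = normalForm-irr d

normalForm-^ : {w : List (Row n)} (d : Normalization w) → normalForm d ≡ w ^
normalForm-^ {w = w} d = trans (sym (Irreducible-^ (normalForm-irr d)))
  (sym (^-resp w (normalForm d) (Path-flat (leftmostPath d))))

Λ : (w : List (Row n)) → Path (Σrow n) w (w ^)
Λ w = castP refl (normalForm-^ (normalization w)) (leftmostPath (normalization w))

_≟ₐ_ : (β γ : RowCell n) → Dec (β ≡ γ)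
α u v _ ≟ₐ α u′ v′ _ = map′ (λ { (refl , refl) → refl }) (λ { refl → refl , refl })
                            ((u ≟ᵣ u′) ×-dec (v ≟ᵣ v′))

record Critical (n : ℕ) : Set where
  constructor critical
  field
    row₁ row₂ row₃ : Row n
    .reducible₁    : ¬ row₁ ⊲ row₂
    .reducible₂    : ¬ row₂ ⊲ row₃

source : Critical n → List (Row n)
source (critical u v t _ _) = u ∷ v ∷ t ∷ []

normalize-after : {w w′ : List (Row n)} → Path (Σrow n) w w′ → Path (Σrow n) w (w ^)
normalize-after {w = w} {w′} p = p ◅◅ castP refl (sym (^-resp w w′ (Path-flat p))) (Λ w′)

L R : (τ : Critical n) → Path (Σrow n) (source τ) (source τ ^)
L (critical u v t p _) = normalize-after ((stepOf (α u v p) ◅ ε) ▷ₚ (t ∷ []))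
R (critical u v t _ q) = normalize-after ((u ∷ []) ◁ₚ (stepOf (α v t q) ◅ ε))

𝔖 : Critical n → Set
𝔖 (critical u v t _ _) = Σ[ h ∈ 2 ≤ ℓ u ] ¬ ∂ u h ⊲ v

𝔖? : (τ : Critical n) → Dec (𝔖 τ)
𝔖? (critical u v t _ _) with 2 ℕ.≤? ℓ u
... | no  ≱ = no λ (h , _) → ≱ h
... | yes h = map′ (h ,_) proj₂ (¬? (∂ u h ⊲? v))

record 𝔗¹ (n : ℕ) : Set where
  constructor triple
  field
    τ   : Critical n
    .∉𝔖 : ¬ 𝔖 τ

_≟ₜ_ : (τ τ′ : 𝔗¹ n) → Dec (τ ≡ τ′)
triple (critical u v t _ _) _ ≟ₜ triple (critical u′ v′ t′ _ _) _ =
  map′ (λ { (refl , refl , refl) → refl }) (λ { refl → refl , refl , refl })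
       ((u ≟ᵣ u′) ×-dec (v ≟ᵣ v′) ×-dec (t ≟ᵣ t′))

subsets : ∀ n → List (Subset n)
subsets zero    = [] ∷ []
subsets (suc n) = cartesianProductWith _∷_ (outside ∷ inside ∷ []) (subsets n)

when : {A B : Set} → (A → B) → Dec A → Maybe B
when f (yes a) = just (f a)
when f (no  _) = nothing

rows : ∀ n → List (Row n)
rows n = mapMaybe (λ p → when (λ ne → row p ne) (Sub.nonempty? p)) (subsets n)

rowCells : ∀ n → List (RowCell n)
rowCells n = mapMaybe (λ (u , v) → when (λ u⋪v → α u v u⋪v) (¬? (u ⊲? v)))
  (cartesianProduct (rows n) (rows n))

criticals : ∀ n → List (Critical n)
criticals n = mapMaybe
  (λ (u , v , t) → when (λ (p , q) → critical u v t p q) (¬? (u ⊲? v) ×-dec ¬? (v ⊲? t)))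
  (cartesianProduct (rows n) (cartesianProduct (rows n) (rows n)))

triples : ∀ n → List (𝔗¹ n)
triples n = mapMaybe (λ τ → when (λ ∉𝔖 → triple τ ∉𝔖) (¬? (𝔖? τ))) (criticals n)

-- p = before ⋆₁ β ⋆₁ after, with β in empty context.
record Split {P : Polygraph₂ X} {u v : List X} (p : Path P u v) (β : Gen₂ P) : Set where
  constructor split
  field
    before : Path P u (src P β)
    after  : Path P (tgt P β) v
    eq     : p ≡ before ◅◅ (stepOf β ◅ after)

module _ {P : Polygraph₂ X} (_≟₁_ : (x y : X) → Dec (x ≡ y))
         (_≟₂_ : (β γ : Gen₂ P) → Dec (β ≡ γ)) where

  split? : ∀ {u v} (p : Path P u v) β → Dec (Split p β)
  split? ε β = no λ { (split ε _ ()) ; (split (_ ◅ _) _ ()) }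
  split? (s@(step l γ z e e′) ◅ p) β with split? p β
  ... | yes (split f g eq) = yes (split (s ◅ f) g (cong (s ◅_) eq))
  ... | no ¬later with List.≡-dec _≟₁_ l [] ×-dec γ ≟₂ β ×-dec List.≡-dec _≟₁_ z []
  ...   | yes (refl , refl , refl) = yes (now (trans e idʳ) (trans e′ idʳ))
    where
    idʳ : {w : List X} → w ++ [] ≡ w
    idʳ = List.++-identityʳ _
    now : ∀ {u w v} {e : u ≡ src P β ++ []} {e′ : w ≡ tgt P β ++ []} {p : Path P w v} →
          u ≡ src P β → w ≡ tgt P β → Split (step [] β [] e e′ ◅ p) β
    now refl refl = split ε _ (cong₂ (λ e e′ → step [] β [] e e′ ◅ _) (uip _ _) (uip _ _))
  ...   | no ¬now = no λ
    { (split ε       _ refl) → ¬now (refl , refl , refl)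
    ; (split (_ ◅ f) g refl) → ¬later (split f g refl) }

occurrences : RowCell n → 𝔗¹ n → ℕ
occurrences β (triple τ _) = length (filter (_≟ₐ β) (gens ⌜ L τ ⌝ ++ gens ⌜ R τ ⌝))

Eligible : 𝔗¹ n → RowCell n → Set
Eligible τ′@(triple τ _) β = (Split (L τ) β ⊎ Split (R τ) β) × occurrences β τ′ ≡ 1

eligible? : (τ : 𝔗¹ n) (β : RowCell n) → Dec (Eligible τ β)
eligible? τ′@(triple τ _) β =
  (split? _≟ᵣ_ _≟ₐ_ (L τ) β ⊎-dec split? _≟ᵣ_ _≟ₐ_ (R τ) β) ×-dec occurrences β τ′ ℕ.≟ 1

record EligiblePair (n : ℕ) : Set where
  constructor pair
  field
    {triple-of} : 𝔗¹ n
    {cell}      : RowCell n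
    eligible    : Eligible triple-of cell

open EligiblePair public

S : (e : EligiblePair n) → Track (Σrow n) (src (Σrow n) (cell e)) (tgt (Σrow n) (cell e))
S (pair {triple τ _} (inj₁ (split f g _) , _)) = ⌜ f ⌝ ⁻¹ ◅◅ ⌜ R τ ⌝ ◅◅ ⌜ g ⌝ ⁻¹
S (pair {triple τ _} (inj₂ (split f g _) , _)) = ⌜ f ⌝ ⁻¹ ◅◅ ⌜ L τ ⌝ ◅◅ ⌜ g ⌝ ⁻¹

dependencies : EligiblePair n → List (RowCell n)
dependencies e = gens (S e)

eligiblePairs : ∀ n → List (EligiblePair n)
eligiblePairs n = mapMaybe (λ (τ , β) → when (pair {triple-of = τ} {β}) (eligible? τ β))
  (cartesianProduct (triples n) (rowCells n))

rowOrder : ℕ → DecTotalOrder 0ℓ 0ℓ 0ℓ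
rowOrder n = On.decTotalOrder (Lex.≤-decTotalOrder (Fin.≤-decTotalOrder n)) (letters {n})

infixr 4 _×ₗ_
_×ₗ_ : DecTotalOrder 0ℓ 0ℓ 0ℓ → DecTotalOrder 0ℓ 0ℓ 0ℓ → DecTotalOrder 0ℓ 0ℓ 0ℓ
_×ₗ_ = ×-decTotalOrder

cellOrder : ℕ → DecTotalOrder 0ℓ 0ℓ 0ℓ
cellOrder n = On.decTotalOrder (ℕ.≤-decTotalOrder ×ₗ ℕ.≤-decTotalOrder ×ₗ rowOrder n ×ₗ rowOrder n)
  λ ((α u v _) : RowCell n) → ℓ u + ℓ v , ℓ u , u , v

tripleOrder : ℕ → DecTotalOrder 0ℓ 0ℓ 0ℓ
tripleOrder n = On.decTotalOrder (rowOrder n ×ₗ rowOrder n ×ₗ rowOrder n)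
  λ ((triple (critical u v t _ _) _) : 𝔗¹ n) → u , v , t

pairOrder : ℕ → DecTotalOrder 0ℓ 0ℓ 0ℓ
pairOrder n = On.decTotalOrder (cellOrder n ×ₗ tripleOrder n)
  λ (e : EligiblePair n) → cell e , triple-of e

keep-if : {A : Set} {P : List A → A → Set} → (∀ kept a → Dec (P kept a)) →
          List A → List A → List A
keep-if P? kept []       = kept
keep-if P? kept (a ∷ as) with P? kept a
... | yes _ = keep-if P? (kept ∷ʳ a) as
... | no  _ = keep-if P? kept as

Unmatched : List (EligiblePair n) → EligiblePair n → Set
Unmatched kept e = ¬ Any (λ k → triple-of e ≡ triple-of k ⊎ cell e ≡ cell k) kept

-- The elements of ℬ^match, each with the triple kept with it.
matched : ∀ n → List (EligiblePair n)
matched n = keep-if {P = Unmatched} unmatched? [] (Sort.sort (pairOrder n) (eligiblePairs n))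
  where
  unmatched? : ∀ kept e → Dec (Unmatched kept e)
  unmatched? kept e =
    ¬? (any? (λ k → (triple-of e ≟ₜ triple-of k) ⊎-dec (cell e ≟ₐ cell k)) kept)

-- The dependency graph induced on a list of elements of ℬ^match.
Edge : (K : List (EligiblePair n)) → Fin (length K) → Fin (length K) → Set
Edge K i j = cell (lookup K i) ∈ dependencies (lookup K j)

edge? : (K : List (EligiblePair n)) → ∀ i j → Dec (Edge K i j)
edge? K i j = any? (cell (lookup K i) ≟ₐ_) (dependencies (lookup K j))

Acyclic : List (EligiblePair n) → Set
Acyclic K = ∀ i → ¬ TransClosure (Edge K) i i

module Reachability {V : Set} {E : V → V → Set} (E? : ∀ i j → Dec (E i j)) where

  -- There is a nonempty walk whose inner vertices are in the given list.
  Via : List V → V → V → Set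
  Via []       i j = E i j
  Via (k ∷ ks) i j = Via ks i j ⊎ (Via ks i k × Via ks k j)

  via? : ∀ ks i j → Dec (Via ks i j)
  via? []       i j = E? i j
  via? (k ∷ ks) i j = via? ks i j ⊎-dec (via? ks i k ×-dec via? ks k j)

  sound : ∀ ks {i j} → Via ks i j → TransClosure E i j
  sound []       e              = Plus.TransClosure.[ e ]
  sound (k ∷ ks) (inj₁ p)       = sound ks p
  sound (k ∷ ks) (inj₂ (p , q)) = sound ks p Plus.++ sound ks q

  edge : ∀ ks {i j} → E i j → Via ks i j
  edge []       e = e
  edge (k ∷ ks) e = inj₁ (edge ks e)

  compose : ∀ ks {i k j} → k ∈ ks → Via ks i k → Via ks k j → Via ks i j
  compose (k ∷ ks) (here refl) p q = inj₂ (into p , out q)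
    where
    into : ∀ {i} → Via ks i k ⊎ (Via ks i k × Via ks k k) → Via ks i k
    into (inj₁ p)       = p
    into (inj₂ (p , _)) = p
    out : ∀ {j} → Via ks k j ⊎ (Via ks k k × Via ks k j) → Via ks k j
    out (inj₁ q)       = q
    out (inj₂ (_ , q)) = q
  compose (_ ∷ ks) (there k∈) (inj₁ p)        (inj₁ q)        = inj₁ (compose ks k∈ p q)
  compose (_ ∷ ks) (there k∈) (inj₁ p)        (inj₂ (q , q′)) = inj₂ (compose ks k∈ p q , q′)
  compose (_ ∷ ks) (there k∈) (inj₂ (p , p′)) (inj₁ q)        = inj₂ (p , compose ks k∈ p′ q)
  compose (_ ∷ ks) (there k∈) (inj₂ (p , _))  (inj₂ (_ , q))  = inj₂ (p , q)

  complete : ∀ ks → (∀ k → k ∈ ks) → ∀ {i j} → TransClosure E i j → Via ks i j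
  complete ks all Plus.TransClosure.[ e ]    = edge ks e
  complete ks all (e ∷ es) = compose ks (all _) (edge ks e) (complete ks all es)

acyclic? : (K : List (EligiblePair n)) → Dec (Acyclic K)
acyclic? K = Fin.all? λ i → ¬? (map′ (sound ks) (complete ks ∈-allFin) (via? ks i i))
  where
  open Reachability (edge? K)
  ks = allFin (length K)

AcyclicWith : List (EligiblePair n) → EligiblePair n → Set
AcyclicWith kept e = Acyclic (kept ∷ʳ e)

acyclicWith? : (kept : List (EligiblePair n)) (e : EligiblePair n) → Dec (AcyclicWith kept e)
acyclicWith? kept e = acyclic? (kept ∷ʳ e)

-- The elements of ℬ^acyc, each with the triple kept with it.
collapsed : ∀ n → List (EligiblePair n)
collapsed n = keep-if {P = AcyclicWith} acyclicWith? [] (matched n)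

collapsed-acyclic : ∀ n → Acyclic (collapsed n)
collapsed-acyclic n = go [] (λ ()) (matched n)
  where
  go : ∀ kept → Acyclic kept → ∀ es → Acyclic (keep-if {P = AcyclicWith} acyclicWith? kept es)
  go kept ac []       = ac
  go kept ac (e ∷ es) with acyclicWith? kept e
  ... | yes ac′ = go (kept ∷ʳ e) ac′ es
  ... | no  _   = go kept ac es

data PreRowCell (n : ℕ) : Set where
  _ʳ : StylCell n → PreRowCell n
  γ  : (u : Row n) → .(2 ≤ ℓ u) → PreRowCell n

rowsOf : List (Fin n) → List (Row n)
rowsOf = concatMap (λ x → r x ∷ [])

Σprerow : (n : ℕ) → Polygraph₂ (Row n)
Σprerow n .Gen₂        = PreRowCell n
Σprerow n .src (δ ʳ)   = rowsOf (src (Σstyl n) δ)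
Σprerow n .src (γ u _) = rowsOf (letters u)
Σprerow n .tgt (δ ʳ)   = rowsOf (tgt (Σstyl n) δ)
Σprerow n .tgt (γ u _) = u ∷ []

word-⁅⁆ : (u : Row n) {x : Fin n} → letters u ≡ x ∷ [] → u ≡ r x
word-⁅⁆ u e = row-≡ (sym (trans (cong (foldl _⊕_ ∅) (sym e))
  (trans (adds-word ∅ (supp u)) (Sub.∪-identityˡ (supp u)))))

short-row : (u : Row n) → ¬ 2 ≤ ℓ u → ∃ λ x → u ≡ r x
short-row u ≱2 with letters u in e
... | []        = contradiction e (word-nonempty (supp u) (nonemptyᵣ u))
... | x ∷ []    = x , word-⁅⁆ u e
... | _ ∷ _ ∷ _ = contradiction (s≤s (s≤s z≤n)) ≱2

rowsOf-short : (u : Row n) → ¬ 2 ≤ ℓ u → u ∷ [] ≡ rowsOf (letters u)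
rowsOf-short u ≱2 with x , refl ← short-row u ≱2 = sym (cong rowsOf (word-r x))

unfoldRow : (u : Row n) → Track (Σprerow n) (u ∷ []) (rowsOf (letters u))
unfoldRow u with 2 ℕ.≤? ℓ u
... | yes h = ⟪ γ u h ⟫ ⁻¹
... | no  ≱ = cast refl (rowsOf-short u ≱) ε

-- E_w, with the γ⁻¹ applied from left to right.
unfold : (w : List (Row n)) → Track (Σprerow n) w (rowsOf (flat w))
unfold []      = ε
unfold (u ∷ w) = cast refl (sym (concatMap-++ (λ x → r x ∷ []) (letters u) (flat w)))
  ((unfoldRow u ▷ w) ◅◅ (rowsOf (letters u) ◁ unfold w))

ηs κs ƛs stylCells : ∀ n → List (StylCell n)
ηs n = map η (allFin n)
κs n = mapMaybe
  (λ (x , y , z) → when (λ (p , q) → κ x y z p q) ((x Fin.≤? y) ×-dec (y Fin.<? z)))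
  (cartesianProduct (allFin n) (cartesianProduct (allFin n) (allFin n)))
ƛs n = mapMaybe
  (λ (x , y , z) → when (λ (p , q) → ƛ x y z p q) ((x Fin.<? y) ×-dec (y Fin.≤? z)))
  (cartesianProduct (allFin n) (cartesianProduct (allFin n) (allFin n)))
stylCells n = ηs n ++ κs n ++ ƛs n

-- Generating 2-cells and their inverses, in the order of elementary steps.
moves : ∀ n → List (StylCell n ⊎ StylCell n)
moves n = map inj₁ (stylCells n) ++ map inj₂ (stylCells n)

-- The factorizations of a word in two factors, from left to right.
splits : (w : List X) → List (∃₂ λ a b → w ≡ a ++ b)
splits []      = ([] , [] , refl) ∷ []
splits (x ∷ w) = ([] , x ∷ w , refl) ∷ map (λ (a , b , e) → x ∷ a , b , cong (x ∷_) e) (splits w)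

prefix? : (a b : List (Fin n)) → Dec (∃ λ c → b ≡ a ++ c)
prefix? []      b       = yes (b , refl)
prefix? (x ∷ a) []      = no λ ()
prefix? (x ∷ a) (y ∷ b) = map′ (λ { (refl , c , refl) → c , refl }) (λ { (c , refl) → refl , c , refl })
                               ((x Fin.≟ y) ×-dec prefix? a b)

ElementaryStep : List (Fin n) → List (Fin n) → Set
ElementaryStep {n} = SymClosure (Step (Σstyl n))

apply : {u : List (Fin n)} → (∃₂ λ a b → u ≡ a ++ b) → StylCell n ⊎ StylCell n →
        Maybe (∃ λ v → ElementaryStep u v)
apply (a , b , e) (inj₁ β) =
  when (λ (c , e′) → _ , fwd (step a β c (trans e (cong (a ++_) e′)) refl)) (prefix? _ b)
apply (a , b , e) (inj₂ β) =
  when (λ (c , e′) → _ , bwd (step a β c refl (trans e (cong (a ++_) e′)))) (prefix? _ b)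

-- Ordered by position first.
stepsFrom : (u : List (Fin n)) → List (∃ λ v → ElementaryStep u v)
stepsFrom {n} u = concatMap (λ s → mapMaybe (apply s) (moves n)) (splits u)

-- The 2-cells with k steps, in lexicographic order.
tracks : ℕ → (u v : List (Fin n)) → List (Track (Σstyl n) u v)
tracks zero    u v = loop (List.≡-dec Fin._≟_ u v)
  where
  loop : ∀ {u v} → Dec (u ≡ v) → List (Track (Σstyl _) u v)
  loop (yes refl) = ε ∷ []
  loop (no  _)    = []
tracks (suc k) u v = concatMap (λ (w , s) → map (s ◅_) (tracks k w v)) (stepsFrom u)

∈-concatMap : {f : X → List Y} {x : X} {y : Y} {xs : List X} →
              x ∈ xs → y ∈ f x → y ∈ concatMap f xs
∈-concatMap {f = f} (here refl) y∈ = ∈-++⁺ˡ y∈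
∈-concatMap {f = f} {xs = x ∷ _} (there x∈) y∈ = ∈-++⁺ʳ (f x) (∈-concatMap x∈ y∈)

∈-mapMaybe : {f : X → Maybe Y} {x : X} {y : Y} {xs : List X} →
             x ∈ xs → f x ≡ just y → y ∈ mapMaybe f xs
∈-mapMaybe {f = f} {xs = x ∷ _} (here refl) e with f x
∈-mapMaybe (here refl) refl | just _ = here refl
∈-mapMaybe {f = f} {xs = x ∷ _} (there x∈) e with f x
... | just _  = there (∈-mapMaybe x∈ e)
... | nothing = ∈-mapMaybe x∈ e

∈-splits : (a b : List X) → (a , b , refl) ∈ splits (a ++ b)
∈-splits []      []      = here refl
∈-splits []      (_ ∷ _) = here refl
∈-splits (x ∷ a) b       = there (∈-map⁺ _ (∈-splits a b))

∈-cartesianProduct : {x : X} {y : Y} {xs : List X} {ys : List Y} →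
                     x ∈ xs → y ∈ ys → (x , y) ∈ cartesianProduct xs ys
∈-cartesianProduct (here refl) y∈ = ∈-++⁺ˡ (∈-map⁺ _ y∈)
∈-cartesianProduct {xs = x ∷ _} {ys} (there x∈) y∈ =
  ∈-++⁺ʳ (map (x ,_) ys) (∈-cartesianProduct x∈ y∈)

when-yes : {A B : Set} {f : A → B} {b : B} (d : Dec A) → A → (∀ a → f a ≡ b) → when f d ≡ just b
when-yes (yes a) _ e = cong just (e a)
when-yes (no ¬a) a _ = contradiction a ¬a

∈-stylCells : (β : StylCell n) → β ∈ stylCells n
∈-stylCells {n} (η x) = ∈-++⁺ˡ (∈-map⁺ η (∈-allFin x))
∈-stylCells {n} (κ x y z p q) = ∈-++⁺ʳ (ηs n) (∈-++⁺ˡ (∈-mapMaybe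
  (∈-cartesianProduct (∈-allFin x) (∈-cartesianProduct (∈-allFin y) (∈-allFin z)))
  (when-yes ((x Fin.≤? y) ×-dec (y Fin.<? z))
            (recompute (x Fin.≤? y) p , recompute (y Fin.<? z) q) (λ _ → refl))))
∈-stylCells {n} (ƛ x y z p q) = ∈-++⁺ʳ (ηs n) (∈-++⁺ʳ (κs n) (∈-mapMaybe
  (∈-cartesianProduct (∈-allFin x) (∈-cartesianProduct (∈-allFin y) (∈-allFin z)))
  (when-yes ((x Fin.<? y) ×-dec (y Fin.≤? z))
            (recompute (x Fin.<? y) p , recompute (y Fin.≤? z) q) (λ _ → refl))))

∈-stepsFrom : {u v : List (Fin n)} (s : ElementaryStep u v) → (v , s) ∈ stepsFrom u
∈-stepsFrom {n} (fwd (step a β c refl refl)) = ∈-concatMap (∈-splits a (src (Σstyl n) β ++ c))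
  (∈-mapMaybe (∈-++⁺ˡ (∈-map⁺ inj₁ (∈-stylCells β)))
    (when-yes (prefix? (src (Σstyl n) β) _) (c , refl) same-step))
  where
  same-step : ∀ ((c′ , e) : ∃ λ c′ → src (Σstyl n) β ++ c ≡ src (Σstyl n) β ++ c′) →
    _≡_ {A = ∃ λ v → ElementaryStep _ v}
      (_ , fwd (step a β c′ (cong (a ++_) e) refl)) (_ , fwd (step a β c refl refl))
  same-step (c′ , e) with refl ← List.++-cancelˡ (src (Σstyl n) β) c c′ e | refl ← e = refl
∈-stepsFrom {n} (bwd (step a β c refl refl)) = ∈-concatMap (∈-splits a (tgt (Σstyl n) β ++ c))
  (∈-mapMaybe (∈-++⁺ʳ (map inj₁ (stylCells n)) (∈-map⁺ inj₂ (∈-stylCells β)))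
    (when-yes (prefix? (tgt (Σstyl n) β) _) (c , refl) same-step))
  where
  same-step : ∀ ((c′ , e) : ∃ λ c′ → tgt (Σstyl n) β ++ c ≡ tgt (Σstyl n) β ++ c′) →
    _≡_ {A = ∃ λ v → ElementaryStep _ v}
      (_ , bwd (step a β c′ refl (cong (a ++_) e))) (_ , bwd (step a β c refl refl))
  same-step (c′ , e) with refl ← List.++-cancelˡ (tgt (Σstyl n) β) c c′ e | refl ← e = refl

steps : {P : Polygraph₂ X} {u v : List X} → Track P u v → ℕ
steps ε       = 0
steps (_ ◅ f) = suc (steps f)

∈-tracks : {u v : List (Fin n)} (f : Track (Σstyl n) u v) → f ∈ tracks (steps f) u v
∈-tracks {u = u} ε with List.≡-dec Fin._≟_ u u
... | yes e rewrite uip e refl = here refl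
... | no  ≢                    = contradiction refl ≢
∈-tracks (s ◅ f) = ∈-concatMap (∈-stepsFrom s) (∈-map⁺ (s ◅_) (∈-tracks f))

headOf : (xs : List X) {x : X} → .(x ∈ xs) → X
headOf (x ∷ _) _ = x

-- The 2-cells with at most k steps, by length and then lexicographically.
shortlex : ℕ → (u v : List (Fin n)) → List (Track (Σstyl n) u v)
shortlex k u v = concatMap (λ i → tracks i u v) (upTo (suc k))

∈-shortlex : {u v : List (Fin n)} (f : Track (Σstyl n) u v) → f ∈ shortlex (steps f) u v
∈-shortlex {u = u} {v} f = ∈-concatMap {f = λ i → tracks i u v} {x = steps f}
  {xs = upTo (suc (steps f))} (∈-upTo⁺ ℕ.≤-refl) (∈-tracks f)

-- Π on words of letters; lettersToRows maps it to words in the generators r_x.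
-- The congruence only serves to bound the search.
Π : (u v : List (Fin n)) → u ≋ v → Track (Σstyl n) u v
Π {n} u v e = headOf (shortlex (steps (~⇒Track (Σstyl n) e)) u v) (∈-shortlex (~⇒Track (Σstyl n) e))

lettersToRows : {u v : List (Fin n)} → Track (Σstyl n) u v → Track (Σprerow n) (rowsOf u) (rowsOf v)
lettersToRows = extend (λ x → r x ∷ []) (λ δ → ⟪ δ ʳ ⟫)

rowCell≋ : (β : RowCell n) → flat (src (Σrow n) β) ≋ flat (tgt (Σrow n) β)
rowCell≋ β = Path-flat (stepOf β ◅ ε)

-- The 2-cell P_{u,v}, for β = α_{u,v}.
letterPath : (β : RowCell n) → Track (Σprerow n) (src (Σrow n) β) (tgt (Σrow n) β)
letterPath {n} β = unfold s ◅◅ lettersToRows (Π (flat s) (flat t) (rowCell≋ β)) ◅◅ unfold t ⁻¹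
  where
  s = src (Σrow n) β
  t = tgt (Σrow n) β

flat-rowsOf : (w : List (Fin n)) → flat (rowsOf w) ≡ w
flat-rowsOf []      = refl
flat-rowsOf (x ∷ w) = cong₂ _++_ (word-r x) (flat-rowsOf w)

preRow≋ : (δ : PreRowCell n) → flat (src (Σprerow n) δ) ≋ flat (tgt (Σprerow n) δ)
preRow≋ (δ ʳ)   = subst₂ _≋_ (sym (flat-rowsOf _)) (sym (flat-rowsOf _)) (~-gen δ)
preRow≋ (γ u _) = ~-reflexive _ (trans (flat-rowsOf (letters u)) (sym (List.++-identityʳ _)))

-- The 2-cell Λ_s ⋆₁ Λ_t⁻¹, for a pre-row cell s ⇒ t.
normalPath : (δ : PreRowCell n) → Track (Σrow n) (src (Σprerow n) δ) (tgt (Σprerow n) δ)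
normalPath {n} δ = ⌜ Λ s ⌝ ◅◅ cast (sym (^-resp s t (preRow≋ δ))) refl (⌜ Λ t ⌝ ⁻¹)
  where
  s = src (Σprerow n) δ
  t = tgt (Σprerow n) δ

-- Elimination of the cells of an acyclic list of eligible pairs.
module Reduction {n : ℕ} (K : List (EligiblePair n)) (acyclic : Acyclic K) where

  Collapsed : RowCell n → Set
  Collapsed β = Any (λ e → β ≡ cell e) K

  collapsed? : (β : RowCell n) → Dec (Collapsed β)
  collapsed? β = any? (λ e → β ≟ₐ cell e) K

  record RedCell : Set where
    constructor surviving
    field
      rowCell   : RowCell n
      .survives : ¬ Collapsed rowCell

  Σred : Polygraph₂ (Row n)
  Σred .Gen₂ = RedCell
  Σred .src (surviving β _) = src (Σrow n) β
  Σred .tgt (surviving β _) = tgt (Σrow n) β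

  Image : RowCell n → Set
  Image β = Track Σred (src (Σrow n) β) (tgt (Σrow n) β)

  edge-wellFounded : WellFounded (TransClosure (Edge K))
  edge-wellFounded = spo-wellFounded record
    { isEquivalence = isEquivalence
    ; irrefl        = λ { refl → acyclic _ }
    ; trans         = Plus._++_
    ; <-resp-≈      = (λ { refl p → p }) , (λ { refl p → p })
    }

  redVertex : (i : Fin (length K)) → Acc (TransClosure (Edge K)) i → Image (cell (lookup K i))
  redVertex i (acc rs) = mapTrack (S (lookup K i)) λ {β} β∈ → image β β∈ (collapsed? β)
    where
    image : ∀ β → β ∈ dependencies (lookup K i) → Dec (Collapsed β) → Image β
    image β β∈ (no  ∉) = ⟪ surviving β ∉ ⟫
    image β β∈ (yes c) = subst Image (sym eq)
      (redVertex (Any.index c)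
        (rs Plus.TransClosure.[ subst (_∈ dependencies (lookup K i)) eq β∈ ]))
      where
      eq : β ≡ cell (lookup K (Any.index c))
      eq = Any.lookup-index c

  redCell : (β : RowCell n) → Image β
  redCell β with collapsed? β
  ... | no  ∉ = ⟪ surviving β ∉ ⟫
  ... | yes c = subst Image (sym (Any.lookup-index c))
    (redVertex (Any.index c) (edge-wellFounded (Any.index c)))

  Red : {u v : List (Row n)} → Track (Σrow n) u v → Track Σred u v
  Red f = mapTrack f λ {β} _ → redCell β

  -- The index set of the cells 𝒳.
  record RedCell₃ : Set where
    constructor 𝒳
    field
      index      : 𝔗¹ n
      .unmatched : ¬ Any (λ e → index ≡ triple-of e) K

  Σred₃ : Cells₃ Σred
  Σred₃ .Gen₃ = RedCell₃
  Σred₃ .dom (𝒳 (triple τ _) _) = source τ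
  Σred₃ .cod (𝒳 (triple τ _) _) = source τ ^
  Σred₃ .lhs (𝒳 (triple τ _) _) = Red ⌜ L τ ⌝
  Σred₃ .rhs (𝒳 (triple τ _) _) = Red ⌜ R τ ⌝

  rowToPreRow : {u v : List (Row n)} → Track Σred u v → Track (Σprerow n) u v
  rowToPreRow f = mapTrack f λ { {surviving β _} _ → letterPath β }

  preRow₃ : Cells₃ (Σprerow n)
  preRow₃ .Gen₃ = RedCell₃ ⊎ PreRowCell n
  preRow₃ .dom (inj₁ A) = dom Σred₃ A
  preRow₃ .dom (inj₂ δ) = src (Σprerow n) δ
  preRow₃ .cod (inj₁ A) = cod Σred₃ A
  preRow₃ .cod (inj₂ δ) = tgt (Σprerow n) δ
  preRow₃ .lhs (inj₁ A) = rowToPreRow (lhs Σred₃ A)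
  preRow₃ .lhs (inj₂ δ) = rowToPreRow (Red (normalPath δ))
  preRow₃ .rhs (inj₁ A) = rowToPreRow (rhs Σred₃ A)
  preRow₃ .rhs (inj₂ δ) = ⟪ δ ⟫

Σprerow₃ : (n : ℕ) → Cells₃ (Σprerow n)
Σprerow₃ n = Reduction.preRow₃ (collapsed n) (collapsed-acyclic n)

-- The generators other than r_u and γ_u with u of length at least 2.
record ShortRow (n : ℕ) : Set where
  constructor short
  field
    underlying : Row n
    .length<2  : ¬ 2 ≤ ℓ underlying

data Isγ {n : ℕ} : PreRowCell n → Set where
  isγ : ∀ u .h → Isγ (γ u h)

record LetterCell (n : ℕ) : Set where
  constructor kept
  field
    preRowCell : PreRowCell n
    .¬γ        : ¬ Isγ preRowCell

ℓ-r : (x : Fin n) → ¬ 2 ≤ ℓ (r x)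
ℓ-r x 2≤ with s≤s () ← subst (λ w → 2 ≤ length w) (word-r x) 2≤

shortRow : Fin n → ShortRow n
shortRow x = short (r x) (ℓ-r x)

expand : Row n → List (ShortRow n)
expand u with 2 ℕ.≤? ℓ u
... | yes _ = map shortRow (letters u)
... | no  ≱ = short u ≱ ∷ []

Σstylcoh : (n : ℕ) → Polygraph₂ (ShortRow n)
Σstylcoh n .Gen₂         = LetterCell n
Σstylcoh n .src (kept δ _) = concatMap expand (src (Σprerow n) δ)
Σstylcoh n .tgt (kept δ _) = concatMap expand (tgt (Σprerow n) δ)

expand-r : (x : Fin n) → expand (r x) ≡ shortRow x ∷ []
expand-r x with 2 ℕ.≤? ℓ (r x)
... | yes 2≤ = contradiction 2≤ (ℓ-r x)
... | no  _  = refl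

expand-rowsOf : (w : List (Fin n)) → concatMap expand (rowsOf w) ≡ map shortRow w
expand-rowsOf []      = refl
expand-rowsOf (x ∷ w) = cong₂ _++_ (expand-r x) (expand-rowsOf w)

expand-γ : (u : Row n) → 2 ≤ ℓ u → map shortRow (letters u) ≡ expand u ++ []
expand-γ u 2≤ with 2 ℕ.≤? ℓ u
... | yes _ = sym (List.++-identityʳ _)
... | no  ≱ = contradiction 2≤ ≱

-- The 2-functor eliminating the generators r_u and γ_u.
eliminate₂ : (δ : PreRowCell n) → Track (Σstylcoh n) (concatMap expand (src (Σprerow n) δ))
                                                    (concatMap expand (tgt (Σprerow n) δ))
eliminate₂ (δ ʳ)   = ⟪ kept (δ ʳ) (λ ()) ⟫
eliminate₂ (γ u h) = cast refl
  (trans (expand-rowsOf (letters u)) (expand-γ u (recompute (2 ℕ.≤? ℓ u) h))) ε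

eliminate : {u v : List (Row n)} →
            Track (Σprerow n) u v → Track (Σstylcoh n) (concatMap expand u) (concatMap expand v)
eliminate = extend expand eliminate₂

Σstylcoh₃ : (n : ℕ) → Cells₃ (Σstylcoh n)
Σstylcoh₃ n .Gen₃  = Gen₃ (Σprerow₃ n)
Σstylcoh₃ n .dom A = concatMap expand (dom (Σprerow₃ n) A)
Σstylcoh₃ n .cod A = concatMap expand (cod (Σprerow₃ n) A)
Σstylcoh₃ n .lhs A = eliminate (lhs (Σprerow₃ n) A)
Σstylcoh₃ n .rhs A = eliminate (rhs (Σprerow₃ n) A)

-- letter and stylCell identify r_x with x.
letter : ShortRow n → Fin n
letter (short u _) = min u

stylCell : LetterCell n → StylCell n
stylCell (kept (δ ʳ)   _)  = δ
stylCell (kept (γ u h) ¬γ) = ⊥-elim-irr (¬γ (isγ u h))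

identify₁ : ShortRow n → List (Fin n)
identify₁ a = letter a ∷ []

identify₂ : (δ : LetterCell n) → Track (Σstyl n) (concatMap identify₁ (src (Σstylcoh n) δ))
                                                  (concatMap identify₁ (tgt (Σstylcoh n) δ))
identify₂ (kept (δ ʳ) _) = cast (sym (identify-rowsOf _)) (sym (identify-rowsOf _)) ⟪ δ ⟫
  where
  min-r : (x : Fin n) → min (r x) ≡ x
  min-r x = ∅-⊕⁻ (min-∈ (r x))
  identify-rowsOf : (w : List (Fin n)) → concatMap identify₁ (concatMap expand (rowsOf w)) ≡ w
  identify-rowsOf w = trans (cong (concatMap identify₁) (expand-rowsOf w)) (go w)
    where
    go : (w : List (Fin n)) → concatMap identify₁ (map shortRow w) ≡ w
    go []      = refl
    go (x ∷ w) = cong₂ _∷_ (min-r x) (go w)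
identify₂ (kept (γ u h) ¬γ) = ⊥-elim-irr (¬γ (isγ u h))

Σstyl₃ : (n : ℕ) → Cells₃ (Σstyl n)
Σstyl₃ n .Gen₃  = Gen₃ (Σstylcoh₃ n)
Σstyl₃ n .dom A = concatMap identify₁ (dom (Σstylcoh₃ n) A)
Σstyl₃ n .cod A = concatMap identify₁ (cod (Σstylcoh₃ n) A)
Σstyl₃ n .lhs A = extend identify₁ identify₂ (lhs (Σstylcoh₃ n) A)
Σstyl₃ n .rhs A = extend identify₁ identify₂ (rhs (Σstylcoh₃ n) A)

-- Functions of Agda being computable, the algorithm is the function list.
EffectivelyComputable : {X : ℕ → Set} {P : ∀ n → Polygraph₂ (X n)} →
                        (∀ n → Cells₃ (P n)) → Set
EffectivelyComputable {P = P} Γ =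
  Σ[ list ∈ (∀ n → List (Gen₃ (Γ n) × Boundary (P n))) ]
    (∀ n → 1 ≤ n →
      Unique (list n)
      × (∀ A → (A , boundary (Γ n) A) ∈ list n)
      × (∀ {A b} → (A , b) ∈ list n → b ≡ boundary (Γ n) A))

{-# OPTIONS --safe #-}
-- By Squier's theorem, the fillings of all critical branchings (u, v, t) of the convergent row
-- presentation form a homotopy basis.  Those of 𝔖 are redundant: for x = min u, precomposing
-- the branching with r_x r_∂u r_v r_t ⇒ r_u r_v r_t turns it into the branching (∂u, v, t), with
-- a shorter first row, up to the fillings of branchings of 𝔗¹.  The rewriting of rows terminates
-- because, for the least letter whose charges change (see weigh), these charges only move to the
-- right or disappear.
--
-- The homotopy basis of the row presentation is carried to the letters by Tietze
-- transformations.  Each is a 2-functor with a section up to 3-cells, so that parallel tracks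
-- are filled by the image of a filling of their lifts.  A collapsed cell is defined by the triple
-- kept with it, whose filling therefore becomes an identity.
module Submission where

open import Data.Bool.Base using (Bool; true; false; _∨_; _xor_; if_then_else_)
open import Data.Empty using (⊥-elim-irr)
open import Data.Fin.Base using (Fin; zero; suc)
import Data.Fin.Base as Fin
import Data.Fin.Properties as Fin
open import Data.Fin.Subset using (Subset; Nonempty; inside; outside; _∪_; _⊆_)
  renaming (_∈_ to _∈ₛ_; ⊥ to ∅)
import Data.Fin.Subset.Properties as Sub
open import Data.List.Base
  using (List; []; _∷_; _++_; _∷ʳ_; map; mapMaybe; concatMap; lookup; length; allFin; deduplicate)
import Data.List.Properties as List
open import Data.List.Membership.Propositional using (_∈_)
open import Data.List.Membership.Propositional.Properties
  using (∈-lookup; ∈-map⁺; ∈-map⁻; ∈-++⁺ˡ; ∈-++⁺ʳ; ∈-allFin; ∈-deduplicate⁺)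
open import Data.List.Relation.Unary.All as All using (All; []; _∷_)
import Data.List.Relation.Unary.All.Properties as All
open import Data.List.Relation.Unary.AllPairs using (AllPairs; []; _∷_)
import Data.List.Relation.Unary.AllPairs.Properties as AllPairs
open import Data.List.Relation.Unary.Any as Any using (Any; here; there; any?)
import Data.List.Relation.Unary.Any.Properties as Any
open import Data.List.Relation.Unary.Linked using ([]; [-]; _∷_)
open import Data.List.Relation.Unary.Unique.Propositional using (Unique)
import Data.List.Relation.Unary.Unique.DecPropositional.Properties as Deduplicate
import Data.List.Relation.Unary.Unique.Propositional.Properties as Unique
import Data.List.Sort as Sort
open import Data.Nat.Base as ℕ using (ℕ; _≤_; z≤n; s≤s; _+_; _*_)
open import Data.Nat.Induction using (<-wellFounded)
import Data.Nat.Properties as ℕ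
open import Data.Product.Base using (∃; _×_; _,_; proj₁; proj₂)
open import Data.Sum.Base as Sum using (_⊎_; inj₁; inj₂; [_,_]′)
import Data.Sum.Properties as Sum
open import Data.Unit.Base using (⊤; tt)
open import Data.Vec.Base using (Vec; []; _∷_; replicate; _[_]≔_; here; there)
open import Data.Vec.Relation.Binary.Lex.Strict as Lex using (Lex-<; this; next)
open import Function.Base using (_∘_; id)
open import Function.Bundles using (mk↔ₛ′)
open import Induction.WellFounded using (WellFounded; Acc; acc; module Subrelation)
open import Relation.Binary.Construct.Closure.ReflexiveTransitive as Star using (Star; ε; _◅_; _◅◅_)
import Relation.Binary.Construct.Closure.ReflexiveTransitive.Properties as Star
open import Relation.Binary.Construct.Closure.Symmetric as SymClosure using (SymClosure; fwd; bwd)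
open import Relation.Binary.Construct.Closure.Transitive using (TransClosure; [_])
import Relation.Binary.Construct.On as On
open import Relation.Binary.Definitions using (DecidableEquality)
open import Relation.Binary.PropositionalEquality
  using (_≡_; _≢_; refl; sym; trans; cong; cong₂; subst; subst₂; resp₂)
open import Relation.Nullary.Decidable using (Dec; yes; no; map′; _×-dec_; recompute; ¬?)
open import Relation.Nullary.Negation using (¬_; contradiction)
open import Defs

-- The obstacle in eliminating 𝔖 is circularity: resolving r_x r_∂u r_v r_t meets further critical
-- triples, which must be filled before (u, v, t) is. Squier's theorem is therefore proved relative
-- to a class of words closed under rewriting, and used twice: first for the class `Narrow`, whose
-- critical triples are filled without recourse to the induction on the first row, then for all
-- words.
--
-- A second obstacle is formal: the laws of `++` hold only propositionally, so tracks that ought to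
-- be parallel have different boundaries. Equality and fillings are hence families `_≅_` and `_⇛_`
-- indexed by both boundaries.

private variable
  X Y : Set
  n : ℕ

-- Tracks

-- The sequence of elementary steps of a track, without its boundary.  Comparing
-- such sequences replaces reasoning on transports along equalities of words.
RawStep : Polygraph₂ X → Set
RawStep {X} P = Bool × List X × Gen₂ P × List X

infix 4 _≅_
-- Matching on `refl` identifies the boundaries as well, which keeps transports out of the laws
-- below.
data _≅_ {P : Polygraph₂ X} {u v : List X} (f : Track P u v) :
         {u′ v′ : List X} → Track P u′ v′ → Set where
  refl : f ≅ f

module _ {P : Polygraph₂ X} where

  private variable
    u v w u′ v′ w′ : List X

  ≡⇒≅ : {f g : Track P u v} → f ≡ g → f ≅ g
  ≡⇒≅ refl = refl

  ≅⇒≡ : {f g : Track P u v} → f ≅ g → f ≡ g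
  ≅⇒≡ refl = refl

  ≅-sym : {f : Track P u v} {g : Track P u′ v′} → f ≅ g → g ≅ f
  ≅-sym refl = refl

  ≅-trans : {f : Track P u v} {g : Track P u′ v′} {w w′ : List X} {h : Track P w w′} →
            f ≅ g → g ≅ h → f ≅ h
  ≅-trans refl refl = refl

  cast-≅ : (p : u ≡ u′) (q : v ≡ v′) (f : Track P u v) → cast p q f ≅ f
  cast-≅ refl refl f = refl

  ε-≅ : u ≡ u′ → _≅_ {P = P} (ε {x = u}) (ε {x = u′})
  ε-≅ refl = refl

  ◅◅-≅ : {f : Track P u v} {g : Track P v w} {f′ : Track P u′ v′} {g′ : Track P v′ w′} →
         f ≅ f′ → g ≅ g′ → f ◅◅ g ≅ f′ ◅◅ g′
  ◅◅-≅ refl refl = refl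

  ⁻¹-≅ : {f : Track P u v} {g : Track P u′ v′} → f ≅ g → f ⁻¹ ≅ g ⁻¹
  ⁻¹-≅ refl = refl

  ◁-≅ : {f : Track P u v} {g : Track P u′ v′} → w ≡ w′ → f ≅ g → w ◁ f ≅ w′ ◁ g
  ◁-≅ refl refl = refl

  ▷-≅ : {f : Track P u v} {g : Track P u′ v′} → f ≅ g → w ≡ w′ → f ▷ w ≅ g ▷ w′
  ▷-≅ refl refl = refl

  rawStep : SymClosure (Step P) u v → RawStep P
  rawStep (fwd (step l β r _ _)) = true  , l , β , r
  rawStep (bwd (step l β r _ _)) = false , l , β , r

  raw : Track P u v → List (RawStep P)
  raw ε       = []
  raw (s ◅ f) = rawStep s ∷ raw f

  -- Each raw step determines its target from its source, and its boundary equations are unique. The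
  -- common source is a hypothesis because an empty track has no step to read it from.
  raw-injective : (f : Track P u v) (g : Track P u′ v′) → u ≡ u′ → raw f ≡ raw g → f ≅ g
  raw-injective ε ε refl _ = refl
  raw-injective (fwd (step l β r refl refl) ◅ f) (fwd (step _ _ _ p q) ◅ g) refl e
    with refl , e′ ← List.∷-injective e with refl ← p | refl ← q
    with refl ← raw-injective f g refl e′ = refl
  raw-injective (bwd (step l β r refl refl) ◅ f) (bwd (step _ _ _ p q) ◅ g) refl e
    with refl , e′ ← List.∷-injective e with refl ← p | refl ← q
    with refl ← raw-injective f g refl e′ = refl
  raw-injective (fwd _ ◅ f) (bwd _ ◅ g) _ ()
  raw-injective (bwd _ ◅ f) (fwd _ ◅ g) _ ()

  raw-◁ : (w : List X) (f : Track P u v) →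
          raw (w ◁ f) ≡ map (λ (d , l , β , r) → d , w ++ l , β , r) (raw f)
  raw-◁ w ε         = refl
  raw-◁ w (fwd (step _ _ _ _ _) ◅ f) = cong (_ ∷_) (raw-◁ w f)
  raw-◁ w (bwd (step _ _ _ _ _) ◅ f) = cong (_ ∷_) (raw-◁ w f)

  raw-▷ : (f : Track P u v) (w : List X) →
          raw (f ▷ w) ≡ map (λ (d , l , β , r) → d , l , β , r ++ w) (raw f)
  raw-▷ ε         w = refl
  raw-▷ (fwd (step _ _ _ _ _) ◅ f) w = cong (_ ∷_) (raw-▷ f w)
  raw-▷ (bwd (step _ _ _ _ _) ◅ f) w = cong (_ ∷_) (raw-▷ f w)

  private
    map-raw : {S : Set} {f g h : S → S} → (∀ x → f (g x) ≡ h x) → ∀ xs → map f (map g xs) ≡ map h xs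
    map-raw e xs = trans (sym (List.map-∘ xs)) (List.map-cong e xs)

  ◁-++ : ∀ a b (f : Track P u v) → (a ++ b) ◁ f ≅ a ◁ (b ◁ f)
  ◁-++ a b f = raw-injective _ _ (List.++-assoc a b _) (trans (raw-◁ (a ++ b) f) (sym
    (trans (raw-◁ a (b ◁ f)) (trans (cong (map _) (raw-◁ b f))
      (map-raw (λ (d , l , β , r) → cong (λ l → d , l , β , r) (sym (List.++-assoc a b l))) (raw f))))))

  ▷-++ : ∀ (f : Track P u v) a b → f ▷ (a ++ b) ≅ (f ▷ a) ▷ b
  ▷-++ f a b = raw-injective _ _ (sym (List.++-assoc _ a b)) (trans (raw-▷ f (a ++ b)) (sym
    (trans (raw-▷ (f ▷ a) b) (trans (cong (map _) (raw-▷ f a))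
      (map-raw (λ (d , l , β , r) → cong (λ r → d , l , β , r) (List.++-assoc r a b)) (raw f))))))

  ◁-▷ : ∀ a (f : Track P u v) b → (a ◁ f) ▷ b ≅ a ◁ (f ▷ b)
  ◁-▷ a f b = raw-injective _ _ (List.++-assoc a _ b) (trans
    (trans (raw-▷ (a ◁ f) b) (trans (cong (map _) (raw-◁ a f)) (map-raw (λ _ → refl) (raw f))))
    (sym (trans (raw-◁ a (f ▷ b)) (trans (cong (map _) (raw-▷ f b)) (map-raw (λ _ → refl) (raw f))))))

  []-◁ : (f : Track P u v) → [] ◁ f ≅ f
  []-◁ f = raw-injective _ _ refl (trans (raw-◁ [] f) (List.map-id (raw f)))

  ▷-[] : (f : Track P u v) → f ▷ [] ≅ f
  ▷-[] f = raw-injective _ _ (List.++-identityʳ _) (trans (raw-▷ f []) (trans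
    (List.map-cong (λ (d , l , β , r) → cong (λ r → d , l , β , r) (List.++-identityʳ r)) (raw f))
    (List.map-id (raw f))))

  ◁-◅◅ : ∀ w (f : Track P u v) (g : Track P v v′) → w ◁ (f ◅◅ g) ≡ (w ◁ f) ◅◅ (w ◁ g)
  ◁-◅◅ w f g = Star.gmap-◅◅ _ _ f g

  ▷-◅◅ : ∀ (f : Track P u v) (g : Track P v v′) w → (f ◅◅ g) ▷ w ≡ (f ▷ w) ◅◅ (g ▷ w)
  ▷-◅◅ f g w = Star.gmap-◅◅ _ _ f g

  ◅◅-identityʳ : (f : Track P u v) → f ◅◅ ε ≡ f
  ◅◅-identityʳ ε       = refl
  ◅◅-identityʳ (s ◅ f) = cong (s ◅_) (◅◅-identityʳ f)

  private
    -- Inverses are computed with an accumulator; expressing it as a composite makes induction on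
    -- `_⁻¹` possible.
    revApp-◅◅ : (f : Track P u v) (g : Track P u w) →
      Star.revApp (SymClosure.symmetric (Step P)) f g ≡ f ⁻¹ ◅◅ g
    revApp-◅◅ ε       g = refl
    revApp-◅◅ (s ◅ f) g = trans (revApp-◅◅ f (SymClosure.symmetric (Step P) s ◅ g)) (sym (trans
      (cong (_◅◅ g) (revApp-◅◅ f (SymClosure.symmetric (Step P) s ◅ ε))) (Star.◅◅-assoc (f ⁻¹) _ g)))

  ⁻¹-◅ : (s : SymClosure (Step P) u v) (f : Track P v w) →
         (s ◅ f) ⁻¹ ≡ f ⁻¹ ◅◅ (SymClosure.symmetric (Step P) s ◅ ε)
  ⁻¹-◅ s f = revApp-◅◅ f _

  ⁻¹-◅◅ : (f : Track P u v) (g : Track P v w) → (f ◅◅ g) ⁻¹ ≡ g ⁻¹ ◅◅ f ⁻¹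
  ⁻¹-◅◅ ε       g = sym (◅◅-identityʳ (g ⁻¹))
  ⁻¹-◅◅ (s ◅ f) g = trans (⁻¹-◅ s (f ◅◅ g)) (trans (cong (_◅◅ _) (⁻¹-◅◅ f g)) (trans
    (Star.◅◅-assoc (g ⁻¹) (f ⁻¹) _) (cong (g ⁻¹ ◅◅_) (sym (⁻¹-◅ s f)))))

  ⁻¹-involutive : (f : Track P u v) → f ⁻¹ ⁻¹ ≡ f
  ⁻¹-involutive ε       = refl
  ⁻¹-involutive (s ◅ f) = trans (cong _⁻¹ (⁻¹-◅ s f)) (trans (⁻¹-◅◅ (f ⁻¹) _)
    (trans (cong (_ ◅_) (⁻¹-involutive f)) (cong (_◅ f) (flip² s))))
    where
    flip² : ∀ {u v} (s : SymClosure (Step P) u v) →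
            SymClosure.symmetric (Step P) (SymClosure.symmetric (Step P) s) ≡ s
    flip² (fwd _) = refl
    flip² (bwd _) = refl

  ◁-⁻¹ : ∀ w (f : Track P u v) → w ◁ (f ⁻¹) ≡ (w ◁ f) ⁻¹
  ◁-⁻¹ w ε       = refl
  ◁-⁻¹ w (s ◅ f) = trans (cong (w ◁_) (⁻¹-◅ s f)) (trans (◁-◅◅ w (f ⁻¹) _)
    (trans (cong₂ _◅◅_ (◁-⁻¹ w f) (cong (_◅ ε) (lemma s))) (sym (⁻¹-◅ _ (w ◁ f)))))
    where
    lemma : ∀ {u v} (s : SymClosure (Step P) u v) →
            SymClosure.gmap (w ++_) (w ◁ₛ_) (SymClosure.symmetric (Step P) s)
            ≡ SymClosure.symmetric (Step P) (SymClosure.gmap (w ++_) (w ◁ₛ_) s)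
    lemma (fwd _) = refl
    lemma (bwd _) = refl

  ▷-⁻¹ : ∀ (f : Track P u v) w → (f ⁻¹) ▷ w ≡ (f ▷ w) ⁻¹
  ▷-⁻¹ ε       w = refl
  ▷-⁻¹ (s ◅ f) w = trans (cong (_▷ w) (⁻¹-◅ s f)) (trans (▷-◅◅ (f ⁻¹) _ w)
    (trans (cong₂ _◅◅_ (▷-⁻¹ f w) (cong (_◅ ε) (lemma s))) (sym (⁻¹-◅ _ (f ▷ w)))))
    where
    lemma : ∀ {u v} (s : SymClosure (Step P) u v) →
            SymClosure.gmap (_++ w) (_▷ₛ w) (SymClosure.symmetric (Step P) s)
            ≡ SymClosure.symmetric (Step P) (SymClosure.gmap (_++ w) (_▷ₛ w) s)
    lemma (fwd _) = refl
    lemma (bwd _) = refl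

  step-≅ : ∀ {u v} l β r (p : u ≡ l ++ src P β ++ r) (q : v ≡ l ++ tgt P β ++ r) →
           fwd (step l β r p q) ◅ ε ≅ l ◁ (⟪ β ⟫ ▷ r)
  step-≅ l β r p q = raw-injective _ _ p (cong (λ l → (true , l , β , r) ∷ []) (sym (List.++-identityʳ l)))

module _ {P : Polygraph₂ X} (Γ : Cells₃ P) where

  -- Existence of a 3-cell between tracks which are parallel up to equalities of words.
  infix 4 _⇛_
  data _⇛_ {u v : List X} (f : Track P u v) : {u′ v′ : List X} → Track P u′ v′ → Set where
    het : {g : Track P u v} → Track₃ Γ f g → f ⇛ g

module Tracks₃ {P : Polygraph₂ X} {Γ : Cells₃ P} where

  private variable
    u v w u′ v′ w′ u″ v″ : List X

  private
    infix 4 _⟹_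
    _⟹_ : {u v u′ v′ : List X} → Track P u v → Track P u′ v′ → Set
    f ⟹ g = _⇛_ Γ f g

  ⇛⇒Track₃ : {f g : Track P u v} → f ⟹ g → Track₃ Γ f g
  ⇛⇒Track₃ (het A) = A

  ≈⇒⇛ : {f g : Track P u v} → f ≈ g → f ⟹ g
  ≈⇒⇛ e = het (id₃ e)

  ≅⇒⇛ : {f : Track P u v} {g : Track P u′ v′} → f ≅ g → f ⟹ g
  ≅⇒⇛ refl = het (id₃ ≈-refl)

  ≡⇒⇛ : {f g : Track P u v} → f ≡ g → f ⟹ g
  ≡⇒⇛ refl = het (id₃ ≈-refl)

  ⇛-refl : {f : Track P u v} → f ⟹ f
  ⇛-refl = ≅⇒⇛ refl

  ⇛-sym : {f : Track P u v} {g : Track P u′ v′} → f ⟹ g → g ⟹ f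
  ⇛-sym (het A) = het (inv₃ A)

  ⇛-trans : {f : Track P u v} {g : Track P u′ v′} {h : Track P u″ v″} → f ⟹ g → g ⟹ h → f ⟹ h
  ⇛-trans (het A) (het B) = het (A ⋆₂ B)

  ◅◅-⇛ : {f : Track P u v} {g : Track P v w} {f′ : Track P u′ v′} {g′ : Track P v′ w′} →
         f ⟹ f′ → g ⟹ g′ → f ◅◅ g ⟹ f′ ◅◅ g′
  ◅◅-⇛ (het A) (het B) = het (A ⋆₁ B)

  ◁-⇛ : {f : Track P u v} {g : Track P u′ v′} → w ≡ w′ → f ⟹ g → w ◁ f ⟹ w′ ◁ g
  ◁-⇛ refl (het A) = het (_ ◁₃ A)

  ▷-⇛ : {f : Track P u v} {g : Track P u′ v′} → f ⟹ g → w ≡ w′ → f ▷ w ⟹ g ▷ w′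
  ▷-⇛ (het A) refl = het (A ▷₃ _)

  infix  3 _∎
  infixr 2 _⇛⟨_⟩_ _≅⟨_⟩_

  _⇛⟨_⟩_ : (f : Track P u v) {g : Track P u′ v′} {h : Track P u″ v″} → f ⟹ g → g ⟹ h → f ⟹ h
  _ ⇛⟨ p ⟩ q = ⇛-trans p q

  _≅⟨_⟩_ : (f : Track P u v) {g : Track P u′ v′} {h : Track P u″ v″} → f ≅ g → g ⟹ h → f ⟹ h
  _ ≅⟨ p ⟩ q = ⇛-trans (≅⇒⇛ p) q

  _∎ : (f : Track P u v) → f ⟹ f
  _ ∎ = ⇛-refl

  ◅◅-⇛ˡ : {f : Track P u v} {f′ : Track P u v} (g : Track P v w) → f ⟹ f′ → f ◅◅ g ⟹ f′ ◅◅ g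
  ◅◅-⇛ˡ g p = ◅◅-⇛ p ⇛-refl

  ◅◅-⇛ʳ : (f : Track P u v) {g : Track P v w} {g′ : Track P v w} → g ⟹ g′ → f ◅◅ g ⟹ f ◅◅ g′
  ◅◅-⇛ʳ f p = ◅◅-⇛ ⇛-refl p

  cancelˡ : (f : Track P u v) {g h : Track P v w} → f ◅◅ g ⟹ f ◅◅ h → g ⟹ h
  cancelˡ f {g} {h} p =
    g                     ⇛⟨ ⇛-sym (contract g) ⟩
    f ⁻¹ ◅◅ (f ◅◅ g)      ⇛⟨ ◅◅-⇛ʳ (f ⁻¹) p ⟩
    f ⁻¹ ◅◅ (f ◅◅ h)      ⇛⟨ contract h ⟩
    h                     ∎
    where
    contract : ∀ g → f ⁻¹ ◅◅ (f ◅◅ g) ⟹ g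
    contract g = ⇛-trans (≡⇒⇛ (sym (Star.◅◅-assoc (f ⁻¹) f g))) (◅◅-⇛ˡ g (≈⇒⇛ (inverseˡ f)))

  -- `Track₃` only inverts along 2-composition; inversion of the 2-cells themselves is recovered by
  -- cancelling `f`.
  ⁻¹-⇛ : {f : Track P u v} {g : Track P u′ v′} → f ⟹ g → f ⁻¹ ⟹ g ⁻¹
  ⁻¹-⇛ {f = f} {g} p@(het A) = cancelˡ f
    (f ◅◅ f ⁻¹   ⇛⟨ ≈⇒⇛ (inverseʳ f) ⟩
     ε           ⇛⟨ ⇛-sym (≈⇒⇛ (inverseʳ g)) ⟩
     g ◅◅ g ⁻¹   ⇛⟨ ◅◅-⇛ˡ (g ⁻¹) (⇛-sym p) ⟩
     f ◅◅ g ⁻¹   ∎)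

-- 2-functors

-- Common interface of `mapTrack`, which fixes 1-cells definitionally, and `extend`, which does not.
-- Only the behaviour on single steps is required; composites, inverses and whiskerings follow.
record Functor (P : Polygraph₂ X) (Q : Polygraph₂ Y) : Set where
  field
    F₀     : List X → List Y
    F₀-[]  : F₀ [] ≡ []
    F₀-++  : ∀ u v → F₀ (u ++ v) ≡ F₀ u ++ F₀ v
    F₂     : ∀ β → Track Q (F₀ (src P β)) (F₀ (tgt P β))
    Fₛ     : ∀ {u v} → Step P u v → Track Q (F₀ u) (F₀ v)
    F      : ∀ {u v} → Track P u v → Track Q (F₀ u) (F₀ v)
    F-ε    : ∀ {u} → F (ε {x = u}) ≡ ε
    F-fwd  : ∀ {u v w} (s : Step P u v) (f : Track P v w) → F (fwd s ◅ f) ≡ Fₛ s ◅◅ F f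
    F-bwd  : ∀ {u v w} (s : Step P v u) (f : Track P v w) → F (bwd s ◅ f) ≡ Fₛ s ⁻¹ ◅◅ F f
    F-step : ∀ {u v} l β r (p : u ≡ l ++ src P β ++ r) (q : v ≡ l ++ tgt P β ++ r) →
             Fₛ (step l β r p q) ≅ F₀ l ◁ (F₂ β ▷ F₀ r)

module _ {P : Polygraph₂ X} {Q : Polygraph₂ Y} (𝓕 : Functor P Q) where
  open Functor 𝓕

  private variable
    u v w u′ v′ : List X

  F-≅ : {f : Track P u v} {g : Track P u′ v′} → f ≅ g → F f ≅ F g
  F-≅ refl = refl

  F-◅◅ : (f : Track P u v) (g : Track P v w) → F (f ◅◅ g) ≡ F f ◅◅ F g
  F-◅◅ ε g = cong (_◅◅ F g) (sym F-ε)
  F-◅◅ (fwd s ◅ f) g = trans (F-fwd s (f ◅◅ g)) (trans (cong (Fₛ s ◅◅_) (F-◅◅ f g))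
    (trans (sym (Star.◅◅-assoc (Fₛ s) (F f) (F g))) (cong (_◅◅ F g) (sym (F-fwd s f)))))
  F-◅◅ (bwd s ◅ f) g = trans (F-bwd s (f ◅◅ g)) (trans (cong (Fₛ s ⁻¹ ◅◅_) (F-◅◅ f g))
    (trans (sym (Star.◅◅-assoc (Fₛ s ⁻¹) (F f) (F g))) (cong (_◅◅ F g) (sym (F-bwd s f)))))

  F-fwd-ε : (s : Step P u v) → F (fwd s ◅ ε) ≡ Fₛ s
  F-fwd-ε s = trans (F-fwd s ε) (trans (cong (Fₛ s ◅◅_) F-ε) (◅◅-identityʳ (Fₛ s)))

  F-bwd-ε : (s : Step P u v) → F (bwd s ◅ ε) ≡ Fₛ s ⁻¹
  F-bwd-ε s = trans (F-bwd s ε) (trans (cong (Fₛ s ⁻¹ ◅◅_) F-ε) (◅◅-identityʳ (Fₛ s ⁻¹)))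

  F-⁻¹ : (f : Track P u v) → F (f ⁻¹) ≡ F f ⁻¹
  F-⁻¹ ε = trans F-ε (cong _⁻¹ (sym F-ε))
  F-⁻¹ (fwd s ◅ f) = trans (cong F (⁻¹-◅ (fwd s) f)) (trans (F-◅◅ (f ⁻¹) (bwd s ◅ ε))
    (trans (cong₂ _◅◅_ (F-⁻¹ f) (F-bwd-ε s))
    (trans (sym (⁻¹-◅◅ (Fₛ s) (F f))) (cong _⁻¹ (sym (F-fwd s f))))))
  F-⁻¹ (bwd s ◅ f) = trans (cong F (⁻¹-◅ (bwd s) f)) (trans (F-◅◅ (f ⁻¹) (fwd s ◅ ε))
    (trans (cong₂ _◅◅_ (F-⁻¹ f) (trans (F-fwd-ε s) (sym (⁻¹-involutive (Fₛ s)))))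
    (trans (sym (⁻¹-◅◅ (Fₛ s ⁻¹) (F f))) (cong _⁻¹ (sym (F-bwd s f))))))

  Fₛ-◁ : ∀ w (s : Step P u v) → Fₛ (w ◁ₛ s) ≅ F₀ w ◁ Fₛ s
  Fₛ-◁ w (step l β r p q) = ≅-trans (F-step (w ++ l) β r _ _) (≅-trans
    (◁-≅ (F₀-++ w l) refl) (≅-trans (◁-++ (F₀ w) (F₀ l) _) (◁-≅ refl (≅-sym (F-step l β r p q)))))

  Fₛ-▷ : ∀ (s : Step P u v) w → Fₛ (s ▷ₛ w) ≅ Fₛ s ▷ F₀ w
  Fₛ-▷ (step l β r p q) w = ≅-trans (F-step l β (r ++ w) _ _) (≅-trans
    (◁-≅ refl (≅-trans (▷-≅ refl (F₀-++ r w)) (▷-++ (F₂ β) (F₀ r) (F₀ w))))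
    (≅-trans (≅-sym (◁-▷ (F₀ l) (F₂ β ▷ F₀ r) (F₀ w))) (▷-≅ (≅-sym (F-step l β r p q)) refl)))

  F-◁ : ∀ w (f : Track P u v) → F (w ◁ f) ≅ F₀ w ◁ F f
  F-◁ {u} w ε = ≅-trans (≡⇒≅ F-ε) (≅-trans (ε-≅ (F₀-++ w u)) (◁-≅ refl (≡⇒≅ (sym F-ε))))
  F-◁ w (fwd s ◅ f) = ≅-trans (≡⇒≅ (F-fwd (w ◁ₛ s) (w ◁ f))) (≅-trans
    (◅◅-≅ (Fₛ-◁ w s) (F-◁ w f)) (≡⇒≅ (trans (sym (◁-◅◅ (F₀ w) (Fₛ s) (F f)))
      (cong (F₀ w ◁_) (sym (F-fwd s f))))))
  F-◁ w (bwd s ◅ f) = ≅-trans (≡⇒≅ (F-bwd (w ◁ₛ s) (w ◁ f))) (≅-trans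
    (◅◅-≅ (≅-trans (⁻¹-≅ (Fₛ-◁ w s)) (≡⇒≅ (sym (◁-⁻¹ (F₀ w) (Fₛ s))))) (F-◁ w f))
    (≡⇒≅ (trans (sym (◁-◅◅ (F₀ w) (Fₛ s ⁻¹) (F f))) (cong (F₀ w ◁_) (sym (F-bwd s f))))))

  F-▷ : ∀ (f : Track P u v) w → F (f ▷ w) ≅ F f ▷ F₀ w
  F-▷ {u} ε w = ≅-trans (≡⇒≅ F-ε) (≅-trans (ε-≅ (F₀-++ u w)) (▷-≅ (≡⇒≅ (sym F-ε)) refl))
  F-▷ (fwd s ◅ f) w = ≅-trans (≡⇒≅ (F-fwd (s ▷ₛ w) (f ▷ w))) (≅-trans
    (◅◅-≅ (Fₛ-▷ s w) (F-▷ f w)) (≡⇒≅ (trans (sym (▷-◅◅ (Fₛ s) (F f) (F₀ w)))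
      (cong (_▷ F₀ w) (sym (F-fwd s f))))))
  F-▷ (bwd s ◅ f) w = ≅-trans (≡⇒≅ (F-bwd (s ▷ₛ w) (f ▷ w))) (≅-trans
    (◅◅-≅ (≅-trans (⁻¹-≅ (Fₛ-▷ s w)) (≡⇒≅ (sym (▷-⁻¹ (Fₛ s) (F₀ w))))) (F-▷ f w))
    (≡⇒≅ (trans (sym (▷-◅◅ (Fₛ s ⁻¹) (F f) (F₀ w))) (cong (_▷ F₀ w) (sym (F-bwd s f))))))

  module _ {Δ : Cells₃ Q} where
    open Tracks₃ {Γ = Δ}

    private
      infix 4 _⟹_
      _⟹_ : {u v u′ v′ : List Y} → Track Q u v → Track Q u′ v′ → Set
      f ⟹ g = _⇛_ Δ f g

    F-≈ : {f g : Track P u v} → f ≈ g → F f ⟹ F g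
    F-≈ ≈-refl = ⇛-refl
    F-≈ (≈-sym e) = ⇛-sym (F-≈ e)
    F-≈ (≈-trans e e′) = ⇛-trans (F-≈ e) (F-≈ e′)
    F-≈ (⋆-cong {f = f} {f′} {g} {g′} e e′) =
      F (f ◅◅ g)      ≅⟨ ≡⇒≅ (F-◅◅ f g) ⟩
      F f ◅◅ F g      ⇛⟨ ◅◅-⇛ (F-≈ e) (F-≈ e′) ⟩
      F f′ ◅◅ F g′    ≅⟨ ≡⇒≅ (sym (F-◅◅ f′ g′)) ⟩
      F (f′ ◅◅ g′)    ∎
    F-≈ (◁-cong w {f} {g} e) =
      ⇛-trans (≅⇒⇛ (F-◁ w f)) (⇛-trans (◁-⇛ refl (F-≈ e)) (≅⇒⇛ (≅-sym (F-◁ w g))))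
    F-≈ (▷-cong {f = f} {g} e w) =
      ⇛-trans (≅⇒⇛ (F-▷ f w)) (⇛-trans (▷-⇛ (F-≈ e) refl) (≅⇒⇛ (≅-sym (F-▷ g w))))
    F-≈ (inverseʳ f) =
      F (f ◅◅ f ⁻¹)   ≅⟨ ≡⇒≅ (trans (F-◅◅ f (f ⁻¹)) (cong (F f ◅◅_) (F-⁻¹ f))) ⟩
      F f ◅◅ F f ⁻¹   ⇛⟨ ≈⇒⇛ (inverseʳ (F f)) ⟩
      ε               ≅⟨ ≡⇒≅ (sym F-ε) ⟩
      F ε             ∎
    F-≈ (inverseˡ f) =
      F (f ⁻¹ ◅◅ f)   ≅⟨ ≡⇒≅ (trans (F-◅◅ (f ⁻¹) f) (cong (_◅◅ F f) (F-⁻¹ f))) ⟩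
      F f ⁻¹ ◅◅ F f   ⇛⟨ ≈⇒⇛ (inverseˡ (F f)) ⟩
      ε               ≅⟨ ≡⇒≅ (sym F-ε) ⟩
      F ε             ∎
    F-≈ {u = _} (interchange {u = u} {v} {u′} {v′} f g) =
      F ((f ▷ u′) ◅◅ (v ◁ g))             ≅⟨ ≡⇒≅ (F-◅◅ (f ▷ u′) (v ◁ g)) ⟩
      F (f ▷ u′) ◅◅ F (v ◁ g)             ≅⟨ ◅◅-≅ (F-▷ f u′) (F-◁ v g) ⟩
      (F f ▷ F₀ u′) ◅◅ (F₀ v ◁ F g)       ⇛⟨ ≈⇒⇛ (interchange (F f) (F g)) ⟩
      (F₀ u ◁ F g) ◅◅ (F f ▷ F₀ v′)       ≅⟨ ◅◅-≅ (≅-sym (F-◁ u g)) (≅-sym (F-▷ f v′)) ⟩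
      F (u ◁ g) ◅◅ F (f ▷ v′)             ≅⟨ ≡⇒≅ (sym (F-◅◅ (u ◁ g) (f ▷ v′))) ⟩
      F ((u ◁ g) ◅◅ (f ▷ v′))             ∎

    module _ {Γ : Cells₃ P} (F₃ : ∀ A → F (lhs Γ A) ⟹ F (rhs Γ A)) where

      F-Track₃ : {f g : Track P u v} → Track₃ Γ f g → F f ⟹ F g
      F-Track₃ (gen₃ A) = F₃ A
      F-Track₃ (id₃ e) = F-≈ e
      F-Track₃ (A ⋆₂ B) = ⇛-trans (F-Track₃ A) (F-Track₃ B)
      F-Track₃ (inv₃ A) = ⇛-sym (F-Track₃ A)
      F-Track₃ (_⋆₁_ {f = f} {f′} {g} {g′} A B) = ⇛-trans (≡⇒⇛ (F-◅◅ f g))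
        (⇛-trans (◅◅-⇛ (F-Track₃ A) (F-Track₃ B)) (≡⇒⇛ (sym (F-◅◅ f′ g′))))
      F-Track₃ (_◁₃_ w {f = f} {g} A) =
        ⇛-trans (≅⇒⇛ (F-◁ w f)) (⇛-trans (◁-⇛ refl (F-Track₃ A)) (≅⇒⇛ (≅-sym (F-◁ w g))))
      F-Track₃ (_▷₃_ {f = f} {g} A w) =
        ⇛-trans (≅⇒⇛ (F-▷ f w)) (⇛-trans (▷-⇛ (F-Track₃ A) refl) (≅⇒⇛ (≅-sym (F-▷ g w))))

mapFunctor : {P Q : Polygraph₂ X} → (∀ β → Track Q (src P β) (tgt P β)) → Functor P Q
mapFunctor {P = P} {Q} φ = record
  { F₀     = id
  ; F₀-[]  = refl
  ; F₀-++  = λ _ _ → refl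
  ; F₂     = φ
  ; Fₛ     = λ s → mapStep s (φ (Step.gen s))
  ; F      = λ f → mapTrack f λ {β} _ → φ β
  ; F-ε    = refl
  ; F-fwd  = λ _ _ → refl
  ; F-bwd  = λ _ _ → refl
  ; F-step = λ l β r p q → cast-≅ (sym p) (sym q) _
  }

extendFunctor : {P : Polygraph₂ X} {Q : Polygraph₂ Y} (f₁ : X → List Y) →
                (∀ β → Track Q (concatMap f₁ (src P β)) (concatMap f₁ (tgt P β))) → Functor P Q
extendFunctor {P = P} {Q} f₁ f₂ = record
  { F₀     = concatMap f₁
  ; F₀-[]  = refl
  ; F₀-++  = concatMap-++ f₁
  ; F₂     = f₂
  ; Fₛ     = extendStep f₁ f₂
  ; F      = extend f₁ f₂
  ; F-ε    = refl
  ; F-fwd  = λ _ _ → refl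
  ; F-bwd  = λ _ _ → refl
  ; F-step = λ l β r p q → cast-≅ _ _ _
  }

-- Tietze transformation: a homotopy basis is transported along 𝓕 when 𝓖 is a
-- section of 𝓕 on 1-cells, and on 2-cells up to 3-cells.
module Transfer {P : Polygraph₂ X} {Q : Polygraph₂ Y} {Γ : Cells₃ P} {Δ : Cells₃ Q}
  (𝓕 : Functor P Q) (𝓖 : Functor Q P) where
  open Functor 𝓕
  open Functor 𝓖 using () renaming
    (F₀ to G₀; F₂ to G₂; Fₛ to Gₛ; F to G; F-ε to G-ε; F-fwd to G-fwd; F-bwd to G-bwd; F-step to G-step)
  open Tracks₃ {Γ = Δ}

  private
    infix 4 _⟹_
    _⟹_ : {u v u′ v′ : List Y} → Track Q u v → Track Q u′ v′ → Set
    f ⟹ g = _⇛_ Δ f g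

  module _ (section₀ : ∀ w → F₀ (G₀ w) ≡ w) (section₂ : ∀ β → F (G₂ β) ⟹ ⟪ β ⟫) where

    sectionₛ : ∀ {u v} (s : Step Q u v) → F (Gₛ s) ⟹ fwd s ◅ ε
    sectionₛ (step l β r p q) =
      F (Gₛ (step l β r p q))                      ≅⟨ F-≅ 𝓕 (G-step l β r p q) ⟩
      F (G₀ l ◁ (G₂ β ▷ G₀ r))                     ≅⟨ F-◁ 𝓕 (G₀ l) (G₂ β ▷ G₀ r) ⟩
      F₀ (G₀ l) ◁ F (G₂ β ▷ G₀ r)                  ≅⟨ ◁-≅ refl (F-▷ 𝓕 (G₂ β) (G₀ r)) ⟩
      F₀ (G₀ l) ◁ (F (G₂ β) ▷ F₀ (G₀ r))           ⇛⟨ ◁-⇛ (section₀ l) (▷-⇛ (section₂ β) (section₀ r)) ⟩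
      l ◁ (⟪ β ⟫ ▷ r)                              ≅⟨ ≅-sym (step-≅ l β r p q) ⟩
      fwd (step l β r p q) ◅ ε                     ∎

    section : ∀ {u v} (f : Track Q u v) → F (G f) ⟹ f
    section ε = ⇛-trans (≡⇒⇛ (trans (cong F G-ε) F-ε)) (≅⇒⇛ (ε-≅ (section₀ _)))
    section (fwd s ◅ f) = ⇛-trans (≡⇒⇛ (trans (cong F (G-fwd s f)) (F-◅◅ 𝓕 (Gₛ s) (G f))))
      (◅◅-⇛ (sectionₛ s) (section f))
    section (bwd s ◅ f) = ⇛-trans
      (≡⇒⇛ (trans (cong F (G-bwd s f)) (trans (F-◅◅ 𝓕 (Gₛ s ⁻¹) (G f)) (cong (_◅◅ F (G f)) (F-⁻¹ 𝓕 (Gₛ s))))))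
      (◅◅-⇛ (⁻¹-⇛ (sectionₛ s)) (section f))

    transfer : (∀ A → F (lhs Γ A) ⟹ F (rhs Γ A)) → IsHomotopyBasis Γ → IsHomotopyBasis Δ
    transfer F₃ basis f g = ⇛⇒Track₃
      (⇛-trans (⇛-sym (section f)) (⇛-trans (F-Track₃ 𝓕 {Γ = Γ} F₃ (basis (G f) (G g))) (section g)))

F-⟪⟫ : {P : Polygraph₂ X} {Q : Polygraph₂ Y} (𝓕 : Functor P Q) (β : Gen₂ P) →
       Functor.F 𝓕 ⟪ β ⟫ ≅ Functor.F₂ 𝓕 β
F-⟪⟫ 𝓕 β = ≅-trans (≡⇒≅ (F-fwd-ε 𝓕 (stepOf β))) (≅-trans (F-step [] β [] _ _) (≅-trans
  (◁-≅ F₀-[] (▷-≅ refl F₀-[])) (≅-trans ([]-◁ _) (▷-[] _))))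
  where open Functor 𝓕

⌜⌝-◅◅ : {P : Polygraph₂ X} {u v w : List X} (f : Path P u v) (g : Path P v w) →
        ⌜ f ◅◅ g ⌝ ≡ ⌜ f ⌝ ◅◅ ⌜ g ⌝
⌜⌝-◅◅ f g = Star.gmap-◅◅ id fwd f g

module _ {P : Polygraph₂ X} {Q : Polygraph₂ Y} (𝓕 : Functor P Q) {Δ : Cells₃ Q} where
  open Functor 𝓕
  open Tracks₃ {Γ = Δ}

  -- The image of β is that of the solution of f ⋆₁ β ⋆₁ g = h, so f and g cancel and the filling is
  -- an identity, without any generating 3-cell.
  F-solve : ∀ {u v} β (f : Track P u (src P β)) (g : Track P (tgt P β) v) (h : Track P u v) →
            F₂ β ≡ F (f ⁻¹ ◅◅ h ◅◅ g ⁻¹) → _⇛_ Δ (F (f ◅◅ (⟪ β ⟫ ◅◅ g))) (F h)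
  F-solve β f g h e =
    F (f ◅◅ (⟪ β ⟫ ◅◅ g))            ≅⟨ ≡⇒≅ (trans (F-◅◅ 𝓕 f _) (cong (F f ◅◅_) (F-◅◅ 𝓕 ⟪ β ⟫ g))) ⟩
    F f ◅◅ (F ⟪ β ⟫ ◅◅ F g)          ≅⟨ ≡⇒≅ (cong (λ t → F f ◅◅ (t ◅◅ F g)) (trans (≅⇒≡ (F-⟪⟫ 𝓕 β)) e)) ⟩
    F f ◅◅ (F k ◅◅ F g)              ≅⟨ ≡⇒≅ (sym (trans (F-◅◅ 𝓕 f _) (cong (F f ◅◅_) (F-◅◅ 𝓕 k g)))) ⟩
    F (f ◅◅ (k ◅◅ g))                ⇛⟨ F-≈ 𝓕 cancel ⟩
    F h                              ∎
    where
    k = f ⁻¹ ◅◅ h ◅◅ g ⁻¹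
    cancel : f ◅◅ (k ◅◅ g) ≈ h
    cancel rewrite sym (Star.◅◅-assoc f k g) | sym (Star.◅◅-assoc f (f ⁻¹) (h ◅◅ g ⁻¹))
      | Star.◅◅-assoc (f ◅◅ f ⁻¹) (h ◅◅ g ⁻¹) g | Star.◅◅-assoc h (g ⁻¹) g =
      ≈-trans (⋆-cong (inverseʳ f) (⋆-cong (≈-refl {f = h}) (inverseˡ g)))
              (subst (λ k → k ≈ h) (sym (◅◅-identityʳ h)) ≈-refl)

-- The row presentation, with the triples of 𝔗¹ as 3-cells

Σrow₃ : (n : ℕ) → Cells₃ (Σrow n)
Σrow₃ n .Gen₃ = 𝔗¹ n
Σrow₃ n .dom (triple τ _) = source τ
Σrow₃ n .cod (triple τ _) = source τ ^
Σrow₃ n .lhs (triple τ _) = ⌜ L τ ⌝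
Σrow₃ n .rhs (triple τ _) = ⌜ R τ ⌝

-- The images used by `redVertex` are functions of membership proofs, which can only be compared
-- pointwise.
mapTrack-cong : {P Q : Polygraph₂ X} {u v : List X} (f : Track P u v)
                {φ ψ : ∀ {β} → β ∈ gens f → Track Q (src P β) (tgt P β)} →
                (∀ {β} (β∈ : β ∈ gens f) → φ β∈ ≡ ψ β∈) → mapTrack f φ ≡ mapTrack f ψ
mapTrack-cong ε           e = refl
mapTrack-cong (fwd s ◅ f) e =
  cong₂ _◅◅_ (cong (mapStep s) (e (here refl))) (mapTrack-cong f (e ∘ there))
mapTrack-cong (bwd s ◅ f) e =
  cong₂ _◅◅_ (cong (λ t → mapStep s t ⁻¹) (e (here refl))) (mapTrack-cong f (e ∘ there))

DistinctCells : List (EligiblePair n) → Set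
DistinctCells = AllPairs λ e e′ → cell e ≢ cell e′

lookup-injective : {f : X → Y} {xs : List X} → AllPairs (λ x y → f x ≢ f y) xs → ∀ i j →
                   f (lookup xs i) ≡ f (lookup xs j) → i ≡ j
lookup-injective (_ ∷ _)  zero    zero    _ = refl
lookup-injective (d ∷ _)  zero    (suc j) e = contradiction e (All.lookup d (∈-lookup j))
lookup-injective (d ∷ _)  (suc i) zero    e = contradiction (sym e) (All.lookup d (∈-lookup i))
lookup-injective (_ ∷ ps) (suc i) (suc j) e = cong suc (lookup-injective ps i j e)

module Collapse {n : ℕ} (K : List (EligiblePair n)) (acyclic : Acyclic K)
                (distinct : DistinctCells K) where
  open Reduction K acyclic

  private
    -- Reads off the images from the definition of redVertex.
    images : ∀ {u v} {f : Track (Σrow n) u v} {φ : ∀ {β} → β ∈ gens f → Image β} {t} →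
             t ≡ mapTrack f (λ {β} → φ {β}) → ∀ {β} → β ∈ gens f → Image β
    images {φ = φ} _ = φ

    vertexImages : ∀ {i} (rs : ∀ {j} → TransClosure (Edge K) j i → Acc (TransClosure (Edge K)) j) →
                   ∀ {β} → β ∈ dependencies (lookup K i) → Image β
    vertexImages {i} rs = images {f = S (lookup K i)} {t = redVertex i (acc rs)} refl

    dependence : ∀ {i β} (c : Collapsed β) → β ∈ dependencies (lookup K i) →
                 TransClosure (Edge K) (Any.index c) i
    dependence {i} c β∈ = [ subst (_∈ dependencies (lookup K i)) (Any.lookup-index c) β∈ ]

  -- `redVertex` hands down the accessibility of its own vertex, while `redCell` starts afresh from
  -- `edge-wellFounded`; this reconciles the two.
  redVertex-irrelevant : ∀ i (a b : Acc (TransClosure (Edge K)) i) → redVertex i a ≡ redVertex i b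
  redVertex-irrelevant i (acc rs) (acc rs′) = mapTrack-cong (S (lookup K i)) pointwise
    where
    pointwise : ∀ {β} (β∈ : β ∈ dependencies (lookup K i)) → vertexImages rs β∈ ≡ vertexImages rs′ β∈
    pointwise {β} β∈ with collapsed? β
    ... | no  _ = refl
    ... | yes c = cong (subst Image (sym (Any.lookup-index c)))
      (redVertex-irrelevant (Any.index c) (rs (dependence c β∈)) (rs′ (dependence c β∈)))

  redVertex-S : ∀ i (a : Acc (TransClosure (Edge K)) i) → redVertex i a ≡ Red (S (lookup K i))
  redVertex-S i (acc rs) = mapTrack-cong (S (lookup K i)) pointwise
    where
    pointwise : ∀ {β} (β∈ : β ∈ dependencies (lookup K i)) → vertexImages rs β∈ ≡ redCell β
    pointwise {β} β∈ with collapsed? β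
    ... | no  _ = refl
    ... | yes c = cong (subst Image (sym (Any.lookup-index c)))
      (redVertex-irrelevant (Any.index c) (rs (dependence c β∈)) (edge-wellFounded (Any.index c)))

  -- The defining equation Red(β) = Red(S_β). The search in `collapsed?` could stop at another index
  -- carrying the same cell; distinctness of the cells excludes it.
  redCell-S : ∀ i → redCell (cell (lookup K i)) ≡ Red (S (lookup K i))
  redCell-S i with collapsed? (cell (lookup K i))
  ... | no  ∉ = contradiction (Any.map (cong cell) (∈-lookup {xs = K} i)) ∉
  ... | yes c = trans
    (at-index (Any.index c)
      (lookup-injective distinct _ _ (sym (Any.lookup-index c))) (Any.lookup-index c))
    (redVertex-S i (edge-wellFounded i))
    where
    at-index : ∀ j → j ≡ i → (e : cell (lookup K i) ≡ cell (lookup K j)) →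
           subst Image (sym e) (redVertex j (edge-wellFounded j)) ≡ redVertex i (edge-wellFounded i)
    at-index _ refl refl = refl

  redCell-survives : ∀ β .(s : ¬ Collapsed β) → redCell β ≡ ⟪ surviving β s ⟫
  redCell-survives β s with collapsed? β
  ... | no  _ = refl
  ... | yes c = ⊥-elim-irr (s c)

  𝓡𝓮𝓭 : Functor (Σrow n) Σred
  𝓡𝓮𝓭 = mapFunctor redCell

  𝓘 : Functor Σred (Σrow n)
  𝓘 = mapFunctor λ β → ⟪ RedCell.rowCell β ⟫

  open Tracks₃ {Γ = Σred₃}

  -- One of L and R factors through the collapsed cell, and S_β solves for that cell by means of the
  -- other, so `F-solve` applies in either case.
  Red-collapsed : ∀ i → let triple τ _ = triple-of (lookup K i) in
                  _⇛_ Σred₃ (Red ⌜ L τ ⌝) (Red ⌜ R τ ⌝)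
  Red-collapsed i with lookup K i | redCell-S i
  ... | pair {triple τ _} {β} (inj₁ (split f g eq) , _) | e =
    ⇛-trans (≡⇒⇛ (cong Red (trans (cong ⌜_⌝ eq) (⌜⌝-◅◅ f (stepOf β ◅ g)))))
            (F-solve 𝓡𝓮𝓭 β ⌜ f ⌝ ⌜ g ⌝ ⌜ R τ ⌝ e)
  ... | pair {triple τ _} {β} (inj₂ (split f g eq) , _) | e =
    ⇛-sym (⇛-trans (≡⇒⇛ (cong Red (trans (cong ⌜_⌝ eq) (⌜⌝-◅◅ f (stepOf β ◅ g)))))
            (F-solve 𝓡𝓮𝓭 β ⌜ f ⌝ ⌜ g ⌝ ⌜ L τ ⌝ e))

  Red₃ : ∀ A → _⇛_ Σred₃ (Red (lhs (Σrow₃ n) A)) (Red (rhs (Σrow₃ n) A))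
  Red₃ A with any? (λ e → A ≟ₜ triple-of e) K
  ... | no  ∉ = het (gen₃ (𝒳 A ∉))
  ... | yes c = subst (λ A → _⇛_ Σred₃ (Red (lhs (Σrow₃ n) A)) (Red (rhs (Σrow₃ n) A)))
                      (sym (Any.lookup-index c)) (Red-collapsed (Any.index c))

  Σred-basis : IsHomotopyBasis (Σrow₃ n) → IsHomotopyBasis Σred₃
  Σred-basis = Transfer.transfer {Γ = Σrow₃ n} 𝓡𝓮𝓭 𝓘 (λ _ → refl)
    (λ { (surviving β s) → ⇛-trans (≅⇒⇛ (F-⟪⟫ 𝓡𝓮𝓭 β)) (≡⇒⇛ (redCell-survives β s)) }) Red₃

  -- The cells `inj₂ δ` are exactly the section condition of `Transfer`, and the cells `inj₁ A` the
  -- fillings of the images of the row 3-cells.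
  preRow-basis : IsHomotopyBasis Σred₃ → IsHomotopyBasis preRow₃
  preRow-basis = Transfer.transfer {Γ = Σred₃} {preRow₃}
    (mapFunctor λ β → letterPath (RedCell.rowCell β)) (mapFunctor λ δ → Red (normalPath δ))
    (λ _ → refl) (λ δ → het (gen₃ (inj₂ δ))) (λ A → het (gen₃ (inj₁ A)))

module _ {A : Set} {_R_ : A → A → Set} {P : List A → A → Set} (P? : ∀ kept a → Dec (P kept a)) where

  AllPairs-remove : ∀ as {a bs} → AllPairs _R_ (as ++ a ∷ bs) → AllPairs _R_ (as ++ bs)
  AllPairs-remove []       (_ ∷ ps) = ps
  AllPairs-remove (x ∷ as) (p ∷ ps) =
    All.++⁺ (All.++⁻ˡ as p) (All.tail (All.++⁻ʳ as p)) ∷ AllPairs-remove as ps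

  -- Scanning only removes elements, so the relation is inherited from the scanned list.
  keep-if-AllPairs⁺ : ∀ ks as → AllPairs _R_ (ks ++ as) → AllPairs _R_ (keep-if P? ks as)
  keep-if-AllPairs⁺ ks []       ps = subst (AllPairs _R_) (List.++-identityʳ ks) ps
  keep-if-AllPairs⁺ ks (a ∷ as) ps with P? ks a
  ... | yes _ = keep-if-AllPairs⁺ (ks ∷ʳ a) as
                  (subst (AllPairs _R_) (sym (List.++-assoc ks (a ∷ []) as)) ps)
  ... | no  _ = keep-if-AllPairs⁺ ks as (AllPairs-remove ks ps)

  -- Here the relation comes from the criterion itself: what is kept is related to everything kept
  -- before it.
  keep-if-AllPairs : (∀ {ks a} → P ks a → All (_R a) ks) →
                     ∀ ks as → AllPairs _R_ ks → AllPairs _R_ (keep-if P? ks as)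
  keep-if-AllPairs P⇒R ks []       ps = ps
  keep-if-AllPairs P⇒R ks (a ∷ as) ps with P? ks a
  ... | yes p = keep-if-AllPairs P⇒R (ks ∷ʳ a) as
                  (AllPairs.++⁺ ps ([] ∷ []) (All.map (_∷ []) (P⇒R p)))
  ... | no  _ = keep-if-AllPairs P⇒R ks as ps

matched-distinct : ∀ n → DistinctCells (matched n)
matched-distinct n = keep-if-AllPairs {P = Unmatched} _
  (λ unmatched → All.map (λ ¬p e → ¬p (inj₂ (sym e))) (All.¬Any⇒All¬ _ unmatched))
  [] (Sort.sort (pairOrder n) (eligiblePairs n)) []

collapsed-distinct : ∀ n → DistinctCells (collapsed n)
collapsed-distinct n = keep-if-AllPairs⁺ {P = AcyclicWith} acyclicWith? [] (matched n) (matched-distinct n)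

Σprerow-basis : ∀ n → IsHomotopyBasis (Σrow₃ n) → IsHomotopyBasis (Σprerow₃ n)
Σprerow-basis n basis = preRow-basis (Σred-basis basis)
  where open Collapse (collapsed n) (collapsed-acyclic n) (collapsed-distinct n)

-- Elimination of the long rows

expand-short : (a : ShortRow n) → expand (ShortRow.underlying a) ≡ a ∷ []
expand-short (short u ≱) with 2 ℕ.≤? ℓ u
... | yes 2≤ = ⊥-elim-irr (≱ 2≤)
... | no  _  = refl

inclusion₁ : ShortRow n → List (Row n)
inclusion₁ a = ShortRow.underlying a ∷ []

inclusion₁-rowsOf : (w : List (Fin n)) → concatMap inclusion₁ (concatMap expand (rowsOf w)) ≡ rowsOf w
inclusion₁-rowsOf w = trans (cong (concatMap inclusion₁) (expand-rowsOf w)) (go w)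
  where
  go : ∀ w → concatMap inclusion₁ (map shortRow w) ≡ rowsOf w
  go []      = refl
  go (x ∷ w) = cong (r x ∷_) (go w)

inclusion₂ : (δ : LetterCell n) → Track (Σprerow n)
  (concatMap inclusion₁ (src (Σstylcoh n) δ)) (concatMap inclusion₁ (tgt (Σstylcoh n) δ))
inclusion₂ {n} (kept (δ ʳ)   _)  =
  cast (sym (inclusion₁-rowsOf (src (Σstyl n) δ))) (sym (inclusion₁-rowsOf (tgt (Σstyl n) δ))) ⟪ δ ʳ ⟫
inclusion₂ (kept (γ u h) ¬γ) = ⊥-elim-irr (¬γ (isγ u h))

expand-inclusion₁ : (w : List (ShortRow n)) → concatMap expand (concatMap inclusion₁ w) ≡ w
expand-inclusion₁ []      = refl
expand-inclusion₁ (a ∷ w) = cong₂ _++_ (expand-short a) (expand-inclusion₁ w)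

Σstylcoh-basis : ∀ n → IsHomotopyBasis (Σprerow₃ n) → IsHomotopyBasis (Σstylcoh₃ n)
Σstylcoh-basis n = Transfer.transfer {Γ = Σprerow₃ n} {Σstylcoh₃ n} 𝓔 (extendFunctor inclusion₁ inclusion₂)
  expand-inclusion₁ section₂ (λ A → het (gen₃ A))
  where
  open Tracks₃ {Γ = Σstylcoh₃ n}
  𝓔 : Functor (Σprerow n) (Σstylcoh n)
  𝓔 = extendFunctor expand eliminate₂
  section₂ : ∀ β → _⇛_ (Σstylcoh₃ n) (eliminate (inclusion₂ β)) ⟪ β ⟫
  section₂ (kept (δ ʳ)   _)  = ≅⇒⇛ (≅-trans
    (F-≅ 𝓔 {f = inclusion₂ (kept (δ ʳ) (λ ()))} (cast-≅
      (sym (inclusion₁-rowsOf (src (Σstyl n) δ))) (sym (inclusion₁-rowsOf (tgt (Σstyl n) δ))) ⟪ δ ʳ ⟫))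
    (F-⟪⟫ 𝓔 (δ ʳ)))
  section₂ (kept (γ u h) ¬γ) = ⊥-elim-irr (¬γ (isγ u h))

-- Identification of the one-letter rows with the letters

min-r : (x : Fin n) → min (r x) ≡ x
min-r x = ∅-⊕⁻ (min-∈ (r x))

identify-shortRow : (w : List (Fin n)) → concatMap identify₁ (map shortRow w) ≡ w
identify-shortRow []      = refl
identify-shortRow (x ∷ w) = cong₂ _∷_ (min-r x) (identify-shortRow w)

concatMap-[_] : (f : X → Y) (w : List X) → concatMap (λ x → f x ∷ []) w ≡ map f w
concatMap-[ f ] []      = refl
concatMap-[ f ] (x ∷ w) = cong (f x ∷_) (concatMap-[ f ] w)

embed₁ : Fin n → List (ShortRow n)
embed₁ x = shortRow x ∷ []

embed-expand : (w : List (Fin n)) → concatMap expand (rowsOf w) ≡ concatMap embed₁ w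
embed-expand w = trans (expand-rowsOf w) (sym (concatMap-[ shortRow ] w))

embed₂ : (δ : StylCell n) → Track (Σstylcoh n)
  (concatMap embed₁ (src (Σstyl n) δ)) (concatMap embed₁ (tgt (Σstyl n) δ))
embed₂ {n} δ = cast (embed-expand (src (Σstyl n) δ)) (embed-expand (tgt (Σstyl n) δ)) ⟪ kept (δ ʳ) (λ ()) ⟫

identify-embed : (w : List (Fin n)) → concatMap identify₁ (concatMap embed₁ w) ≡ w
identify-embed w = trans (cong (concatMap identify₁) (concatMap-[ shortRow ] w)) (identify-shortRow w)

𝓘𝓭 : Functor (Σstylcoh n) (Σstyl n)
𝓘𝓭 = extendFunctor identify₁ identify₂

𝓔𝓶𝓫 : Functor (Σstyl n) (Σstylcoh n)
𝓔𝓶𝓫 = extendFunctor embed₁ embed₂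

Σstyl-basis : ∀ n → IsHomotopyBasis (Σstylcoh₃ n) → IsHomotopyBasis (Σstyl₃ n)
Σstyl-basis n = Transfer.transfer {Γ = Σstylcoh₃ n} {Σstyl₃ n} 𝓘𝓭 𝓔𝓶𝓫
  identify-embed section₂ (λ A → het (gen₃ A))
  where
  open Tracks₃ {Γ = Σstyl₃ n}
  section₂ : ∀ δ → _⇛_ (Σstyl₃ n) (extend identify₁ identify₂ (embed₂ δ)) ⟪ δ ⟫
  section₂ δ = ≅⇒⇛ (≅-trans
    (F-≅ 𝓘𝓭 {f = embed₂ δ} (cast-≅
      (embed-expand (src (Σstyl n) δ)) (embed-expand (tgt (Σstyl n) δ)) ⟪ kept (δ ʳ) (λ ()) ⟫))
    (≅-trans (F-⟪⟫ 𝓘𝓭 (kept (δ ʳ) (λ ()))) (cast-≅ _ _ ⟪ δ ⟫)))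

-- Presentation of the stylic monoid and isomorphism of 2-polygraphs

module _ {P : Polygraph₂ X} where

  ~-step : ∀ {u v} → Step P u v → _~_ P u v
  ~-step (step l β r refl refl) = ~-++ (~-refl {u = l}) (~-++ (~-gen β) (~-refl {u = r}))

  Track⇒~ : ∀ {u v} → Track P u v → _~_ P u v
  Track⇒~ ε           = ~-refl
  Track⇒~ (fwd s ◅ f) = ~-trans (~-step s) (Track⇒~ f)
  Track⇒~ (bwd s ◅ f) = ~-trans (~-sym (~-step s)) (Track⇒~ f)

-- Two words are congruent exactly when a track joins them, so a 2-functor carries congruences over.
F-~ : {P : Polygraph₂ X} {Q : Polygraph₂ Y} (𝓕 : Functor P Q) → ∀ {u v} →
      _~_ P u v → _~_ Q (Functor.F₀ 𝓕 u) (Functor.F₀ 𝓕 v)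
F-~ 𝓕 e = Track⇒~ (Functor.F 𝓕 (~⇒Track _ e))

short≡ : (a : ShortRow n) → shortRow (letter a) ≡ a
short≡ (short u ≱) with x , refl ← short-row u (λ 2≤ → ⊥-elim-irr (≱ 2≤)) = cong shortRow (min-r x)

Σstylcoh-presents : ∀ n → Σstylcoh n Presents Styl n
Σstylcoh-presents n = concatMap identify₁ , record
  { isMonoidMonomorphism = record
    { isMonoidHomomorphism = record
      { isMagmaHomomorphism = record
        { isRelHomomorphism = record { cong = F-~ 𝓘𝓭 }
        ; homo = λ u v → ~-reflexive _ (concatMap-++ identify₁ u v)
        }
      ; ε-homo = ~-refl
      }
    ; injective = λ {u} {v} e → subst₂ (_~_ (Σstylcoh n)) (embed-identify u) (embed-identify v) (F-~ 𝓔𝓶𝓫 e)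
    }
  ; surjective = λ w → concatMap embed₁ w ,
      λ e → ~-trans (F-~ 𝓘𝓭 e) (~-reflexive _ (identify-embed w))
  }
  where
  embed-identify : ∀ w → concatMap embed₁ (concatMap identify₁ w) ≡ w
  embed-identify []      = refl
  embed-identify (a ∷ w) = cong₂ _∷_ (short≡ a) (embed-identify w)

stylCell-isomorphism : ∀ n → IsIsomorphism (Σstylcoh n) (Σstyl n) letter stylCell
stylCell-isomorphism n = record
  { bijective₁ = (λ {a} {b} e → trans (sym (short≡ a)) (trans (cong shortRow e) (short≡ b)))
               , (λ x → shortRow x , λ { refl → min-r x })
  ; bijective₂ = (λ { {kept (δ ʳ) _} {kept (_ ʳ) _} refl → refl
                    ; {kept (γ u h) ¬γ} → ⊥-elim-irr (¬γ (isγ u h))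
                    ; {kept (_ ʳ) _} {kept (γ u h) ¬γ} → ⊥-elim-irr (¬γ (isγ u h)) })
               , (λ δ → kept (δ ʳ) (λ ()) , λ { refl → refl })
  ; src-comm = λ { (kept (δ ʳ) _)    → sym (letters-of (src (Σstyl n) δ))
                 ; (kept (γ u h) ¬γ) → ⊥-elim-irr (¬γ (isγ u h)) }
  ; tgt-comm = λ { (kept (δ ʳ) _)    → sym (letters-of (tgt (Σstyl n) δ))
                 ; (kept (γ u h) ¬γ) → ⊥-elim-irr (¬γ (isγ u h)) }
  }
  where
  letters-of : ∀ (w : List (Fin n)) → map letter (concatMap expand (rowsOf w)) ≡ w
  letters-of w = trans (sym (concatMap-[ letter ] _))
    (trans (cong (concatMap identify₁) (expand-rowsOf w)) (identify-shortRow w))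

-- Products of two rows

·-leftover : (u v : Row n) → u · v ≡ (u ∪ᵣ v) ∷ N (word (leftover (supp u) (supp v)))
·-leftover u v = trans (◂-++ [] (letters u) (letters v))
  (trans (cong (_◂ letters v) (N-letters u)) (◂-row u [] v))

-- Indexed by the reading, so that matching on `product u v` replaces 𝓡 (u · v) by its one-row or
-- two-row shape. The upper row consists of the bumped letters.
data Product (u v : Row n) : List (Row n) → Set where
  single : ¬ Nonempty (leftover (supp u) (supp v)) → Product u v ((u ∪ᵣ v) ∷ [])
  double : ∀ w → supp w ≡ leftover (supp u) (supp v) → w ⊲ (u ∪ᵣ v) → Product u v (w ∷ (u ∪ᵣ v) ∷ [])

product : (u v : Row n) → Product u v (𝓡 (u · v))
product u v with N-tableau (letters u ++ letters v) | ·-leftover u v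
... | tab | e with N-row (leftover (supp u) (supp v))
...   | inj₁ e′ = subst (λ T → Product u v (𝓡 T)) (sym (trans e (cong ((u ∪ᵣ v) ∷_) e′)))
                    (single λ ne → contradiction (trans (sym e′) (N-letters (row _ ne))) λ ())
...   | inj₂ (w , e′ , e″) with e₂ ← trans e (cong ((u ∪ᵣ v) ∷_) e′)
      with w⊲ ∷ _ ← subst IsTableau e₂ tab =
        subst (λ T → Product u v (𝓡 T)) (sym e₂) (double w e″ w⊲)

leftover-⊆ : (p q : Subset n) → leftover p q ⊆ p
leftover⁺-⊆p : (p q : Subset n) → leftover⁺ p q ⊆ p
leftover-⊆ (_ ∷ p) (outside ∷ q) = Sub.out⊆ (leftover-⊆ p q)
leftover-⊆ (_ ∷ p) (inside  ∷ q) = Sub.out⊆ (leftover⁺-⊆p p q)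
leftover⁺-⊆p (outside ∷ p) (_ ∷ q)       = Sub.out⊆ (leftover⁺-⊆p p q)
leftover⁺-⊆p (inside  ∷ p) (outside ∷ q) = Sub.s⊆s (leftover-⊆ p q)
leftover⁺-⊆p (inside  ∷ p) (inside  ∷ q) = Sub.s⊆s (leftover⁺-⊆p p q)

leftover-min-≤ : (w u v : Row n) → supp w ≡ leftover (supp u) (supp v) → min u Fin.≤ min w
leftover-min-≤ w u v e = min-≤ u (leftover-⊆ (supp u) (supp v) (subst (min w ∈ₛ_) e (min-∈ w)))

-- A bumped letter exceeds the inserted letter that bumps it, hence also the least inserted letter.
∈-leftover : (p q : Subset n) .(ne : Nonempty q) {x : Fin n} → x ∈ₛ leftover p q → least q ne Fin.< x
∈-leftover []      []            _  ()
∈-leftover (_ ∷ p) (outside ∷ q) ne (there x∈) = s≤s (∈-leftover p q (pop ne) x∈)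
∈-leftover (_ ∷ p) (inside  ∷ q) _  (there x∈) = s≤s z≤n

-- Termination

infix 4 _≺_
_≺_ : Vec ℕ n → Vec ℕ n → Set
_≺_ = Lex-< _≡_ ℕ._<_

≺-wellFounded : WellFounded (_≺_ {n})
≺-wellFounded = Lex.<-wellFounded trans (proj₁ (resp₂ ℕ._<_)) <-wellFounded

bit : Bool → ℕ
bit b = if b then 1 else 0

-- A letter x of [n] is charged at a row u if x is the least letter of u, or if
-- x is larger than the least letter of u and not in u.  The boolean tells whether
-- a smaller letter is in u.
weigh : Bool → ℕ → Subset n → Vec ℕ n → Vec ℕ n
weigh s k []      []       = []
weigh s k (b ∷ p) (m ∷ ms) = (bit (s xor b) * k + m) ∷ weigh (s ∨ b) k p ms

-- A charge weighs one plus the number of rows to the right of its row, so that moving it to the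
-- right lowers the entry of its letter.
measure : List (Row n) → Vec ℕ n
measure []      = replicate _ 0
measure (u ∷ w) = weigh false (ℕ.suc (length w)) (supp u) (measure w)

weigh-mono : ∀ s k (p : Subset n) {m m′} → m ≺ m′ → weigh s k p m ≺ weigh s k p m′
weigh-mono s k []      (Lex.base ())
weigh-mono s k (b ∷ p) (this m<m′ _) = this (ℕ.+-monoʳ-< (bit (s xor b) * k) m<m′) refl
weigh-mono s k (b ∷ p) (next refl m≺) = next refl (weigh-mono (s ∨ b) k p m≺)

module _ (k : ℕ) where

  private
    -- The measure of two adjacent rows `p`, `q` followed by `k` rows of measure `m`; the booleans
    -- allow a recursion that has already passed smaller letters.
    weigh₂ : Bool → Subset n → Bool → Subset n → Vec ℕ n → Vec ℕ n
    weigh₂ s p t q m = weigh s (2 + k) p (weigh t (1 + k) q m)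

  -- As long as the letters of p lie in q, neither row changes. The first letter of p missing from q
  -- stays in the upper row and joins the lower one, which already has a smaller letter: its charge
  -- there disappears.
  leftover⁺-≺ : ∀ s (p q : Subset n) m →
    weigh₂ s (leftover⁺ p q) true (p ∪ q) m ≺ weigh₂ s p true q m ⊎ p ⊆ q
  leftover⁺-≺ s []            []            []      = inj₂ λ ()
  leftover⁺-≺ s (outside ∷ p) (b ∷ q)       (m ∷ ms) with leftover⁺-≺ (s ∨ false) p q ms
  ... | inj₁ m≺  = inj₁ (next refl m≺)
  ... | inj₂ p⊆q = inj₂ (Sub.out⊆ p⊆q)
  leftover⁺-≺ s (inside  ∷ p) (inside  ∷ q) (m ∷ ms) with leftover⁺-≺ (s ∨ true) p q ms
  ... | inj₁ m≺  = inj₁ (next refl m≺)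
  ... | inj₂ p⊆q = inj₂ (Sub.s⊆s p⊆q)
  leftover⁺-≺ s (inside  ∷ p) (outside ∷ q) (m ∷ ms) =
    inj₁ (this (ℕ.+-monoʳ-< (bit (s xor true) * (2 + k)) (s≤s (ℕ.m≤n+m m _))) refl)

  -- The least letter of p ∪ q decides. If it is in p, it loses its charge at the upper row and is
  -- charged at the lower row, as it already was if it is also in q. If it is only in q, both rows
  -- keep it as it is and `leftover⁺-≺` takes over.
  leftover-≺ : ∀ (p q : Subset n) .(np : Nonempty p) .(nq : Nonempty q) m →
    weigh₂ false (leftover p q) false (p ∪ q) m ≺ weigh₂ false p false q m
    ⊎ p ⊆ q × least q nq Fin.< least p np
  leftover-≺ []            []            np nq []       = ⊥-elim-irr (¬nonempty-[] np)
  leftover-≺ (outside ∷ p) (outside ∷ q) np nq (m ∷ ms) with leftover-≺ p q (pop np) (pop nq) ms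
  ... | inj₁ m≺          = inj₁ (next refl m≺)
  ... | inj₂ (p⊆q , q<p) = inj₂ (Sub.out⊆ p⊆q , s≤s q<p)
  leftover-≺ (outside ∷ p) (inside  ∷ q) np nq (m ∷ ms) with leftover⁺-≺ false p q ms
  ... | inj₁ m≺          = inj₁ (next refl m≺)
  ... | inj₂ p⊆q         = inj₂ (Sub.out⊆ p⊆q , s≤s z≤n)
  leftover-≺ (inside  ∷ p) (outside ∷ q) np nq (m ∷ ms) = inj₁ (this ℕ.≤-refl refl)
  leftover-≺ (inside  ∷ p) (inside  ∷ q) np nq (m ∷ ms) =
    inj₁ (this (s≤s (ℕ.m≤n+m (1 * (1 + k) + m) (1 + (k + 0 * (2 + k))))) refl)

-- Length comes first because a one-row product shifts the weights of all rows to its left; at equal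
-- length those weights agree and `measure` can be compared under a common prefix.
lengthMeasure : List (Row n) → Vec ℕ (ℕ.suc n)
lengthMeasure w = length w ∷ measure w

lengthMeasure-∷ : ∀ (u : Row n) w w′ → lengthMeasure w ≺ lengthMeasure w′ →
                  lengthMeasure (u ∷ w) ≺ lengthMeasure (u ∷ w′)
lengthMeasure-∷ u _ _ (this l<l′ _)            = this (s≤s l<l′) refl
lengthMeasure-∷ u w w′ (next e m≺m′) = next (cong ℕ.suc e)
  (subst (λ k → weigh false (ℕ.suc k) (supp u) (measure w) ≺ measure (u ∷ w′)) (sym e)
    (weigh-mono false _ (supp u) m≺m′))

step-≺ : {w w′ : List (Row n)} → Step (Σrow n) w w′ → lengthMeasure w′ ≺ lengthMeasure w
step-≺ (step (t ∷ a) β b refl refl) =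
  lengthMeasure-∷ t (a ++ tgt (Σrow _) β ++ b) (a ++ src (Σrow _) β ++ b) (step-≺ (step a β b refl refl))
step-≺ (step [] (α u v u⋪v) b refl refl) with 𝓡 (u · v) | product u v
... | _ | single _     = this ℕ.≤-refl refl
... | _ | double w e _ with leftover-≺ (length b) (supp u) (supp v) (nonemptyᵣ u) (nonemptyᵣ v) (measure b)
...   | inj₁ m≺  = next refl (subst (λ p → weigh false _ p _ ≺ measure (u ∷ v ∷ b)) (sym e) m≺)
...   | inj₂ u⊲v = ⊥-elim-irr (u⋪v u⊲v)

infix 4 _⊏_
_⊏_ : List (Row n) → List (Row n) → Set
w′ ⊏ w = Step (Σrow _) w w′

⊏-wellFounded : WellFounded (_⊏_ {n})
⊏-wellFounded = Subrelation.wellFounded step-≺ (On.wellFounded lengthMeasure ≺-wellFounded)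

-- Coherence of the branchings of words of rows

module _ {P : Polygraph₂ X} where

  ◁-⌜⌝ : ∀ {u v} w (f : Path P u v) → ⌜ w ◁ₚ f ⌝ ≡ w ◁ ⌜ f ⌝
  ◁-⌜⌝ w ε       = refl
  ◁-⌜⌝ w (s ◅ f) = cong (fwd (w ◁ₛ s) ◅_) (◁-⌜⌝ w f)

  ▷-⌜⌝ : ∀ {u v} (f : Path P u v) w → ⌜ f ▷ₚ w ⌝ ≡ ⌜ f ⌝ ▷ w
  ▷-⌜⌝ ε       w = refl
  ▷-⌜⌝ (s ◅ f) w = cong (fwd (s ▷ₛ w) ◅_) (▷-⌜⌝ f w)

  ⌜⌝-context : ∀ {u v w} l (f : Path P u v) r (g : Path P (l ++ v ++ r) w) →
               ⌜ (l ◁ₚ (f ▷ₚ r)) ◅◅ g ⌝ ≡ (l ◁ (⌜ f ⌝ ▷ r)) ◅◅ ⌜ g ⌝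
  ⌜⌝-context l f r g = trans (⌜⌝-◅◅ (l ◁ₚ (f ▷ₚ r)) g)
    (cong (_◅◅ ⌜ g ⌝) (trans (◁-⌜⌝ l (f ▷ₚ r)) (cong (l ◁_) (▷-⌜⌝ f r))))

Irreducible-no-step : {w w′ : List (Row n)} → Irreducible w → ¬ Step (Σrow n) w w′
Irreducible-no-step (u⊲v ∷ _) (step []          (α u v ⋪) b refl _) = ⊥-elim-irr (⋪ u⊲v)
Irreducible-no-step (_ ∷ irr) (step (_ ∷ [])    β         b refl _) =
  Irreducible-no-step irr (step [] β b refl refl)
Irreducible-no-step (_ ∷ irr) (step (_ ∷ t ∷ a) β         b refl _) =
  Irreducible-no-step irr (step (t ∷ a) β b refl refl)

normalForm-unique : {w z : List (Row n)} → flat w ≋ flat z → Irreducible z → w ^ ≡ z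
normalForm-unique {w = w} {z} e irr = trans (^-resp w z e) (Irreducible-^ irr)

normalize : {w z : List (Row n)} → flat w ≋ flat z → Irreducible z → Path (Σrow n) w z
normalize {w = w} e irr = castP refl (normalForm-unique {w = w} e irr) (Λ w)

Irreducible-normalForm : (w : List (Row n)) → Irreducible (w ^)
Irreducible-normalForm w =
  subst Irreducible (normalForm-^ (normalization w)) (normalForm-irr (normalization w))

Filled : Critical n → Set
Filled {n} τ = Track₃ (Σrow₃ n) ⌜ L τ ⌝ ⌜ R τ ⌝

-- Irreducible targets suit the Noetherian induction: after any step, a path to the target can be
-- replaced by one through another chosen word. Other targets are reached by composing with a
-- normalization.
Coherent : List (Row n) → Set
Coherent {n} w = ∀ {z} (f g : Path (Σrow n) w z) → Irreducible z → Track₃ (Σrow₃ n) ⌜ f ⌝ ⌜ g ⌝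

module _ {n : ℕ} where
  open Tracks₃ {Γ = Σrow₃ n} public

  infix 4 _⟹_
  _⟹_ : {u v u′ v′ : List (Row n)} → Track (Σrow n) u v → Track (Σrow n) u′ v′ → Set
  f ⟹ g = _⇛_ (Σrow₃ n) f g

  -- After its first step s, a path can be replaced with any other path of source w′.
  reroute : ∀ {w w′ z a a′ b} l r (s : Step (Σrow n) w w′) (f : Path (Σrow n) w′ z) →
            Coherent w′ → Irreducible z →
            (s′ : Step (Σrow n) a a′) (g : Path (Σrow n) a′ b) (h : Path (Σrow n) (l ++ b ++ r) z) →
            fwd s ◅ ε ≅ l ◁ ((fwd s′ ◅ ε) ▷ r) →
            ⌜ s ◅ f ⌝ ⟹ (l ◁ (⌜ s′ ◅ g ⌝ ▷ r)) ◅◅ ⌜ h ⌝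
  reroute l r s f coh irr s′ g h refl =
    (fwd s ◅ ε) ◅◅ ⌜ f ⌝
      ⇛⟨ ◅◅-⇛ʳ (fwd s ◅ ε) (het (coh f ((l ◁ₚ (g ▷ₚ r)) ◅◅ h) irr)) ⟩
    (fwd s ◅ ε) ◅◅ ⌜ (l ◁ₚ (g ▷ₚ r)) ◅◅ h ⌝
      ≅⟨ ≡⇒≅ (cong ((fwd s ◅ ε) ◅◅_) (⌜⌝-context l g r h)) ⟩
    (l ◁ (⌜ s′ ◅ g ⌝ ▷ r)) ◅◅ ⌜ h ⌝
      ∎

  -- Coherence of `w₁` and `w₂` reroutes both paths through the word `w₃` where both cells have been
  -- applied; the remaining square is the interchange law.
  disjoint : ∀ l (β : RowCell n) m β′ r {w w₁ w₂ z} →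
    (p₁ : w ≡ l ++ src (Σrow n) β ++ m ++ src (Σrow n) β′ ++ r)
    (q₁ : w₁ ≡ l ++ tgt (Σrow n) β ++ m ++ src (Σrow n) β′ ++ r)
    (p₂ : w ≡ (l ++ src (Σrow n) β ++ m) ++ src (Σrow n) β′ ++ r)
    (q₂ : w₂ ≡ (l ++ src (Σrow n) β ++ m) ++ tgt (Σrow n) β′ ++ r)
    (f : Path (Σrow n) w₁ z) (g : Path (Σrow n) w₂ z) →
    Coherent w₁ → Coherent w₂ → Irreducible z →
    ⌜ step l β (m ++ src (Σrow n) β′ ++ r) p₁ q₁ ◅ f ⌝ ⟹
    ⌜ step (l ++ src (Σrow n) β ++ m) β′ r p₂ q₂ ◅ g ⌝
  disjoint l β m β′ r {w} {w₁} {w₂} {z} p₁ q₁ p₂ q₂ f g coh₁ coh₂ irr =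
    fwd s₁ ◅ ⌜ f ⌝                        ⇛⟨ ◅◅-⇛ʳ (fwd s₁ ◅ ε) (het (coh₁ f (t₁ ◅ h) irr)) ⟩
    (fwd s₁ ◅ fwd t₁ ◅ ε) ◅◅ ⌜ h ⌝        ⇛⟨ ◅◅-⇛ˡ ⌜ h ⌝ square ⟩
    (fwd s₂ ◅ fwd t₂ ◅ ε) ◅◅ ⌜ h ⌝        ⇛⟨ ◅◅-⇛ʳ (fwd s₂ ◅ ε) (⇛-sym (het (coh₂ g (t₂ ◅ h) irr))) ⟩
    fwd s₂ ◅ ⌜ g ⌝                        ∎
    where
    S₁ = src (Σrow n) β
    T₁ = tgt (Σrow n) β
    S₂ = src (Σrow n) β′
    T₂ = tgt (Σrow n) β′
    assoc : ∀ (s t : List (Row n)) → l ++ s ++ m ++ t ≡ (l ++ s ++ m) ++ t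
    assoc s t = sym (trans (List.++-assoc l (s ++ m) t) (cong (l ++_) (List.++-assoc s m t)))
    w₃ = l ++ T₁ ++ m ++ T₂ ++ r
    s₁ : Step (Σrow n) w w₁
    s₁ = step l β (m ++ S₂ ++ r) p₁ q₁
    s₂ : Step (Σrow n) w w₂
    s₂ = step (l ++ S₁ ++ m) β′ r p₂ q₂
    t₁ : Step (Σrow n) w₁ w₃
    t₁ = step (l ++ T₁ ++ m) β′ r (trans q₁ (assoc T₁ (S₂ ++ r))) (assoc T₁ (T₂ ++ r))
    t₂ : Step (Σrow n) w₂ w₃
    t₂ = step l β (m ++ T₂ ++ r) (trans q₂ (sym (assoc S₁ (T₂ ++ r)))) refl
    h : Path (Σrow n) w₃ z
    h = normalize (~-trans (~-sym (Path-flat (t₁ ◅ ε))) (Path-flat f)) irr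
    F : Track (Σrow n) (l ++ S₁) (l ++ T₁)
    F = l ◁ ⟪ β ⟫
    G : Track (Σrow n) (m ++ S₂ ++ r) (m ++ T₂ ++ r)
    G = m ◁ (⟪ β′ ⟫ ▷ r)
    inner : ∀ (s : List (Row n)) →
            _≡_ {A = RawStep (Σrow n)} (true , l ++ s ++ m , β′ , r) (true , (l ++ s) ++ m ++ [] , β′ , r)
    inner s = cong (λ l → true , l , β′ , r)
      (trans (sym (List.++-assoc l s m)) (cong ((l ++ s) ++_) (sym (List.++-identityʳ m))))
    outer : ∀ (s : List (Row n)) →
            _≡_ {A = RawStep (Σrow n)} (true , l , β , m ++ s ++ r) (true , l ++ [] , β , m ++ s ++ r)
    outer s = cong (λ l → true , l , β , m ++ s ++ r) (sym (List.++-identityʳ l))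
    square : (fwd s₁ ◅ fwd t₁ ◅ ε) ⟹ (fwd s₂ ◅ fwd t₂ ◅ ε)
    square =
      (fwd s₁ ◅ fwd t₁ ◅ ε)
        ≅⟨ raw-injective _ _ (trans p₁ (sym (List.++-assoc l S₁ _)))
             (cong₂ (λ x y → x ∷ y ∷ []) (outer S₂) (inner T₁)) ⟩
      (F ▷ (m ++ S₂ ++ r)) ◅◅ ((l ++ T₁) ◁ G)
        ⇛⟨ ≈⇒⇛ (interchange F G) ⟩
      ((l ++ S₁) ◁ G) ◅◅ (F ▷ (m ++ T₂ ++ r))
        ≅⟨ ≅-sym (raw-injective _ _
             (trans p₂ (trans (sym (assoc S₁ (S₂ ++ r))) (sym (List.++-assoc l S₁ _))))
             (cong₂ (λ x y → x ∷ y ∷ []) (inner S₁) (outer T₂))) ⟩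
      (fwd s₂ ◅ fwd t₂ ◅ ε)
        ∎

  -- Coherence of `w₁` and `w₂` reroutes the two paths through L τ and R τ in context, followed by
  -- the same path `h`.
  overlapping : ∀ l (u v t : Row n) r .(p : ¬ u ⊲ v) .(q : ¬ v ⊲ t) {w w₁ w₂ z} →
    (p₁ : w ≡ l ++ u ∷ v ∷ t ∷ r) (q₁ : w₁ ≡ l ++ 𝓡 (u · v) ++ t ∷ r)
    (p₂ : w ≡ (l ++ u ∷ []) ++ v ∷ t ∷ r) (q₂ : w₂ ≡ (l ++ u ∷ []) ++ 𝓡 (v · t) ++ r)
    (f : Path (Σrow n) w₁ z) (g : Path (Σrow n) w₂ z) →
    Filled (critical u v t p q) → Coherent w₁ → Coherent w₂ → Irreducible z →
    ⌜ step l (α u v p) (t ∷ r) p₁ q₁ ◅ f ⌝ ⟹ ⌜ step (l ++ u ∷ []) (α v t q) r p₂ q₂ ◅ g ⌝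
  overlapping l u v t r p q {w} {w₁} {w₂} {z} p₁ q₁ p₂ q₂ f g filled coh₁ coh₂ irr =
    ⌜ s₁ ◅ f ⌝                           ⇛⟨ reroute l r s₁ f coh₁ irr _ _ h
      (raw-injective _ _ p₁ (cong (λ l → (true , l , α u v p , t ∷ r) ∷ []) (sym (List.++-identityʳ l)))) ⟩
    (l ◁ (⌜ L τ ⌝ ▷ r)) ◅◅ ⌜ h ⌝         ⇛⟨ ◅◅-⇛ˡ ⌜ h ⌝ (◁-⇛ refl (▷-⇛ (het filled) refl)) ⟩
    (l ◁ (⌜ R τ ⌝ ▷ r)) ◅◅ ⌜ h ⌝         ⇛⟨ ⇛-sym (reroute l r s₂ g coh₂ irr _ _ h
      (raw-injective _ _ p₁ refl)) ⟩
    ⌜ s₂ ◅ g ⌝                           ∎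
    where
    τ = critical u v t p q
    s₁ : Step (Σrow n) w w₁
    s₁ = step l (α u v p) (t ∷ r) p₁ q₁
    s₂ : Step (Σrow n) w w₂
    s₂ = step (l ++ u ∷ []) (α v t q) r p₂ q₂
    h : Path (Σrow n) (l ++ (source τ ^) ++ r) z
    h = normalize (~-trans (~-sym (Path-flat (l ◁ₚ (L τ ▷ₚ r))))
      (subst (λ w → flat w ≋ flat z) p₁ (Path-flat (s₁ ◅ f)))) irr

-- The word `y ∷ m` is the offset between two positions. Sources of row cells having two rows, the
-- steps overlap when `m` is empty and are disjoint otherwise.
data Compare {X : Set} (l₁ x₁ l₂ x₂ : List X) : Set where
  equal : l₁ ≡ l₂ → x₁ ≡ x₂ → Compare l₁ x₁ l₂ x₂
  left  : ∀ y m → l₂ ≡ l₁ ++ y ∷ m → x₁ ≡ y ∷ m ++ x₂ → Compare l₁ x₁ l₂ x₂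
  right : ∀ y m → l₁ ≡ l₂ ++ y ∷ m → x₂ ≡ y ∷ m ++ x₁ → Compare l₁ x₁ l₂ x₂

compare : ∀ {X : Set} (l₁ : List X) {x₁} l₂ {x₂} → l₁ ++ x₁ ≡ l₂ ++ x₂ → Compare l₁ x₁ l₂ x₂
compare []       []       e = equal refl e
compare []       (y ∷ l₂) e = left y l₂ refl e
compare (y ∷ l₁) []       e = right y l₁ refl (sym e)
compare (y ∷ l₁) (y′ ∷ l₂) e with refl , e′ ← List.∷-injective e with compare l₁ l₂ e′
... | equal refl refl      = equal refl refl
... | left  y m refl e″ = left y m refl e″
... | right y m refl e″ = right y m refl e″

-- Squier's theorem, relative to a class of words closed under rewriting.
module Squier {n : ℕ} (𝒢 : List (Row n) → Set)
  (closed : ∀ {w w′} → 𝒢 w → Step (Σrow n) w w′ → 𝒢 w′)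
  (filled : ∀ l {u v t} r → 𝒢 (l ++ u ∷ v ∷ t ∷ r) → ∀ .p .q → Filled (critical u v t p q)) where

  branching : ∀ {w w₁ w₂ z} → 𝒢 w → (s₁ : Step (Σrow n) w w₁) (s₂ : Step (Σrow n) w w₂)
    (f : Path (Σrow n) w₁ z) (g : Path (Σrow n) w₂ z) → Coherent w₁ → Coherent w₂ → Irreducible z →
    ⌜ s₁ ◅ f ⌝ ⟹ ⌜ s₂ ◅ g ⌝
  branching Gw (step l₁ (α u₁ v₁ c₁) r₁ p₁ q₁) (step l₂ (α u₂ v₂ c₂) r₂ p₂ q₂) f g coh₁ coh₂ irr
    with compare l₁ l₂ (trans (sym p₁) p₂)
  branching Gw (step l₁ (α u₁ v₁ c₁) r₁ refl refl) (step l₂ (α u₂ v₂ c₂) r₂ p₂ refl) f g coh₁ coh₂ irr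
    | equal refl refl with refl ← p₂ = ◅◅-⇛ʳ (_ ◅ ε) (het (coh₁ f g irr))
  branching Gw (step l₁ (α u₁ v₁ c₁) r₁ p₁ q₁) (step l₂ (α u₂ v₂ c₂) r₂ p₂ q₂) f g coh₁ coh₂ irr
    | left y [] refl refl =
    overlapping l₁ u₁ v₁ v₂ r₂ c₁ c₂ p₁ q₁ p₂ q₂ f g (filled l₁ r₂ (subst 𝒢 p₁ Gw) c₁ c₂) coh₁ coh₂ irr
  branching Gw (step l₁ (α u₁ v₁ c₁) r₁ p₁ q₁) (step l₂ (α u₂ v₂ c₂) r₂ p₂ q₂) f g coh₁ coh₂ irr
    | left y (_ ∷ m) refl refl =
    disjoint l₁ (α u₁ v₁ c₁) m (α u₂ v₂ c₂) r₂ p₁ q₁ p₂ q₂ f g coh₁ coh₂ irr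
  branching Gw (step l₁ (α u₁ v₁ c₁) r₁ p₁ q₁) (step l₂ (α u₂ v₂ c₂) r₂ p₂ q₂) f g coh₁ coh₂ irr
    | right y [] refl refl = ⇛-sym
    (overlapping l₂ u₂ v₂ v₁ r₁ c₂ c₁ p₂ q₂ p₁ q₁ g f (filled l₂ r₁ (subst 𝒢 p₂ Gw) c₂ c₁) coh₂ coh₁ irr)
  branching Gw (step l₁ (α u₁ v₁ c₁) r₁ p₁ q₁) (step l₂ (α u₂ v₂ c₂) r₂ p₂ q₂) f g coh₁ coh₂ irr
    | right y (_ ∷ m) refl refl = ⇛-sym
    (disjoint l₂ (α u₂ v₂ c₂) m (α u₁ v₁ c₁) r₁ p₂ q₂ p₁ q₁ g f coh₂ coh₁ irr)

  coherent : ∀ {w} → 𝒢 w → Coherent w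
  coherent {w} = go w (⊏-wellFounded w)
    where
    go : ∀ w → Acc _⊏_ w → 𝒢 w → Coherent w
    go w _         Gw ε        ε        irr = id₃ ≈-refl
    go w _         Gw ε        (s ◅ _)  irr = contradiction s (Irreducible-no-step irr)
    go w _         Gw (s ◅ _)  ε        irr = contradiction s (Irreducible-no-step irr)
    go w (acc rs) Gw (s₁ ◅ f) (s₂ ◅ g) irr = ⇛⇒Track₃
      (branching Gw s₁ s₂ f g (go _ (rs s₁) (closed Gw s₁)) (go _ (rs s₂) (closed Gw s₂)) irr)

-- Followed by Λ_v, any track from w to v is filled to a normalization of w. Parallel tracks thus
-- agree after composition with Λ_v, which is invertible.
coherent⇒basis : (∀ (w : List (Row n)) → Coherent w) → IsHomotopyBasis (Σrow₃ n)
coherent⇒basis {n} coh {u} {v} f g =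
  ⇛⇒Track₃ (cancelʳ (⇛-trans (standard f {≋^ f}) (⇛-sym (standard g {≋^ f}))))
  where
  irr : Irreducible (v ^)
  irr = Irreducible-normalForm v

  ≋^ : ∀ {w} → Track (Σrow n) w v → flat w ≋ flat (v ^)
  ≋^ f = ~-trans (track≋ f) (Path-flat (Λ v))
    where
    track≋ : ∀ {u v} → Track (Σrow n) u v → flat u ≋ flat v
    track≋ ε           = ~-refl
    track≋ (fwd s ◅ f) = ~-trans (Path-flat (s ◅ ε)) (track≋ f)
    track≋ (bwd s ◅ f) = ~-trans (~-sym (Path-flat (s ◅ ε))) (track≋ f)

  standard : ∀ {w} (f : Track (Σrow n) w v) {e : flat w ≋ flat (v ^)} →
             f ◅◅ ⌜ Λ v ⌝ ⟹ ⌜ normalize {w = w} e irr ⌝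
  standard ε = het (coh v _ _ irr)
  standard {w} (fwd s ◅ f) = ⇛-trans (◅◅-⇛ʳ (fwd s ◅ ε) (standard f {≋^ f}))
    (het (coh w (s ◅ normalize (≋^ f) irr) _ irr))
  -- The source of `s` is now w′, so coherence of w′ makes its normalization start with `s`, which
  -- then cancels against its inverse.
  standard {w} (_◅_ {j = w′} (bwd s) f) {e} =
    (bwd s ◅ f) ◅◅ ⌜ Λ v ⌝                                  ⇛⟨ ◅◅-⇛ʳ (bwd s ◅ ε) (standard f {≋^ f}) ⟩
    (bwd s ◅ ε) ◅◅ ⌜ normalize (≋^ f) irr ⌝                 ⇛⟨ ◅◅-⇛ʳ (bwd s ◅ ε)
      (het (coh w′ (normalize (≋^ f) irr) (s ◅ normalize e irr) irr)) ⟩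
    (bwd s ◅ fwd s ◅ ε) ◅◅ ⌜ normalize e irr ⌝              ⇛⟨ ◅◅-⇛ˡ _ (≈⇒⇛ (inverseˡ (fwd s ◅ ε))) ⟩
    ⌜ normalize e irr ⌝                                     ∎

  cancelʳ : ∀ {u w} {f g : Track (Σrow n) u v} {h : Track (Σrow n) v w} → f ◅◅ h ⟹ g ◅◅ h → f ⟹ g
  cancelʳ {f = f} {g} {h} p =
    f                       ⇛⟨ ⇛-sym (contract f) ⟩
    (f ◅◅ h) ◅◅ h ⁻¹        ⇛⟨ ◅◅-⇛ˡ (h ⁻¹) p ⟩
    (g ◅◅ h) ◅◅ h ⁻¹        ⇛⟨ contract g ⟩
    g                       ∎
    where
    contract : ∀ f → (f ◅◅ h) ◅◅ h ⁻¹ ⟹ f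
    contract f = ⇛-trans (≡⇒⇛ (Star.◅◅-assoc f h (h ⁻¹)))
      (⇛-trans (◅◅-⇛ʳ f (≈⇒⇛ (inverseʳ h))) (≡⇒⇛ (◅◅-identityʳ f)))

-- Redundancy of the triples of 𝔖

least-∪ : (p : Subset n) .(ne : Nonempty p) →
          (∅ ⊕ least p ne) ∪ (p [ least p ne ]≔ outside) ≡ p
least-∪ []            ne = ⊥-elim-irr (¬nonempty-[] ne)
least-∪ (inside  ∷ p) ne = cong (inside ∷_) (Sub.∪-identityˡ p)
least-∪ (outside ∷ p) ne = cong (outside ∷_) (least-∪ p (pop ne))

least-< : (p : Subset n) .(ne : Nonempty p) {x : Fin n} →
          x ∈ₛ p [ least p ne ]≔ outside → least p ne Fin.< x
least-< (inside  ∷ p) ne (there x∈) = s≤s z≤n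
least-< (outside ∷ p) ne (there x∈) = s≤s (least-< p (pop ne) x∈)

∂-∪ : (u : Row n) .(h : 2 ≤ ℓ u) → r (min u) ∪ᵣ ∂ u h ≡ u
∂-∪ (row p ne) h = row-≡ (least-∪ p ne)

∂-min : (u : Row n) .(h : 2 ≤ ℓ u) → min u Fin.< min (∂ u h)
∂-min (row p ne) h = least-< p ne (min-∈ (∂ (row p ne) h))

∂-length : (u : Row n) .(h : 2 ≤ ℓ u) → ℓ (∂ u h) ℕ.< ℓ u
∂-length (row p ne) _ = go p ne
  where
  go : (p : Subset n) .(ne : Nonempty p) → length (word (p [ least p ne ]≔ outside)) ℕ.< length (word p)
  go []            ne = ⊥-elim-irr (¬nonempty-[] ne)
  go (inside  ∷ p) ne = ℕ.≤-refl
  go (outside ∷ p) ne = subst₂ ℕ._<_ (sym (List.length-map suc (word (p [ least p (pop ne) ]≔ outside))))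
    (sym (List.length-map suc (word p))) (go p (pop ne))

∂-r∪ : (x : Fin n) (p : Row n) .(h : 2 ≤ ℓ (r x ∪ᵣ p)) → x Fin.< min p → ∂ (r x ∪ᵣ p) h ≡ p
∂-r∪ x (row p ne) h x<p = row-≡ (go x p _ ne x<p)
  where
  go : ∀ (x : Fin n) p .(ne′ : Nonempty ((∅ ⊕ x) ∪ p)) .(ne : Nonempty p) → x Fin.< least p ne →
       ((∅ ⊕ x) ∪ p) [ least ((∅ ⊕ x) ∪ p) ne′ ]≔ outside ≡ p
  go zero    (outside ∷ p) ne′ ne _         = cong (outside ∷_) (Sub.∪-identityˡ p)
  go (suc x) (outside ∷ p) ne′ ne (s≤s x<p) = cong (outside ∷_) (go x p (pop ne′) (pop ne) x<p)

⊲-⊆ : {s u v : Row n} → supp s ⊆ supp u → u ⊲ v → s ⊲ v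
⊲-⊆ {s = s} {u} s⊆u (u⊆v , v<u) =
  Sub.⊆-trans s⊆u u⊆v , ℕ.<-≤-trans v<u (min-≤ u (s⊆u (min-∈ s)))

∪-⊲ : {u v d : Row n} → u ⊲ d → v ⊲ d → u ∪ᵣ v ⊲ d
∪-⊲ {u = u} {v} {d} u⊲d v⊲d with p ∷ _ ← Irreducible-∪ [] u v (d ∷ []) (u⊲d ∷ [-]) (v⊲d ∷ [-]) = p

r-⊲ : {d : Row n} {x : Fin n} → x ∈ₛ supp d → min d Fin.< x → r x ⊲ d
r-⊲ {d = d} {x} x∈d d<x =
  (λ y∈ → subst (_∈ₛ supp d) (sym (∅-⊕⁻ y∈)) x∈d) , subst (min d Fin.<_) (sym (min-r x)) d<x

∈-r∪ : (x : Fin n) (p : Row n) → x ∈ₛ supp (r x ∪ᵣ p)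
∈-r∪ x p = Sub.p⊆p∪q (supp p) (∈-⊕ ∅ x)

data LetterProduct (x : Fin n) (p : Row n) : List (Row n) → Set where
  single : LetterProduct x p ((r x ∪ᵣ p) ∷ [])
  double : min p Fin.< x → LetterProduct x p (r x ∷ (r x ∪ᵣ p) ∷ [])

-- Only x can be bumped from the row r x, so a second row has to be r x, bumped by a smaller letter
-- of p.
letterProduct : ∀ (x : Fin n) p {w} → Product (r x) p w → LetterProduct x p w
letterProduct x p (single _)      = single
letterProduct x p (double w e _) with m∈ ← subst (min w ∈ₛ_) e (min-∈ w) =
  subst (λ w → LetterProduct x p (w ∷ _)) (sym w≡) (double p<x)
  where
  w⊆ : supp w ⊆ ∅ ⊕ x
  w⊆ y∈ = leftover-⊆ (∅ ⊕ x) (supp p) (subst (_ ∈ₛ_) e y∈)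
  min≡ : min w ≡ x
  min≡ = ∅-⊕⁻ (w⊆ (min-∈ w))
  w≡ : w ≡ r x
  w≡ = row-≡ (Sub.⊆-antisym w⊆
    λ y∈ → subst (_∈ₛ supp w) (trans min≡ (sym (∅-⊕⁻ y∈))) (min-∈ w))
  p<x : min p Fin.< x
  p<x = subst (min p Fin.<_) min≡ (∈-leftover (∅ ⊕ x) (supp p) (nonemptyᵣ p) m∈)

letterProduct-≤ : (x : Fin n) (p : Row n) → x Fin.≤ min p → 𝓡 (r x · p) ≡ (r x ∪ᵣ p) ∷ []
letterProduct-≤ x p x≤p with 𝓡 (r x · p) | letterProduct x p (product (r x) p)
... | _ | single     = refl
... | _ | double p<x = contradiction p<x (ℕ.≤⇒≯ x≤p)

-- Membership in 𝔖 requires a first row of length at least two.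
filled-r : (x : Fin n) {v t : Row n} .{p : ¬ r x ⊲ v} .{q : ¬ v ⊲ t} → Filled (critical (r x) v t p q)
filled-r x = gen₃ (triple (critical _ _ _ _ _) λ (h , _) → ℓ-r x h)

-- If x < min p, then ∂ (r x ∪ᵣ p) is p, and p ⊲ c keeps the triple out of 𝔖. Otherwise x lies in c
-- above its least letter, so r x ∪ᵣ p ⊲ c and the triple is not critical.
filled-r∪ : (x : Fin n) {p c d : Row n} → p ⊲ c → x Fin.≤ min p ⊎ x ∈ₛ supp c →
            ∀ .s .t → Filled (critical (r x ∪ᵣ p) c d s t)
filled-r∪ x {p} {c} p⊲c@(p⊆c , c<p) x? s t with x Fin.<? min p
... | yes x<p = gen₃ (triple (critical _ _ _ s t)
                  λ (h , ⋪) → ⋪ (subst (_⊲ c) (sym (∂-r∪ x p h x<p)) p⊲c))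
... | no  x≮p = ⊥-elim-irr (s (∪-⊲ {u = r x} {p} {c}
                  (r-⊲ {d = c} x∈c (ℕ.<-≤-trans c<p (ℕ.≮⇒≥ x≮p))) p⊲c))
  where
  x∈c : x ∈ₛ supp c
  x∈c = [ (λ x≤p → p⊆c (subst (_∈ₛ supp p) (Fin.≤-antisym (ℕ.≮⇒≥ x≮p) x≤p) (min-∈ p))) , id ]′ x?

-- A class of words closed under rewriting, which contains the words obtained from
-- r_x r_p r_v r_t, for x < min p, by rewriting r_p r_v or r_v r_t.
data Narrow {n : ℕ} : List (Row n) → Set where
  none  : Narrow []
  one   : ∀ {a} → Narrow (a ∷ [])
  two   : ∀ {a b} → Narrow (a ∷ b ∷ [])
  three : ∀ {a b c} → (∀ .p .q → Filled (critical a b c p q)) → Narrow (a ∷ b ∷ c ∷ [])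
  fourˡ : ∀ x {p c d} → p ⊲ c → x Fin.≤ min p ⊎ x ∈ₛ supp c → Narrow (r x ∷ p ∷ c ∷ d ∷ [])
  fourʳ : ∀ x {p c d} → c ⊲ d → x Fin.≤ min p ⊎ x ∈ₛ supp (p ∪ᵣ c) → Narrow (r x ∷ p ∷ c ∷ d ∷ [])
  four  : ∀ x {p c d} → p ⊲ d → c ⊲ d → x ∈ₛ supp d → Narrow (r x ∷ p ∷ c ∷ d ∷ [])

-- Rewriting the last pair of `fourˡ`, or the middle pair of `fourʳ`, makes that pair irreducible
-- and changes the shape. The alternative on x ensures that merging r x into p in `fourˡ` leaves a
-- triple covered by `filled-r∪`. Once x lies in a row c that is merged into the last one, that row
-- dominates both middle rows: this is `four`, which persists until rows merge.
Narrow-closed : {w w′ : List (Row n)} → Narrow w → Step (Σrow n) w w′ → Narrow w′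
Narrow-closed nar (step l (α u v u⋪v) b p refl) =
  go nar l p (recompute (¬? (u ⊲? v)) u⋪v) (product u v)
  where
  threeˡ : ∀ {a b c : Row n} → a ⊲ b → Narrow (a ∷ b ∷ c ∷ [])
  threeˡ a⊲b = three λ p _ → ⊥-elim-irr (p a⊲b)
  threeʳ : ∀ {a b c : Row n} → b ⊲ c → Narrow (a ∷ b ∷ c ∷ [])
  threeʳ b⊲c = three λ _ q → ⊥-elim-irr (q b⊲c)
  threeᵣ : ∀ (x : Fin n) {b c} → Narrow (r x ∷ b ∷ c ∷ [])
  threeᵣ x = three λ p q → filled-r x {p = p} {q}

  go : ∀ {w} → Narrow w → ∀ l {u v b} → w ≡ l ++ u ∷ v ∷ b → ¬ u ⊲ v →
       ∀ {s} → Product u v s → Narrow (l ++ s ++ b)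
  go none [] ()
  go none (_ ∷ _) ()
  go one [] ()
  go one (_ ∷ []) ()
  go one (_ ∷ _ ∷ _) ()
  go two [] refl _ (single _)     = one
  go two [] refl _ (double _ _ _) = two
  go two (_ ∷ []) ()
  go two (_ ∷ _ ∷ []) ()
  go two (_ ∷ _ ∷ _ ∷ _) ()
  go (three _) [] refl _ (single _)             = two
  go (three _) [] refl _ (double _ _ w⊲)        = threeˡ w⊲
  go (three _) (_ ∷ []) refl _ (single _)       = two
  go (three _) (_ ∷ []) refl _ (double _ _ w⊲)  = threeʳ w⊲
  go (three _) (_ ∷ _ ∷ []) ()
  go (three _) (_ ∷ _ ∷ _ ∷ []) ()
  go (three _) (_ ∷ _ ∷ _ ∷ _ ∷ _) ()
  go (fourˡ x {p} p⊲c x?) [] refl _ uv with letterProduct x p uv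
  ... | single     = three (filled-r∪ x p⊲c x?)
  ... | double p<x with x?
  ...   | inj₁ x≤p = contradiction p<x (ℕ.≤⇒≯ x≤p)
  ...   | inj₂ x∈c = fourˡ x (∪-⊲ (r-⊲ x∈c (ℕ.<-trans (proj₂ p⊲c) p<x)) p⊲c) (inj₂ x∈c)
  go (fourˡ x p⊲c x?) (_ ∷ []) refl p⋪c _ = contradiction p⊲c p⋪c
  go (fourˡ x p⊲c x?) (_ ∷ _ ∷ []) refl _ (single _) = threeᵣ x
  go (fourˡ x p⊲c (inj₁ x≤p)) (_ ∷ _ ∷ []) refl _ (double _ _ c⊲) = fourʳ x c⊲ (inj₁ x≤p)
  go (fourˡ x {p} {c} {d} p⊲c (inj₂ x∈c)) (_ ∷ _ ∷ []) refl _ (double _ _ c⊲) =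
    four x (⊲-⊇ {t = p} {c} {c ∪ᵣ d} (Sub.p⊆p∪q (supp d)) p⊲c) c⊲ (Sub.p⊆p∪q (supp d) x∈c)
  go (fourʳ x {p} {c} c⊲d x?) [] refl _ uv with letterProduct x p uv
  ... | single     = threeʳ c⊲d
  ... | double p<x = fourʳ x c⊲d (inj₂ (Sub.p⊆p∪q (supp c) (∈-r∪ x p)))
  go (fourʳ x c⊲d x?) (_ ∷ []) refl _ (single _) = threeᵣ x
  go (fourʳ x {p} {c} c⊲d x?) (_ ∷ []) refl _ (double e e≡ e⊲) =
    fourˡ x e⊲ (Sum.map₁ (λ x≤p → ℕ.≤-trans x≤p (leftover-min-≤ e p c e≡)) x?)
  go (fourʳ x c⊲d x?) (_ ∷ _ ∷ []) refl c⋪d _ = contradiction c⊲d c⋪d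
  go (four x {p} p⊲d c⊲d x∈d) [] refl _ uv with letterProduct x p uv
  ... | single     = threeʳ c⊲d
  ... | double p<x = four x (∪-⊲ (r-⊲ x∈d (ℕ.<-trans (proj₂ p⊲d) p<x)) p⊲d) c⊲d x∈d
  go (four x p⊲d c⊲d x∈d) (_ ∷ []) refl _ (single _) = threeᵣ x
  go (four x {p} {c} {d} p⊲d c⊲d x∈d) (_ ∷ []) refl _ (double e e≡ e⊲) =
    four x (⊲-⊆ {s = e} {p} {d} (λ y∈ → leftover-⊆ (supp p) (supp c) (subst (_ ∈ₛ_) e≡ y∈)) p⊲d)
           (∪-⊲ {u = p} {c} {d} p⊲d c⊲d) x∈d
  go (four x p⊲d c⊲d x∈d) (_ ∷ _ ∷ []) refl c⋪d _ = contradiction c⊲d c⋪d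
  go (fourˡ _ _ _)   (_ ∷ _ ∷ _ ∷ []) ()
  go (fourʳ _ _ _)   (_ ∷ _ ∷ _ ∷ []) ()
  go (four  _ _ _ _) (_ ∷ _ ∷ _ ∷ []) ()
  go (fourˡ _ _ _)   (_ ∷ _ ∷ _ ∷ _ ∷ []) ()
  go (fourʳ _ _ _)   (_ ∷ _ ∷ _ ∷ _ ∷ []) ()
  go (four  _ _ _ _) (_ ∷ _ ∷ _ ∷ _ ∷ []) ()
  go (fourˡ _ _ _)   (_ ∷ _ ∷ _ ∷ _ ∷ _ ∷ _) ()
  go (fourʳ _ _ _)   (_ ∷ _ ∷ _ ∷ _ ∷ _ ∷ _) ()
  go (four  _ _ _ _) (_ ∷ _ ∷ _ ∷ _ ∷ _ ∷ _) ()

-- Of the two triples of a four-row word, the first starts with r x and the second contains an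
-- irreducible pair.
Narrow-filled : ∀ l {u v t : Row n} b → Narrow (l ++ u ∷ v ∷ t ∷ b) → ∀ .p .q → Filled (critical u v t p q)
Narrow-filled l b nar = go nar l refl
  where
  go : ∀ {w : List (Row n)} → Narrow w → ∀ l {u v t b} → w ≡ l ++ u ∷ v ∷ t ∷ b →
       ∀ .p .q → Filled (critical u v t p q)
  go none [] ()
  go none (_ ∷ _) ()
  go one [] ()
  go one (_ ∷ []) ()
  go one (_ ∷ _ ∷ _) ()
  go two [] ()
  go two (_ ∷ []) ()
  go two (_ ∷ _ ∷ []) ()
  go two (_ ∷ _ ∷ _ ∷ _) ()
  go (three F) [] refl = F
  go (three _) (_ ∷ []) ()
  go (three _) (_ ∷ _ ∷ []) ()
  go (three _) (_ ∷ _ ∷ _ ∷ []) ()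
  go (three _) (_ ∷ _ ∷ _ ∷ _ ∷ _) ()
  go (fourˡ x _ _)   [] refl p q = filled-r x {p = p} {q}
  go (fourʳ x _ _)   [] refl p q = filled-r x {p = p} {q}
  go (four  x _ _ _) [] refl p q = filled-r x {p = p} {q}
  go (fourˡ x p⊲c _)   (_ ∷ []) refl p q = ⊥-elim-irr (p p⊲c)
  go (fourʳ x c⊲d _)   (_ ∷ []) refl p q = ⊥-elim-irr (q c⊲d)
  go (four  x _ c⊲d _) (_ ∷ []) refl p q = ⊥-elim-irr (q c⊲d)
  go (fourˡ _ _ _)   (_ ∷ _ ∷ []) ()
  go (fourʳ _ _ _)   (_ ∷ _ ∷ []) ()
  go (four  _ _ _ _) (_ ∷ _ ∷ []) ()
  go (fourˡ _ _ _)   (_ ∷ _ ∷ _ ∷ []) ()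
  go (fourʳ _ _ _)   (_ ∷ _ ∷ _ ∷ []) ()
  go (four  _ _ _ _) (_ ∷ _ ∷ _ ∷ []) ()
  go (fourˡ _ _ _)   (_ ∷ _ ∷ _ ∷ _ ∷ []) ()
  go (fourʳ _ _ _)   (_ ∷ _ ∷ _ ∷ _ ∷ []) ()
  go (four  _ _ _ _) (_ ∷ _ ∷ _ ∷ _ ∷ []) ()
  go (fourˡ _ _ _)   (_ ∷ _ ∷ _ ∷ _ ∷ _ ∷ _) ()
  go (fourʳ _ _ _)   (_ ∷ _ ∷ _ ∷ _ ∷ _ ∷ _) ()
  go (four  _ _ _ _) (_ ∷ _ ∷ _ ∷ _ ∷ _ ∷ _) ()

Narrow-coherent : {w : List (Row n)} → Narrow w → Coherent w
Narrow-coherent = Squier.coherent Narrow Narrow-closed Narrow-filled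

𝓡·-irreducible : (u v : Row n) → Irreducible (𝓡 (u · v))
𝓡·-irreducible u v with 𝓡 (u · v) | product u v
... | _ | single _      = [-]
... | _ | double _ _ w⊲ = w⊲ ∷ [-]

module _ {n : ℕ} (u v t : Row n) .(p : ¬ u ⊲ v) .(q : ¬ v ⊲ t) (h : 2 ≤ ℓ u) (∂u⋪v : ¬ ∂ u h ⊲ v) where
  private
    x  = min u
    u′ = ∂ u h

    x⋪u′ : ¬ r x ⊲ u′
    x⋪u′ (_ , u′<x) = ℕ.<-asym (∂-min u h) (subst (min u′ Fin.<_) (min-r x) u′<x)

    τ₁ τ₂ τ : Critical n
    τ₁ = critical (r x) u′ v x⋪u′ ∂u⋪v
    τ₂ = critical u′ v t ∂u⋪v q
    τ  = critical u v t p q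

    z = source τ ^

    irr : Irreducible z
    irr = Irreducible-normalForm (source τ)

    -- As x is below all letters of u′, nothing is bumped and the product is the single row u.
    join : Step (Σrow n) (r x ∷ u′ ∷ []) (u ∷ [])
    join = step [] (α (r x) u′ x⋪u′) [] refl
      (sym (trans (List.++-identityʳ _)
        (trans (letterProduct-≤ x u′ (ℕ.<⇒≤ (∂-min u h))) (cong (_∷ []) (∂-∪ u h)))))

    join′ : Step (Σrow n) (r x ∷ source τ₂) (source τ)
    join′ = (join ▷ₛ (v ∷ [])) ▷ₛ (t ∷ [])

    tail : Path (Σrow n) ((r x ∷ []) ++ (source τ₂ ^) ++ []) z
    tail = normalize (~-trans (~-sym (Path-flat ((r x ∷ []) ◁ₚ (L τ₂ ▷ₚ []))))
                              (Path-flat (join′ ◅ L τ))) irr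

    -- `join` followed by α_{u,v} is one side of the branching τ₁, filled because its first row is a
    -- letter. The other side begins with α_{u′,v} under r x, and coherence of the narrow word
    -- reached then allows the continuation by L τ₂. The equation on `f` exposes its first step.
    leftSide : (f : Path (Σrow n) (source τ) z) (g : Path (Σrow n) (𝓡 (u · v) ++ t ∷ []) z) →
               f ≡ (stepOf (α u v p) ▷ₛ (t ∷ [])) ◅ g →
               ⌜ join′ ◅ f ⌝ ⟹ ((r x ∷ []) ◁ (⌜ L τ₂ ⌝ ▷ [])) ◅◅ ⌜ tail ⌝
    leftSide _ g refl =
      (⌜ viaL ⌝ ▷ (t ∷ [])) ◅◅ ⌜ g ⌝
        ⇛⟨ ◅◅-⇛ˡ ⌜ g ⌝ (▷-⇛ square refl) ⟩
      (⌜ viaR ⌝ ▷ (t ∷ [])) ◅◅ ⌜ g ⌝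
        ≅⟨ ≡⇒≅ (sym (trans (⌜⌝-◅◅ (viaR ▷ₚ (t ∷ [])) g) (cong (_◅◅ ⌜ g ⌝) (▷-⌜⌝ viaR (t ∷ []))))) ⟩
      ⌜ (viaR ▷ₚ (t ∷ [])) ◅◅ g ⌝
        ⇛⟨ reroute (r x ∷ []) [] _ _ (subst Coherent (assoc (𝓡 (u′ · v))) (Narrow-coherent narrow))
             irr _ _ tail (raw-injective _ _ refl refl) ⟩
      ((r x ∷ []) ◁ (⌜ L τ₂ ⌝ ▷ [])) ◅◅ ⌜ tail ⌝
        ∎
      where
      viaL : Path (Σrow n) (source τ₁) (𝓡 (u · v))
      viaL = (join ▷ₛ (v ∷ [])) ◅ stepOf (α u v p) ◅ ε
      end : Path (Σrow n) ((source τ₁ ^) ++ []) (𝓡 (u · v))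
      end = normalize (~-trans (~-sym (Path-flat (L τ₁ ▷ₚ []))) (Path-flat viaL)) (𝓡·-irreducible u v)
      viaR : Path (Σrow n) (source τ₁) (𝓡 (u · v))
      viaR = ([] ◁ₚ (R τ₁ ▷ₚ [])) ◅◅ end
      square : ⌜ viaL ⌝ ⟹ ⌜ viaR ⌝
      square =
        ⌜ viaL ⌝
          ⇛⟨ reroute [] [] (join ▷ₛ (v ∷ [])) _ (Narrow-coherent two) (𝓡·-irreducible u v)
               _ _ end (raw-injective _ _ refl refl) ⟩
        ([] ◁ (⌜ L τ₁ ⌝ ▷ [])) ◅◅ ⌜ end ⌝
          ⇛⟨ ◅◅-⇛ˡ ⌜ end ⌝ (◁-⇛ refl (▷-⇛ (het (filled-r x)) refl)) ⟩
        ([] ◁ (⌜ R τ₁ ⌝ ▷ [])) ◅◅ ⌜ end ⌝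
          ≅⟨ ≡⇒≅ (sym (⌜⌝-context [] (R τ₁) [] end)) ⟩
        ⌜ viaR ⌝
          ∎
      -- Whiskering by the empty word in `viaR` leaves a `++ []` in the word after its first step.
      assoc : ∀ s → r x ∷ s ++ t ∷ [] ≡ ((r x ∷ s) ++ []) ++ t ∷ []
      assoc s = cong (_++ t ∷ []) (sym (List.++-identityʳ (r x ∷ s)))
      narrow : Narrow (r x ∷ 𝓡 (u′ · v) ++ t ∷ [])
      narrow with 𝓡 (u′ · v) | product u′ v
      ... | _ | single _       = three λ p q → filled-r x {p = p} {q}
      ... | _ | double w w≡ w⊲ = fourˡ x w⊲
        (inj₁ (ℕ.≤-trans (ℕ.<⇒≤ (∂-min u h)) (leftover-min-≤ w u′ v w≡)))

    -- `join` and α_{v,t} act on disjoint rows, so they are exchanged; the narrow word reached by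
    -- α_{v,t} then allows the continuation by R τ₂, with the same `tail` as on the left.
    rightSide : (f : Path (Σrow n) (source τ) z) (g : Path (Σrow n) (u ∷ 𝓡 (v · t)) z) →
                f ≡ ((u ∷ []) ◁ₛ stepOf (α v t q)) ◅ g →
                ⌜ join′ ◅ f ⌝ ⟹ ((r x ∷ []) ◁ (⌜ R τ₂ ⌝ ▷ [])) ◅◅ ⌜ tail ⌝
    rightSide _ g refl =
      (fwd join′ ◅ fwd ((u ∷ []) ◁ₛ stepOf (α v t q)) ◅ ε) ◅◅ ⌜ g ⌝
        ≅⟨ ≡⇒≅ (cong (_◅◅ ⌜ g ⌝) (≅⇒≡ (raw-injective _
             (((fwd join ◅ ε) ▷ (v ∷ t ∷ [])) ◅◅ ((u ∷ []) ◁ ⟪ α v t q ⟫)) refl refl))) ⟩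
      (((fwd join ◅ ε) ▷ (v ∷ t ∷ [])) ◅◅ ((u ∷ []) ◁ ⟪ α v t q ⟫)) ◅◅ ⌜ g ⌝
        ⇛⟨ ◅◅-⇛ˡ ⌜ g ⌝ (≈⇒⇛ (interchange (fwd join ◅ ε) ⟪ α v t q ⟫)) ⟩
      ⌜ ((r x ∷ u′ ∷ []) ◁ₛ stepOf (α v t q)) ◅ (join ▷ₛ 𝓡 (v · t)) ◅ g ⌝
        ⇛⟨ reroute (r x ∷ []) [] _ _ (Narrow-coherent narrow) irr _ _ tail (raw-injective _ _ refl refl) ⟩
      ((r x ∷ []) ◁ (⌜ R τ₂ ⌝ ▷ [])) ◅◅ ⌜ tail ⌝
        ∎
      where
      narrow : Narrow (r x ∷ u′ ∷ 𝓡 (v · t))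
      narrow with 𝓡 (v · t) | product v t
      ... | _ | single _     = three λ p q → filled-r x {p = p} {q}
      ... | _ | double _ _ w⊲ = fourʳ x w⊲ (inj₁ (ℕ.<⇒≤ (∂-min u h)))

  -- The two sides are compared after precomposition with `join′`, which is cancelled since 2-cells
  -- are invertible.
  filled-𝔖 : Filled τ₂ → Filled τ
  filled-𝔖 filled = ⇛⇒Track₃ (cancelˡ (fwd join′ ◅ ε) (⇛-trans (leftSide (L τ) _ refl) (⇛-trans
    (◅◅-⇛ˡ ⌜ tail ⌝ (◁-⇛ refl (▷-⇛ (het filled) refl))) (⇛-sym (rightSide (R τ) _ refl)))))

filled : (τ : Critical n) → Filled τ
filled τ = go (ℓ (Critical.row₁ τ)) τ ℕ.≤-refl (𝔖? τ)
  where
  go : ∀ k (τ : Critical n) → ℓ (Critical.row₁ τ) ≤ k → Dec (𝔖 τ) → Filled τ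
  go k         τ                      u≤k (no ∉𝔖)          = gen₃ (triple τ ∉𝔖)
  go ℕ.zero    (critical u v t p q)   u≤0 (yes (h , _))    = contradiction (ℕ.≤-trans h u≤0) λ ()
  go (ℕ.suc k) (critical u v t p q)   u≤k (yes (h , ∂u⋪v)) = filled-𝔖 u v t p q h ∂u⋪v
    (go k τ′ (ℕ.≤-pred (ℕ.≤-trans (∂-length u h) u≤k)) (𝔖? τ′))
    where
    τ′ = critical (∂ u h) v t ∂u⋪v q

-- The second use of the relative theorem, for the class of all words, now that every critical
-- triple is filled.
Σrow-basis : ∀ n → IsHomotopyBasis (Σrow₃ n)
Σrow-basis n = coherent⇒basis λ w →
  Squier.coherent (λ _ → ⊤) (λ _ _ → tt) (λ l {u} {v} {t} b _ p q → filled (critical u v t p q)) tt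

-- Finiteness and computability

-- A list that is complete and free of duplicates serves both as a bijection with an initial segment
-- and as the output of the algorithm.
record Enumeration (A : Set) : Set where
  field
    elements : List A
    unique   : Unique elements
    complete : ∀ a → a ∈ elements

open Enumeration

enumeration : {A : Set} → DecidableEquality A → (xs : List A) → (∀ a → a ∈ xs) → Enumeration A
enumeration _≟_ xs complete = record
  { elements = deduplicate _≟_ xs
  ; unique   = Deduplicate.deduplicate-! _≟_ xs
  ; complete = λ a → ∈-deduplicate⁺ _≟_ (complete a)
  }

enumeration⇒finite : {A : Set} → Enumeration A → IsFinite A
enumeration⇒finite {A} E = length (elements E) , mk↔ₛ′ index (lookup (elements E))
  (λ i → lookup-injective (unique E) _ _ (lookup-index _)) (λ a → lookup-index a)
  where
  index : A → Fin (length (elements E))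
  index a = Any.index (complete E a)
  lookup-index : ∀ a → lookup (elements E) (index a) ≡ a
  lookup-index a = sym (Any.lookup-index (complete E a))

_≟ₛ_ : DecidableEquality (StylCell n)
η x          ≟ₛ η x′             = map′ (cong η) (λ { refl → refl }) (x Fin.≟ x′)
κ x y z _ _  ≟ₛ κ x′ y′ z′ _ _   = map′ (λ { (refl , refl , refl) → refl }) (λ { refl → refl , refl , refl })
                                     (x Fin.≟ x′ ×-dec y Fin.≟ y′ ×-dec z Fin.≟ z′)
ƛ x y z _ _  ≟ₛ ƛ x′ y′ z′ _ _   = map′ (λ { (refl , refl , refl) → refl }) (λ { refl → refl , refl , refl })
                                     (x Fin.≟ x′ ×-dec y Fin.≟ y′ ×-dec z Fin.≟ z′)
η _          ≟ₛ κ _ _ _ _ _      = no λ ()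
η _          ≟ₛ ƛ _ _ _ _ _      = no λ ()
κ _ _ _ _ _  ≟ₛ η _              = no λ ()
κ _ _ _ _ _  ≟ₛ ƛ _ _ _ _ _      = no λ ()
ƛ _ _ _ _ _  ≟ₛ η _              = no λ ()
ƛ _ _ _ _ _  ≟ₛ κ _ _ _ _ _      = no λ ()

_≟ₚ_ : DecidableEquality (PreRowCell n)
(δ ʳ)  ≟ₚ (δ′ ʳ)  = map′ (cong _ʳ) (λ { refl → refl }) (δ ≟ₛ δ′)
γ u _  ≟ₚ γ u′ _  = map′ (λ { refl → refl }) (λ { refl → refl }) (u ≟ᵣ u′)
(_ ʳ)  ≟ₚ γ _ _   = no λ ()
γ _ _  ≟ₚ (_ ʳ)   = no λ ()

shortRows : ∀ n → Enumeration (ShortRow n)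
shortRows n = enumeration
  (λ { (short u _) (short v _) → map′ (λ { refl → refl }) (λ { refl → refl }) (u ≟ᵣ v) })
  (map shortRow (allFin n)) (λ a → subst (_∈ _) (short≡ a) (∈-map⁺ shortRow (∈-allFin (letter a))))

letterCells : ∀ n → Enumeration (LetterCell n)
letterCells n = enumeration
  (λ { (kept δ _) (kept δ′ _) → map′ (λ { refl → refl }) (λ { refl → refl }) (δ ≟ₚ δ′) })
  (map (λ δ → kept (δ ʳ) (λ ())) (stylCells n))
  (λ { (kept (δ ʳ) _)    → ∈-map⁺ _ (∈-stylCells δ)
     ; (kept (γ u h) ¬γ) → ⊥-elim-irr (¬γ (isγ u h)) })

∈-subsets : (p : Subset n) → p ∈ subsets n
∈-subsets []            = here refl
∈-subsets {ℕ.suc n} (outside ∷ p) = ∈-++⁺ˡ (∈-map⁺ (outside ∷_) (∈-subsets p))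
∈-subsets {ℕ.suc n} (inside  ∷ p) =
  ∈-++⁺ʳ (map (outside ∷_) (subsets n)) (∈-++⁺ˡ (∈-map⁺ (inside ∷_) (∈-subsets p)))

∈-rows : (u : Row n) → u ∈ rows n
∈-rows u = ∈-mapMaybe (∈-subsets (supp u)) (when-yes (Sub.nonempty? (supp u)) (nonemptyᵣ u) (λ _ → refl))

∈-criticals : (τ : Critical n) → τ ∈ criticals n
∈-criticals (critical u v t p q) = ∈-mapMaybe
  (∈-cartesianProduct (∈-rows u) (∈-cartesianProduct (∈-rows v) (∈-rows t)))
  (when-yes (¬? (u ⊲? v) ×-dec ¬? (v ⊲? t))
    (recompute (¬? (u ⊲? v)) p , recompute (¬? (v ⊲? t)) q) (λ _ → refl))

∈-triples : (τ : 𝔗¹ n) → τ ∈ triples n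
∈-triples (triple τ ∉𝔖) = ∈-mapMaybe (∈-criticals τ)
  (when-yes (¬? (𝔖? τ)) (recompute (¬? (𝔖? τ)) ∉𝔖) (λ _ → refl))

preRowCells : ∀ n → List (PreRowCell n)
preRowCells n = map _ʳ (stylCells n) ++ mapMaybe (λ u → when (λ h → γ u h) (2 ℕ.≤? ℓ u)) (rows n)

∈-preRowCells : (δ : PreRowCell n) → δ ∈ preRowCells n
∈-preRowCells     (δ ʳ)   = ∈-++⁺ˡ (∈-map⁺ _ʳ (∈-stylCells δ))
∈-preRowCells {n} (γ u h) = ∈-++⁺ʳ (map _ʳ (stylCells n))
  (∈-mapMaybe (∈-rows u) (when-yes (2 ℕ.≤? ℓ u) (recompute (2 ℕ.≤? ℓ u) h) (λ _ → refl)))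

cells₃ : ∀ n → Enumeration (Gen₃ (Σstyl₃ n))
cells₃ n = enumeration (Sum.≡-dec _≟₃_ _≟ₚ_)
  (map inj₁ (mapMaybe (λ τ → when (λ ∉ → 𝒳 τ ∉) (unmatched? τ)) (triples n)) ++ map inj₂ (preRowCells n))
  (λ { (inj₁ (𝒳 τ ∉)) → ∈-++⁺ˡ (∈-map⁺ inj₁ (∈-mapMaybe (∈-triples τ)
         (when-yes (unmatched? τ) (recompute (unmatched? τ) ∉) (λ _ → refl))))
     ; (inj₂ δ) → ∈-++⁺ʳ (map inj₁ (mapMaybe _ (triples n))) (∈-map⁺ inj₂ (∈-preRowCells δ)) })
  where
  open Reduction (collapsed n) (collapsed-acyclic n)
  unmatched? : ∀ τ → Dec (¬ Any (λ e → τ ≡ triple-of e) (collapsed n))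
  unmatched? τ = ¬? (any? (λ e → τ ≟ₜ triple-of e) (collapsed n))
  _≟₃_ : DecidableEquality RedCell₃
  𝒳 τ _ ≟₃ 𝒳 τ′ _ = map′ (λ { refl → refl }) (λ { refl → refl }) (τ ≟ₜ τ′)

Σstylcoh-finite : ∀ n → IsFinitePolygraph (Σstylcoh₃ n)
Σstylcoh-finite n = record
  { finite₁ = enumeration⇒finite (shortRows n)
  ; finite₂ = enumeration⇒finite (letterCells n)
  ; finite₃ = enumeration⇒finite (cells₃ n)
  }

Σstyl₃-computable : EffectivelyComputable Σstyl₃
Σstyl₃-computable = (λ n → map (withBoundary n) (elements (cells₃ n))) , λ n _ →
  Unique.map⁺ (cong proj₁) (unique (cells₃ n)) ,
  (λ A → ∈-map⁺ (withBoundary n) (complete (cells₃ n) A)) ,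
  λ { A∈ → boundary-of n (∈-map⁻ (withBoundary n) A∈) }
  where
  withBoundary : ∀ n → Gen₃ (Σstyl₃ n) → Gen₃ (Σstyl₃ n) × Boundary (Σstyl n)
  withBoundary n A = A , boundary (Σstyl₃ n) A
  boundary-of : ∀ n {A b} → ∃ (λ A′ → A′ ∈ elements (cells₃ n) × (A , b) ≡ withBoundary n A′) →
                b ≡ boundary (Σstyl₃ n) A
  boundary-of n (_ , _ , refl) = refl

theorem4p4p5 : (∀ n → 1 ≤ n →
    IsFinitePolygraph (Σstylcoh₃ n)
    × IsCoherentPresentation (Σstylcoh₃ n) (Styl n)
    × (∀ (x : Fin n) → letter (shortRow x) ≡ x)
    × IsIsomorphism (Σstylcoh n) (Σstyl n) letter stylCell
    × IsHomotopyBasis (Σstyl₃ n))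
    × EffectivelyComputable Σstyl₃
theorem4p4p5 = (λ n _ →
    Σstylcoh-finite n
  , record { presents = Σstylcoh-presents n ; homotopyBasis = stylcoh-basis n }
  , min-r
  , stylCell-isomorphism n
  , Σstyl-basis n (stylcoh-basis n))
  , Σstyl₃-computable
  where
  stylcoh-basis : ∀ n → IsHomotopyBasis (Σstylcoh₃ n)
  stylcoh-basis n = Σstylcoh-basis n (Σprerow-basis n (Σrow-basis n))
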